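{- Let $k\geq 3$ be an integer. There exists a constant $\beta=\beta(k)$ with $0<\beta<1/(3^{k}\,2k^{5}\,(k!))^4$ such that the following holds for all sufficiently large integers $n$. Let $m$ be an integer with $1\leq m\leq \left(\frac{k}{2(k-1)}-\beta\right)\frac{n}{k}$, and let $H$ be a $k$-graph with $n$ vertices. If $\delta_1(H)>\binom{n-1}{k-1}-\binom{n-m}{k-1}$, then $\nu(H)\geq m$.
   Context: A $k$-graph (i.e. $k$-uniform hypergraph) $H$ consists of a vertex set $V(H)$ and an edge set $E(H)\subseteq\binom{V(H)}{k}$. For a vertex $v$, $d_H(v)$ is the number of edges containing $v$, and $\delta_1(H)=\min_{v\in V(H)} d_H(v)$ is the minimum vertex degree. A matching is a set of pairwise disjoint edges, and $\nu(H)$ is the maximum size of a matching in $H$. -}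

module Defs where

open import Data.Nat using (ℕ; zero; suc; _!; _≤_; _<_; _*_; _∸_; _^_; NonZero; s≤s; z≤n)
open import Data.Nat.Properties using (m*n≢0; m^n≢0; _!≢0)
open import Data.Fin using (Fin)
open import Data.Fin.Subset using (Subset; ∣_∣; _∩_; Empty)
open import Data.Fin.Subset.Properties using (_∈?_)
open import Data.List using (List; length; filter)
open import Data.List.Relation.Unary.All using (All)
open import Data.List.Relation.Unary.AllPairs using (AllPairs)
open import Data.List.Relation.Unary.Unique.Propositional using (Unique)
open import Data.List.Membership.Propositional using (_∈_)
open import Data.Product using (Σ; _×_)
open import Relation.Binary.PropositionalEquality using (_≡_)

record KGraph (k n : ℕ) : Set where
  field
    edges   : List (Subset n)
    uniform : All (λ e → ∣ e ∣ ≡ k) edges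
    simple  : Unique edges
open KGraph public

degree : ∀ {k n} → KGraph k n → Fin n → ℕ
degree H v = length (filter (v ∈?_) (edges H))

MinDegreeGreaterThan : ∀ {k n} → KGraph k n → ℕ → Set
MinDegreeGreaterThan {n = n} H x = (v : Fin n) → x < degree H v

IsMatching : ∀ {k n} → KGraph k n → List (Subset n) → Set
IsMatching H M = All (_∈ edges H) M × AllPairs (λ e f → Empty (e ∩ f)) M

MatchingNumberAtLeast : ∀ {k n} → KGraph k n → ℕ → Set
MatchingNumberAtLeast {n = n} H m =
  Σ (List (Subset n)) λ M → IsMatching H M × m ≤ length M

nz-k : ∀ k → 3 ≤ k → NonZero k
nz-k (suc k) _ = _

nz-2k-1 : ∀ k → 3 ≤ k → NonZero (2 * (k ∸ 1))
nz-2k-1 (suc (suc k)) _ = _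
nz-2k-1 (suc zero) (s≤s ())

betaDen : ℕ → ℕ
betaDen k = (3 ^ k * 2 * k ^ 5 * k !) ^ 4

nz-betaDen : ∀ k → 3 ≤ k → NonZero (betaDen k)
nz-betaDen (suc k) _ = m^n≢0 (3 ^ suc k * 2 * suc k ^ 5 * suc k !) 4
  {{m*n≢0 (3 ^ suc k * 2 * suc k ^ 5) (suc k !) {{m*n≢0 (3 ^ suc k * 2) (suc k ^ 5) {{m*n≢0 (3 ^ suc k) 2 {{m^n≢0 3 (suc k)}}}} {{m^n≢0 (suc k) 5}}}} {{suc k !≢0}}}}

module Submission where

-- Let M be a maximum matching, of size less than m, let W be the set of uncovered vertices and l = k - 1.
-- An l-set f is rich if f ∪ {w} is an edge for many w ∈ W, and an edge of M is good if it contains a heavy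
-- vertex, that is, a vertex lying in many rich sets whose other elements are in W. Delete one heavy vertex
-- from each good edge. Heavy vertices can be matched into W at will, so after the deletion no t + 1 disjoint
-- rich sets meet at most t of the b bad edges (t bounded).
-- If b = 0, every edge that meets W contains a deleted vertex, and the vertices of W have too small a degree.
-- Otherwise sample t bad edges and proportionally many other vertices. The rich sets in the sample form an
-- l-graph on about 2 l t or more vertices without t + 1 disjoint edges, and Frankl's argument for the Erdős
-- matching conjecture (shifting, the shadow bound |F| ≤ t |∂F|, averaging over partitions) bounds their number.
-- As bad edges contain no heavy vertex, hardly any rich set has l - 1 elements in W; shifting preserves
-- this property, and it improves Frankl's bound by a constant factor. This contradicts the lower bound on the
-- number of rich sets that the degree condition yields by averaging over W.

open import Data.Nat as ℕ hiding (_/_)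
open import Data.Nat.Properties
open import Data.Nat.Tactic.RingSolver using (solve-∀)
open import Data.Bool as Bool using (Bool; true; false; _∧_; _∨_; not; if_then_else_)
open import Data.List using (List; []; _∷_; _++_; map; length; concat; concatMap; filter; allFin; cartesianProductWith)
open import Data.List.Properties using (length-++; length-map; ++-assoc; ++-identityʳ; concat-map-[_]; length-tabulate)
open import Data.List.Membership.Propositional using (_∈_; _∉_; find; lose)
open import Data.List.Relation.Unary.Any using (here; there; any?)
open import Data.Vec as Vec using (Vec; []; _∷_)
open import Data.Product using (Σ; _×_; _,_; proj₁; proj₂)
open import Data.Sum using (_⊎_; inj₁; inj₂)
open import Data.Empty using (⊥; ⊥-elim)
open import Function using (_∘_; case_of_)
open import Relation.Nullary using (¬_; Dec; yes; no; does; ¬?)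
open import Relation.Binary.PropositionalEquality hiding ([_])
open import Data.List.Membership.Propositional.Properties using (∈-++⁺ˡ; ∈-++⁺ʳ; ∈-map⁺; ∈-++⁻; ∈-map⁻; ∈-concat⁻′; ∈-∃++; ∈-concat⁺′; ∈-filter⁺; ∈-filter⁻; ∈-allFin; ∈-cartesianProductWith⁺; ∈-cartesianProductWith⁻)
open import Data.Vec.Properties as VecP using (map-replicate; map-++)
open import Data.Fin using (Fin; zero; suc; toℕ; fromℕ; fromℕ<; inject₁)
open import Data.Fin.Properties as FinP using (toℕ-fromℕ; toℕ-injective; toℕ-fromℕ<; toℕ<n)
open import Data.Maybe as Maybe using (Maybe; just; nothing)
open import Data.Fin.Relation.Unary.Top using (view; ‵fromℕ; ‵inject₁)
open import Data.List.Relation.Unary.All as All using (All; []; _∷_)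
open import Data.List.Relation.Unary.AllPairs as AllPairs using (AllPairs; []; _∷_)
open import Data.List.Relation.Unary.Unique.Propositional using (Unique)
import Data.List.Relation.Unary.Unique.Propositional.Properties as UniqueP
open import Relation.Binary using (DecidableEquality)
open import Data.List.Relation.Binary.Permutation.Propositional as Perm using (_↭_; ↭-refl; ↭-sym; ↭-trans; prep; swap)
open import Data.List.Relation.Binary.Permutation.Propositional.Properties as PermP using (↭-length; ∈-resp-↭)
import Data.List.Relation.Unary.All.Properties as AllP
open import Data.List.Relation.Binary.Disjoint.Propositional using (Disjoint)
import Data.List.Membership.DecPropositional as DecMem
open import Relation.Binary.Definitions using (Tri; tri<; tri≈; tri>)
import Data.List.Relation.Unary.AllPairs.Properties as AllPairsP
open import Data.Nat.DivMod using (_%_; m/n*n≤m; m≡m%n+[m/n]*n; m%n<n)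
open import Defs
import Data.Fin.Subset as S
import Data.Fin.Subset.Properties as SP
import Data.Bool.Properties as BoolP
open import Data.List.Membership.Propositional.Properties.WithK using (unique∧set⇒bag)
open import Data.List.Relation.Binary.BagAndSetEquality using (∼bag⇒↭)
open import Function.Bundles using (mk⇔)
open import Relation.Nullary.Decidable using (dec-true)
open import Data.Nat.Combinatorics using (_C_; nCk+nC[k+1]≡[n+1]C[k+1]; k>n⇒nCk≡0; nCk≡nC[n∸k]; nCn≡1)

-- The `k`-graph of all edges that meet m - 1 fixed vertices just fails the degree condition.
-- Accordingly, the lower bound on the number of rich sets and the matching bound have the same
-- leading term, the number of `l`-sets that meet a set of `b` vertices. Frankl's inequality alone
-- therefore yields nothing: a surplus is needed that outweighs the cost of sampling and of the sets
-- that are not rich. The room for it comes from the bound on m. It makes a sample have about 2 l t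
-- vertices, while Frankl's averaging needs only about (2 l - 1) t; the spare vertices hold `z`
-- further colour classes. The surplus grows in proportion to `z`, and the sampling error is bounded
-- in terms of `l` alone. So `z` is fixed first, then t large enough for `z`, then the thresholds
-- `q` and `Q`, and n last. Bounded t is what makes the exchange argument affordable: a bounded
-- number of replacements uses a bounded number of vertices of W, so constant thresholds for
-- richness and heaviness suffice, and the sets that are not rich cost only a term of order b n ^ (l
-- - 2).

private variable
  A B : Set
  n m : ℕ

bit : Bool → ℕ
bit true = 1
bit false = 0

bit≤1 : ∀ b → bit b ≤ 1
bit≤1 true = ≤-refl
bit≤1 false = z≤n

+-interchange : ∀ a b c d → (a + b) + (c + d) ≡ (a + c) + (b + d)
+-interchange = solve-∀

-- Finite sums

∑ : List A → (A → ℕ) → ℕ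
∑ [] φ = 0
∑ (x ∷ xs) φ = φ x + ∑ xs φ

∑-++ : ∀ (xs ys : List A) φ → ∑ (xs ++ ys) φ ≡ ∑ xs φ + ∑ ys φ
∑-++ [] ys φ = refl
∑-++ (x ∷ xs) ys φ = trans (cong (φ x +_) (∑-++ xs ys φ)) (sym (+-assoc (φ x) _ _))

∑-map : ∀ (f : A → B) xs φ → ∑ (map f xs) φ ≡ ∑ xs (φ ∘ f)
∑-map f [] φ = refl
∑-map f (x ∷ xs) φ = cong (φ (f x) +_) (∑-map f xs φ)

∑-concatMap : ∀ (f : A → List B) xs φ → ∑ (concatMap f xs) φ ≡ ∑ xs (λ x → ∑ (f x) φ)
∑-concatMap f [] φ = refl
∑-concatMap f (x ∷ xs) φ = trans (∑-++ (f x) _ φ) (cong (∑ (f x) φ +_) (∑-concatMap f xs φ))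

∑-cong-∈ : ∀ (xs : List A) {φ ψ} → (∀ x → x ∈ xs → φ x ≡ ψ x) → ∑ xs φ ≡ ∑ xs ψ
∑-cong-∈ [] e = refl
∑-cong-∈ (x ∷ xs) e = cong₂ _+_ (e x (here refl)) (∑-cong-∈ xs (λ y y∈ → e y (there y∈)))

∑-cong : ∀ (xs : List A) {φ ψ} → (∀ x → φ x ≡ ψ x) → ∑ xs φ ≡ ∑ xs ψ
∑-cong xs e = ∑-cong-∈ xs (λ x _ → e x)

∑-mono-∈ : ∀ (xs : List A) {φ ψ} → (∀ x → x ∈ xs → φ x ≤ ψ x) → ∑ xs φ ≤ ∑ xs ψ
∑-mono-∈ [] e = z≤n
∑-mono-∈ (x ∷ xs) e = +-mono-≤ (e x (here refl)) (∑-mono-∈ xs (λ y y∈ → e y (there y∈)))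

∑-mono : ∀ (xs : List A) {φ ψ} → (∀ x → φ x ≤ ψ x) → ∑ xs φ ≤ ∑ xs ψ
∑-mono xs e = ∑-mono-∈ xs (λ x _ → e x)

∑-+ : ∀ (xs : List A) φ ψ → ∑ xs (λ x → φ x + ψ x) ≡ ∑ xs φ + ∑ xs ψ
∑-+ [] φ ψ = refl
∑-+ (x ∷ xs) φ ψ = trans (cong (φ x + ψ x +_) (∑-+ xs φ ψ)) (+-interchange (φ x) (ψ x) _ _)

∑-*ˡ : ∀ c (xs : List A) φ → ∑ xs (λ x → c * φ x) ≡ c * ∑ xs φ
∑-*ˡ c [] φ = sym (*-zeroʳ c)
∑-*ˡ c (x ∷ xs) φ = trans (cong (c * φ x +_) (∑-*ˡ c xs φ)) (sym (*-distribˡ-+ c (φ x) _))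

∑-*ʳ : ∀ (xs : List A) φ c → ∑ xs (λ x → φ x * c) ≡ ∑ xs φ * c
∑-*ʳ [] φ c = refl
∑-*ʳ (x ∷ xs) φ c = trans (cong (φ x * c +_) (∑-*ʳ xs φ c)) (sym (*-distribʳ-+ c (φ x) _))

∑-const : ∀ (xs : List A) c → ∑ xs (λ _ → c) ≡ length xs * c
∑-const [] c = refl
∑-const (x ∷ xs) c = cong (c +_) (∑-const xs c)

∑-zero-∈ : ∀ (xs : List A) {φ} → (∀ x → x ∈ xs → φ x ≡ 0) → ∑ xs φ ≡ 0
∑-zero-∈ xs e = trans (∑-cong-∈ xs e) (trans (∑-const xs 0) (*-zeroʳ (length xs)))

∑-zero : ∀ (xs : List A) {φ} → (∀ x → φ x ≡ 0) → ∑ xs φ ≡ 0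
∑-zero xs e = ∑-zero-∈ xs (λ x _ → e x)

∑-swap : ∀ (xs : List A) (ys : List B) (φ : A → B → ℕ) → ∑ xs (λ x → ∑ ys (φ x)) ≡ ∑ ys (λ y → ∑ xs (λ x → φ x y))
∑-swap [] ys φ = sym (∑-zero ys (λ _ → refl))
∑-swap (x ∷ xs) ys φ = trans (cong (∑ ys (φ x) +_) (∑-swap xs ys φ)) (sym (∑-+ ys (φ x) (λ y → ∑ xs (λ x → φ x y))))

∑-bound-∈ : ∀ (xs : List A) {φ} c → (∀ x → x ∈ xs → φ x ≤ c) → ∑ xs φ ≤ length xs * c
∑-bound-∈ xs c e = ≤-trans (∑-mono-∈ xs e) (≤-reflexive (∑-const xs c))

∑-term : ∀ {xs : List A} {x} φ → x ∈ xs → φ x ≤ ∑ xs φ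
∑-term φ (here refl) = m≤m+n _ _
∑-term φ (there {x = y} p) = ≤-trans (∑-term φ p) (m≤n+m _ (φ y))

∑-positive : ∀ (xs : List A) φ → 0 < ∑ xs φ → Σ A λ x → x ∈ xs × 0 < φ x
∑-positive (x ∷ xs) φ p with φ x in eq
... | suc _ = x , here refl , subst (0 <_) (sym eq) z<s
... | zero with ∑-positive xs φ p
... | y , y∈ , q = y , there y∈ , q

-- Binomial coefficients

-- Structural recursion makes Pascal's rule hold by computation, and the inductions over vectors and
-- lists follow that rule. `bin≡C` identifies these numbers with the library's coefficients.
bin : ℕ → ℕ → ℕ
bin n zero = 1
bin zero (suc k) = 0
bin (suc n) (suc k) = bin n k + bin n (suc k)

bin-mono : ∀ {m n} k → m ≤ n → bin m k ≤ bin n k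
bin-mono zero m≤n = ≤-refl
bin-mono (suc k) z≤n = z≤n
bin-mono (suc k) (s≤s m≤n) = +-mono-≤ (bin-mono k m≤n) (bin-mono (suc k) m≤n)

bin-≤-^ : ∀ n k → bin n k ≤ n ^ k
bin-≤-^ n zero = ≤-refl
bin-≤-^ zero (suc k) = z≤n
bin-≤-^ (suc n) (suc k) = begin
  bin n k + bin n (suc k) ≤⟨ +-mono-≤ (bin-≤-^ n k) (bin-≤-^ n (suc k)) ⟩
  n ^ k + n * n ^ k ≤⟨ *-monoʳ-≤ (suc n) (^-monoˡ-≤ k (n≤1+n n)) ⟩
  suc n * suc n ^ k ∎
  where open ≤-Reasoning

-- Each of the `a` additional elements lies in at most `bin (a + n) k` of the sets.
bin-add-≤ : ∀ a n k → bin (a + n) (suc k) ≤ bin n (suc k) + a * bin (a + n) k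
bin-add-≤ zero n k = ≤-reflexive (sym (+-identityʳ _))
bin-add-≤ (suc a) n k = begin
  bin (a + n) k + bin (a + n) (suc k)
    ≤⟨ +-mono-≤ (bin-mono k (n≤1+n (a + n))) (≤-trans (bin-add-≤ a n k) (+-monoʳ-≤ (bin n (suc k)) (*-monoʳ-≤ a (bin-mono k (n≤1+n (a + n)))))) ⟩
  bin (suc a + n) k + (bin n (suc k) + a * bin (suc a + n) k) ≡⟨ lem (bin (suc a + n) k) (bin n (suc k)) (a * bin (suc a + n) k) ⟩
  bin n (suc k) + suc a * bin (suc a + n) k ∎
  where
  open ≤-Reasoning
  lem : ∀ x y z → x + (y + z) ≡ y + (x + z)
  lem = solve-∀

bin-self-pos : ∀ {n k} → k ≤ n → 0 < bin n k
bin-self-pos {k = zero} _ = z<s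
bin-self-pos {suc n} {suc k} (s≤s p) = <-≤-trans (bin-self-pos p) (m≤m+n _ _)

bin-1 : ∀ n → bin n 1 ≡ n
bin-1 zero = refl
bin-1 (suc n) = cong suc (bin-1 n)

-- Bit vectors as subsets

card : Vec Bool n → ℕ
card [] = 0
card (b ∷ v) = bit b + card v

cocard : Vec Bool n → ℕ
cocard [] = 0
cocard (b ∷ v) = bit (not b) + cocard v

card+cocard : ∀ (v : Vec Bool n) → card v + cocard v ≡ n
card+cocard [] = refl
card+cocard (true ∷ v) = cong suc (card+cocard v)
card+cocard (false ∷ v) = trans (+-suc _ _) (cong suc (card+cocard v))

vecs : ∀ n → List (Vec Bool n)
vecs zero = [] ∷ []
vecs (suc n) = map (false ∷_) (vecs n) ++ map (true ∷_) (vecs n)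

∑-vecs : ∀ n (φ : Vec Bool (suc n) → ℕ) →
  ∑ (vecs (suc n)) φ ≡ ∑ (vecs n) (φ ∘ (false ∷_)) + ∑ (vecs n) (φ ∘ (true ∷_))
∑-vecs n φ = trans (∑-++ (map (false ∷_) (vecs n)) _ φ) (cong₂ _+_ (∑-map (false ∷_) (vecs n) φ) (∑-map (true ∷_) (vecs n) φ))

∑-vecs-++ : ∀ y m (φ : Vec Bool (y + m) → ℕ) →
  ∑ (vecs (y + m)) φ ≡ ∑ (vecs y) (λ v → ∑ (vecs m) (λ w → φ (v Vec.++ w)))
∑-vecs-++ zero m φ = sym (+-identityʳ _)
∑-vecs-++ (suc y) m φ = trans (∑-vecs (y + m) φ) (trans
  (cong₂ _+_ (∑-vecs-++ y m (φ ∘ (false ∷_))) (∑-vecs-++ y m (φ ∘ (true ∷_))))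
  (sym (∑-vecs y (λ v → ∑ (vecs m) (λ w → φ (v Vec.++ w))))))

infix 4 _==_
_==_ : ℕ → ℕ → Bool
_==_ = _≡ᵇ_

==-true : ∀ m n → (m == n) ≡ true → m ≡ n
==-true zero zero _ = refl
==-true (suc m) (suc n) e = cong suc (==-true m n e)

==-refl : ∀ n → (n == n) ≡ true
==-refl zero = refl
==-refl (suc n) = ==-refl n

count-card : ∀ n k → ∑ (vecs n) (λ v → bit (card v == k)) ≡ bin n k
count-card zero zero = refl
count-card zero (suc k) = refl
count-card (suc n) zero = trans (∑-vecs n _) (cong₂ _+_ (count-card n zero) (∑-zero (vecs n) (λ _ → refl)))
count-card (suc n) (suc k) = trans (∑-vecs n _) (trans (cong₂ _+_ (count-card n (suc k)) (count-card n k)) (+-comm (bin n (suc k)) (bin n k)))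

bit-true : ∀ {b} → b ≡ true → bit b ≡ 1
bit-true refl = refl

bit-pos : ∀ b → 0 < bit b → b ≡ true
bit-pos true _ = refl

bit-imp : ∀ {b c} → (b ≡ true → c ≡ true) → bit b ≤ bit c
bit-imp {false} _ = z≤n
bit-imp {true} h = ≤-reflexive (sym (bit-true (h refl)))

-- Shifting

Fam : ℕ → Set
Fam n = Vec Bool n → Bool

size : Fam n → ℕ
size {n} F = ∑ (vecs n) (bit ∘ F)

Uniform : ℕ → Fam n → Set
Uniform l F = ∀ v → F v ≡ true → card v ≡ l

-- Elements move towards the tail, so the last positions play the part of the first vertices in the usual convention.
infix 4 _⟶_
data _⟶_ : Vec Bool n → Vec Bool n → Set where
  here  : {v : Vec Bool n} → (true ∷ false ∷ v) ⟶ (false ∷ true ∷ v)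
  there : {x : Bool} {v w : Vec Bool n} → v ⟶ w → (x ∷ v) ⟶ (x ∷ w)

Shifted : Fam n → Set
Shifted F = ∀ {v w} → v ⟶ w → F v ≡ true → F w ≡ true

-- Frankl's shift, for the neighbouring positions `j` and `j + 1` only. This is enough, since longer
-- moves are composed of adjacent ones, as in `move-head`.
shift : ℕ → Fam n → Fam n
shift zero F (true ∷ false ∷ v) = F (true ∷ false ∷ v) ∧ F (false ∷ true ∷ v)
shift zero F (false ∷ true ∷ v) = F (false ∷ true ∷ v) ∨ F (true ∷ false ∷ v)
shift zero F v = F v
shift (suc j) F (x ∷ v) = shift j (F ∘ (x ∷_)) v
shift (suc j) F [] = F []

moved : ℕ → Fam n → Fam n
moved zero F (true ∷ false ∷ v) = F (true ∷ false ∷ v) ∧ not (F (false ∷ true ∷ v))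
moved zero F v = false
moved (suc j) F (x ∷ v) = moved j (F ∘ (x ∷_)) v
moved (suc j) F [] = false

Drops : ℕ → (Vec Bool n → ℕ) → Set
Drops δ ω = ∀ {v w} → v ⟶ w → ω v ≡ δ + ω w

-- One identity with two uses: the constant weight 1 with `δ = 0` shows that shifting keeps the
-- number of members, and `weight` with `δ = 1` shows that each moved member lowers the total weight
-- by one.
shift-weight : ∀ j (F : Fam n) (ω : Vec Bool n → ℕ) δ → Drops δ ω →
  ∑ (vecs n) (λ v → bit (shift j F v) * ω v) + δ * size (moved j F) ≡ ∑ (vecs n) (λ v → bit (F v) * ω v)
shift-weight {zero} zero F ω δ d = trans (cong (∑ (vecs 0) (λ v → bit (F v) * ω v) +_) (*-zeroʳ δ)) (trans (+-identityʳ _) (cong (_+ 0) (lem [])))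
  where
  lem : ∀ (v : Vec Bool 0) → bit (shift zero F v) * ω v ≡ bit (F v) * ω v
  lem [] = refl
shift-weight {suc zero} zero F ω δ d = trans (cong (∑ (vecs 1) (λ v → bit (F v) * ω v) +_) (*-zeroʳ δ)) (+-identityʳ _)
shift-weight {suc (suc n)} zero F ω δ d = begin
  ∑ (vecs (2 + n)) s + δ * ∑ (vecs (2 + n)) e
    ≡⟨ cong₂ (λ a b → a + δ * b) (four s) (four e) ⟩
  (∑ V (λ v → s (false ∷ false ∷ v)) + ∑ V (λ v → s (false ∷ true ∷ v)) + (∑ V (λ v → s (true ∷ false ∷ v)) + ∑ V (λ v → s (true ∷ true ∷ v))))
   + δ * (∑ V (λ v → e (false ∷ false ∷ v)) + ∑ V (λ v → e (false ∷ true ∷ v)) + (∑ V (λ v → e (true ∷ false ∷ v)) + ∑ V (λ v → e (true ∷ true ∷ v))))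
    ≡⟨ cong₂ (λ a b → (∑ V (λ v → s (false ∷ false ∷ v)) + ∑ V (λ v → s (false ∷ true ∷ v)) + (∑ V (λ v → s (true ∷ false ∷ v)) + ∑ V (λ v → s (true ∷ true ∷ v)))) + δ * (a + (∑ V (λ v → e (true ∷ false ∷ v)) + b)))
        (cong₂ _+_ z z) z ⟩
  (∑ V (λ v → s (false ∷ false ∷ v)) + ∑ V (λ v → s (false ∷ true ∷ v)) + (∑ V (λ v → s (true ∷ false ∷ v)) + ∑ V (λ v → s (true ∷ true ∷ v))))
   + δ * (∑ V (λ v → e (true ∷ false ∷ v)) + 0)
    ≡⟨ arr (∑ V (λ v → s (false ∷ false ∷ v))) _ _ (∑ V (λ v → s (true ∷ true ∷ v))) δ _ ⟩
  (∑ V (λ v → s (false ∷ true ∷ v)) + ∑ V (λ v → s (true ∷ false ∷ v)) + δ * ∑ V (λ v → e (true ∷ false ∷ v)))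
    + (∑ V (λ v → s (false ∷ false ∷ v)) + ∑ V (λ v → s (true ∷ true ∷ v)))
    ≡⟨ cong (_+ (∑ V (λ v → s (false ∷ false ∷ v)) + ∑ V (λ v → s (true ∷ true ∷ v)))) mid ⟩
  (∑ V (λ v → o (false ∷ true ∷ v)) + ∑ V (λ v → o (true ∷ false ∷ v)))
    + (∑ V (λ v → s (false ∷ false ∷ v)) + ∑ V (λ v → s (true ∷ true ∷ v)))
    ≡⟨ arr' (∑ V (λ v → s (false ∷ false ∷ v))) _ _ _ ⟩
  _ ≡⟨ four o ⟨
  ∑ (vecs (2 + n)) o ∎
  where
  open ≡-Reasoning
  V = vecs n
  s e o : Vec Bool (2 + n) → ℕ
  s v = bit (shift zero F v) * ω v
  e v = bit (moved zero F v)
  o v = bit (F v) * ω v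
  four : ∀ φ → ∑ (vecs (2 + n)) φ ≡ ∑ V (λ v → φ (false ∷ false ∷ v)) + ∑ V (λ v → φ (false ∷ true ∷ v)) + (∑ V (λ v → φ (true ∷ false ∷ v)) + ∑ V (λ v → φ (true ∷ true ∷ v)))
  four φ = trans (∑-vecs (suc n) φ) (cong₂ _+_ (∑-vecs n (φ ∘ (false ∷_))) (∑-vecs n (φ ∘ (true ∷_))))
  z : ∑ V (λ _ → 0) ≡ 0
  z = ∑-zero V (λ _ → refl)
  arr : ∀ a b c d δ x → a + b + (c + d) + δ * (x + 0) ≡ (b + c + δ * x) + (a + d)
  arr = solve-∀
  arr' : ∀ a b c d → (b + c) + (a + d) ≡ a + b + (c + d)
  arr' = solve-∀
  pt : ∀ a b w δ → bit (b ∨ a) * w + bit (a ∧ b) * (δ + w) + δ * bit (a ∧ not b) ≡ bit b * w + bit a * (δ + w)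
  pt true true = solve-∀
  pt true false = solve-∀
  pt false true = solve-∀
  pt false false = solve-∀
  mid : ∑ V (λ v → s (false ∷ true ∷ v)) + ∑ V (λ v → s (true ∷ false ∷ v)) + δ * ∑ V (λ v → e (true ∷ false ∷ v))
      ≡ ∑ V (λ v → o (false ∷ true ∷ v)) + ∑ V (λ v → o (true ∷ false ∷ v))
  mid = trans (cong₂ _+_ (sym (∑-+ V (λ v → s (false ∷ true ∷ v)) (λ v → s (true ∷ false ∷ v)))) (sym (∑-*ˡ δ V (λ v → e (true ∷ false ∷ v)))))
    (trans (sym (∑-+ V (λ v → s (false ∷ true ∷ v) + s (true ∷ false ∷ v)) _))
    (trans (∑-cong V (λ v → subst (λ x → bit (F (false ∷ true ∷ v) ∨ F (true ∷ false ∷ v)) * ω (false ∷ true ∷ v)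
         + bit (F (true ∷ false ∷ v) ∧ F (false ∷ true ∷ v)) * x + δ * bit (F (true ∷ false ∷ v) ∧ not (F (false ∷ true ∷ v)))
         ≡ bit (F (false ∷ true ∷ v)) * ω (false ∷ true ∷ v) + bit (F (true ∷ false ∷ v)) * x) (sym (d here))
         (pt (F (true ∷ false ∷ v)) (F (false ∷ true ∷ v)) (ω (false ∷ true ∷ v)) δ)))
    (∑-+ V (λ v → o (false ∷ true ∷ v)) _)))
shift-weight {zero} (suc j) F ω δ d = trans (cong (∑ (vecs 0) (λ v → bit (shift (suc j) F v) * ω v) +_) (*-zeroʳ δ)) (trans (+-identityʳ _) (cong (_+ 0) (lem [])))
  where
  lem : ∀ (v : Vec Bool 0) → bit (shift (suc j) F v) * ω v ≡ bit (F v) * ω v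
  lem [] = refl
shift-weight {suc n} (suc j) F ω δ d = begin
  ∑ (vecs (suc n)) (λ v → bit (shift (suc j) F v) * ω v) + δ * size (moved (suc j) F)
    ≡⟨ cong₂ (λ a b → a + δ * b) (∑-vecs n (λ v → bit (shift (suc j) F v) * ω v)) (∑-vecs n (λ v → bit (moved (suc j) F v))) ⟩
  (S false + S true) + δ * (M false + M true)
    ≡⟨ cong ((S false + S true) +_) (*-distribˡ-+ δ (M false) (M true)) ⟩
  (S false + S true) + (δ * M false + δ * M true)
    ≡⟨ +-interchange (S false) (S true) _ _ ⟩
  (S false + δ * M false) + (S true + δ * M true)
    ≡⟨ cong₂ _+_ (ih false) (ih true) ⟩
  _ ≡⟨ ∑-vecs n (λ v → bit (F v) * ω v) ⟨
  ∑ (vecs (suc n)) (λ v → bit (F v) * ω v) ∎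
  where
  open ≡-Reasoning
  S M : Bool → ℕ
  S x = ∑ (vecs n) (λ v → bit (shift j (F ∘ (x ∷_)) v) * ω (x ∷ v))
  M x = size (moved j (F ∘ (x ∷_)))
  ih : ∀ x → S x + δ * M x ≡ ∑ (vecs n) (λ v → bit (F (x ∷ v)) * ω (x ∷ v))
  ih x = shift-weight j (F ∘ (x ∷_)) (ω ∘ (x ∷_)) δ (λ p → d (there p))

size-shift : ∀ j (F : Fam n) → size (shift j F) ≡ size F
size-shift {n} j F = trans (∑-cong (vecs n) (λ v → sym (*-identityʳ _)))
  (trans (sym (+-identityʳ _)) (trans (shift-weight j F (λ _ → 1) 0 (λ _ → refl)) (∑-cong (vecs n) (λ v → *-identityʳ _))))

-- The sum of the distances of the elements from the last position.
weight : Vec Bool n → ℕ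
weight [] = 0
weight {suc n} (b ∷ v) = bit b * n + weight v

weight-drops : Drops {n} 1 weight
weight-drops {suc (suc n)} {true ∷ false ∷ v} here = lem n (weight v)
  where
  lem : ∀ n w → 1 * suc n + (0 * n + w) ≡ 1 + (0 * suc n + (1 * n + w))
  lem = solve-∀
weight-drops {suc n} {x ∷ v} {_ ∷ w} (there p) = trans (cong (bit x * n +_) (weight-drops p)) (+-suc _ _)

∈-vecs : (v : Vec Bool n) → v ∈ vecs n
∈-vecs [] = here refl
∈-vecs (false ∷ v) = ∈-++⁺ˡ (∈-map⁺ (false ∷_) (∈-vecs v))
∈-vecs (true ∷ v) = ∈-++⁺ʳ _ (∈-map⁺ (true ∷_) (∈-vecs v))

place : {v w : Vec Bool n} → v ⟶ w → ℕ
place here = 0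
place (there p) = suc (place p)

place<n : {v w : Vec Bool n} (p : v ⟶ w) → place p < n
place<n here = z<s
place<n (there p) = s<s (place<n p)

moved-at : ∀ {v w} (F : Fam n) (p : v ⟶ w) → moved (place p) F v ≡ F v ∧ not (F w)
moved-at F here = refl
moved-at F (there p) = moved-at _ p

unmoved⇒shifted : (F : Fam n) → (∀ j → j < n → size (moved j F) ≡ 0) → Shifted F
unmoved⇒shifted F h {v} {w} p Fv with F w in Fw
... | true = refl
... | false = ⊥-elim (1+n≰n (subst₂ _≤_ (bit-true eq) (h (place p) (place<n p)) (∑-term (bit ∘ moved (place p) F) (∈-vecs v))))
  where
  eq : moved (place p) F v ≡ true
  eq = trans (moved-at F p) (cong₂ (λ a b → a ∧ not b) Fv Fw)

search-moved : ∀ m (F : Fam n) → (Σ ℕ λ j → 0 < size (moved j F)) ⊎ (∀ j → j < m → size (moved j F) ≡ 0)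
search-moved zero F = inj₂ λ _ ()
search-moved (suc m) F with search-moved m F | size (moved m F) in eq
... | inj₁ r | _ = inj₁ r
... | inj₂ _ | suc _ = inj₁ (m , subst (0 <_) (sym eq) z<s)
... | inj₂ r | zero = inj₂ λ j j<sm → case m≤n⇒m<n∨m≡n (≤-pred j<sm) of λ where
  (inj₁ j<m) → r j j<m
  (inj₂ refl) → eq

-- Every move of an element towards the tail lowers the total weight, so shifting terminates.
shifted-family : (P : Fam n → Set) → (∀ j F → P F → P (shift j F)) → ∀ F → P F →
  Σ (Fam n) λ F' → P F' × Shifted F' × size F' ≡ size F
shifted-family {n} P P-shift F PF = go _ F PF ≤-refl
  where
  total : Fam n → ℕ
  total F = ∑ (vecs n) (λ v → bit (F v) * weight v)
  go : ∀ fuel F → P F → total F ≤ fuel → Σ (Fam n) λ F' → P F' × Shifted F' × size F' ≡ size F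
  go fuel F PF t≤ with search-moved n F
  ... | inj₂ h = F , PF , unmoved⇒shifted F h , refl
  ... | inj₁ (j , pos) with fuel | <-≤-trans (subst (total (shift j F) <_) (shift-weight j F weight 1 weight-drops)
                                    (≤-trans (≤-reflexive (sym (+-comm _ 1))) (+-monoʳ-≤ (total (shift j F)) (≤-trans pos (≤-reflexive (sym (*-identityˡ _))))))) t≤
  ...   | suc fuel' | t< with go fuel' (shift j F) (P-shift j F PF) (≤-pred t<)
  ...     | F' , PF' , sh , sz = F' , PF' , sh , trans sz (size-shift j F)

-- A matching of m members is recorded as a colouring of the ground set whose colour classes are the members.
Colouring : ℕ → ℕ → Set
Colouring m n = Vec (Maybe (Fin m)) n

is : Fin m → Maybe (Fin m) → Bool
is i nothing = false
is i (just j) = does (i FinP.≟ j)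

class : Fin m → Colouring m n → Vec Bool n
class i = Vec.map (is i)

NoMatching : Fam n → ℕ → Set
NoMatching F t = (c : Colouring (suc t) _) → (∀ i → F (class i c) ≡ true) → ⊥

is-refl : (i : Fin m) → is i (just i) ≡ true
is-refl i with i FinP.≟ i
... | yes _ = refl
... | no ¬p = ⊥-elim (¬p refl)

∧-true : ∀ a b → a ∧ b ≡ true → (a ≡ true) × (b ≡ true)
∧-true true true _ = refl , refl

swapAt : ℕ → Vec A n → Vec A n
swapAt zero (a ∷ b ∷ v) = b ∷ a ∷ v
swapAt zero v = v
swapAt (suc j) (a ∷ v) = a ∷ swapAt j v
swapAt (suc j) [] = []

-- Each colour has its own family, because the recursion fixes the colours of the first positions
-- and so restricts each class differently. At the exchanged positions only the class that owns the
-- later one can have arisen by a move. If it has, exchanging the two colours undoes the move, and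
-- the other classes allow this: a shifted family keeps a set that contains only the earlier
-- position just when both versions belong to `F`.
shift-matching : ∀ j (F : Fin m → Fam n) (c : Colouring m n) → (∀ i → shift j (F i) (class i c) ≡ true) →
  (∀ i → F i (class i c) ≡ true) ⊎ (∀ i → F i (class i (swapAt j c)) ≡ true)
shift-matching zero F [] h = inj₁ h
shift-matching zero F (x ∷ []) h = inj₁ λ i → lem i (is i x) (h i)
  where
  lem : ∀ i b → shift zero (F i) (b ∷ []) ≡ true → F i (b ∷ []) ≡ true
  lem i true e = e
  lem i false e = e
shift-matching {m} {suc (suc n)} zero F (x ∷ nothing ∷ c) h = inj₁ λ i → lem i (is i x) (h i)
  where
  lem : ∀ i b → shift zero (F i) (b ∷ false ∷ class i c) ≡ true → F i (b ∷ false ∷ class i c) ≡ true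
  lem i true e = proj₁ (∧-true _ _ e)
  lem i false e = e
shift-matching {m} {suc (suc n)} zero F (x ∷ just a ∷ c) h with F a (is a x ∷ is a (just a) ∷ class a c) in eq
... | true = inj₁ go
  where
  lem : ∀ i b → shift zero (F i) (b ∷ false ∷ class i c) ≡ true → F i (b ∷ false ∷ class i c) ≡ true
  lem i true e = proj₁ (∧-true _ _ e)
  lem i false e = e
  go : ∀ i → F i (is i x ∷ is i (just a) ∷ class i c) ≡ true
  go i with i FinP.≟ a | h i
  ... | no _ | hi = lem i (is i x) hi
  ... | yes refl | _ = subst (λ b → F i (is i x ∷ b ∷ class i c) ≡ true) (is-refl i) eq
... | false = inj₂ go
  where
  up : ∀ b → b ≡ is a x → shift zero (F a) (b ∷ true ∷ class a c) ≡ true → F a (b ∷ true ∷ class a c) ≡ false → F a (true ∷ b ∷ class a c) ≡ true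
  up true _ e f = e
  up false _ e f with F a (false ∷ true ∷ class a c)
  up false _ e () | true
  up false _ e f | false = e
  other : ∀ i b → shift zero (F i) (b ∷ false ∷ class i c) ≡ true → F i (false ∷ b ∷ class i c) ≡ true
  other i true e = proj₂ (∧-true _ _ e)
  other i false e = e
  eq' : F a (is a x ∷ true ∷ class a c) ≡ false
  eq' = subst (λ b → F a (is a x ∷ b ∷ class a c) ≡ false) (is-refl a) eq
  ha : shift zero (F a) (is a x ∷ true ∷ class a c) ≡ true
  ha = subst (λ b → shift zero (F a) (is a x ∷ b ∷ class a c) ≡ true) (is-refl a) (h a)
  go : ∀ i → F i (is i (just a) ∷ is i x ∷ class i c) ≡ true
  go i with i FinP.≟ a | h i
  ... | no _ | hi = other i (is i x) hi
  ... | yes refl | _ = up (is i x) refl ha eq'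
shift-matching (suc j) F [] h = inj₁ h
shift-matching (suc j) F (x ∷ c) h = shift-matching j (λ i → F i ∘ (is i x ∷_)) c h

shift-NoMatching : ∀ j (F : Fam n) t → NoMatching F t → NoMatching (shift j F) t
shift-NoMatching j F t nm c h with shift-matching j (λ _ → F) c h
... | inj₁ e = nm c e
... | inj₂ e = nm (swapAt j c) e

-- Every member of the shifted family is a member of `F` or arises from one by a move. This carries
-- uniformity and the bound on `prefix` through the shifting.
shift-⊆ : ∀ j (F : Fam n) (P : Vec Bool n → Set) → (∀ {v w} → v ⟶ w → P v → P w) →
  (∀ v → F v ≡ true → P v) → ∀ v → shift j F v ≡ true → P v
shift-⊆ zero F P cl h (true ∷ false ∷ v) e = h _ (proj₁ (∧-true _ _ e))
shift-⊆ zero F P cl h (false ∷ true ∷ v) e with F (false ∷ true ∷ v) in eq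
... | true = h _ eq
... | false = cl here (h _ e)
shift-⊆ zero F P cl h [] e = h _ e
shift-⊆ zero F P cl h (true ∷ []) e = h _ e
shift-⊆ zero F P cl h (false ∷ []) e = h _ e
shift-⊆ zero F P cl h (true ∷ true ∷ v) e = h _ e
shift-⊆ zero F P cl h (false ∷ false ∷ v) e = h _ e
shift-⊆ (suc j) F P cl h [] e = h _ e
shift-⊆ (suc j) F P cl h (x ∷ v) e = shift-⊆ j (F ∘ (x ∷_)) (P ∘ (x ∷_)) (λ p → cl (there p)) (λ v → h (x ∷ v)) v e

⟶-card : {v w : Vec Bool n} → v ⟶ w → card v ≡ card w
⟶-card here = refl
⟶-card (there {x = x} p) = cong (bit x +_) (⟶-card p)

prefix : ℕ → Vec Bool n → ℕ
prefix zero v = 0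
prefix (suc p) [] = 0
prefix (suc p) (b ∷ v) = bit b + prefix p v

-- The reason for placing the uncovered vertices in front: moves lead to the tail, so no member
-- gains elements in an initial segment.
⟶-prefix : ∀ p {v w : Vec Bool n} → v ⟶ w → prefix p w ≤ prefix p v
⟶-prefix zero _ = z≤n
⟶-prefix (suc zero) here = z≤n
⟶-prefix (suc (suc p)) here = ≤-refl
⟶-prefix (suc p) (there {x = x} q) = +-monoʳ-≤ (bit x) (⟶-prefix p q)

-- The shadow inequality

infix 4 _⋖_
data _⋖_ : Vec Bool n → Vec Bool n → Set where
  here  : {v : Vec Bool n} → (false ∷ v) ⋖ (true ∷ v)
  there : {x : Bool} {v w : Vec Bool n} → v ⋖ w → (x ∷ v) ⋖ (x ∷ w)

⋖-card : {v w : Vec Bool n} → v ⋖ w → card w ≡ suc (card v)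
⋖-card here = refl
⋖-card (there {x = x} p) = trans (cong (bit x +_) (⋖-card p)) (+-suc _ _)

-- The head reaches the gap by adjacent moves. An element in between is passed by sending that
-- element into the gap first and then letting the head take its place.
move-head : (F : Fam (suc n)) → Shifted F → ∀ {v w} → v ⋖ w → F (true ∷ v) ≡ true → F (false ∷ w) ≡ true
move-head F sh here e = sh here e
move-head F sh (there {x = true} p) e = sh here (move-head (F ∘ (true ∷_)) (λ q → sh (there q)) p e)
move-head F sh (there {x = false} p) e = move-head (F ∘ (false ∷_)) (λ q → sh (there q)) p (sh here e)

fins : ∀ m → List (Fin m)
fins zero = []
fins (suc m) = zero ∷ map suc (fins m)

∑-fins : ∀ m (φ : Fin (suc m) → ℕ) → ∑ (fins (suc m)) φ ≡ φ zero + ∑ (fins m) (φ ∘ suc)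
∑-fins m φ = cong (φ zero +_) (∑-map suc (fins m) φ)

length-fins : ∀ m → length (fins m) ≡ m
length-fins zero = refl
length-fins (suc m) = cong suc (trans (length-map suc (fins m)) (length-fins m))

one-colour : (a : Fin m) → ∑ (fins m) (λ i → bit (is i (just a))) ≡ 1
one-colour {suc m} zero = cong suc (trans (∑-map suc (fins m) _) (∑-zero (fins m) (λ _ → refl)))
one-colour {suc m} (suc a) = trans (∑-map suc (fins m) _) (one-colour a)

blanks : Colouring m n → ℕ
blanks [] = 0
blanks (nothing ∷ c) = suc (blanks c)
blanks (just _ ∷ c) = blanks c

blanks+classes : (c : Colouring m n) → blanks c + ∑ (fins m) (λ i → card (class i c)) ≡ n
blanks+classes {m} [] = ∑-zero (fins m) (λ _ → refl)
blanks+classes (nothing ∷ c) = cong suc (blanks+classes c)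
blanks+classes {m} {suc n} (just a ∷ c) = begin
  blanks c + ∑ (fins m) (λ i → bit (is i (just a)) + card (class i c))
    ≡⟨ cong (blanks c +_) (trans (∑-+ (fins m) (λ i → bit (is i (just a))) (λ i → card (class i c))) (cong (_+ ∑ (fins m) (λ i → card (class i c))) (one-colour a))) ⟩
  blanks c + suc (∑ (fins m) (λ i → card (class i c))) ≡⟨ +-suc _ _ ⟩
  suc (blanks c + ∑ (fins m) (λ i → card (class i c))) ≡⟨ cong suc (blanks+classes c) ⟩
  suc n ∎
  where open ≡-Reasoning

fill-blank : (c : Colouring m n) (j : Fin m) → 0 < blanks c → Σ (Colouring m n) λ c' →
  (blanks c ≡ suc (blanks c')) × (class j c ⋖ class j c') × (∀ i → i ≢ j → class i c ≡ class i c')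
fill-blank (nothing ∷ c) j _ = just j ∷ c , refl , subst (λ b → (false ∷ class j c) ⋖ (b ∷ class j c)) (sym (is-refl j)) here , other
  where
  other : ∀ i → i ≢ j → class i (nothing ∷ c) ≡ class i (just j ∷ c)
  other i i≢j with i FinP.≟ j
  ... | yes e = ⊥-elim (i≢j e)
  ... | no _ = refl
fill-blank (just a ∷ c) j p with fill-blank c j p
... | c' , e , f , o = just a ∷ c' , e , there f , λ i i≢j → cong (_ ∷_) (o i i≢j)

link-NoMatching : (F : Fam (suc n)) → Shifted F → ∀ l t → Uniform (suc l) F → NoMatching F t → suc l * suc t ≤ suc n →
  NoMatching (F ∘ (true ∷_)) t
link-NoMatching {n} F sh l t uni nm big c₀ h₀ = finish (steps t ≤-refl)
  where
  -- The first `j` classes have traded the head for a blank position, and each stage uses up one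
  -- blank.
  Stage : ℕ → Set
  Stage j = Σ (Colouring (suc t) n) λ c → (∀ i → toℕ i < j → F (false ∷ class i c) ≡ true)
    × (∀ i → j ≤ toℕ i → F (true ∷ class i c) ≡ true) × t ≤ blanks c + j
  classes : ∑ (fins (suc t)) (λ i → card (class i c₀)) ≡ suc t * l
  classes = trans (∑-cong (fins (suc t)) (λ i → suc-injective (uni _ (h₀ i))))
    (trans (∑-const (fins (suc t)) l) (cong (_* l) (length-fins (suc t))))
  enough : t ≤ blanks c₀ + 0
  enough = +-cancelʳ-≤ (suc t * l) t (blanks c₀ + 0) (≤-pred (subst₂ _≤_ (lem t l)
    (cong suc (sym (trans (cong (_+ suc t * l) (+-identityʳ (blanks c₀))) (trans (cong (blanks c₀ +_) (sym classes)) (blanks+classes c₀))))) big))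
    where
    lem : ∀ t l → suc l * suc t ≡ suc (t + suc t * l)
    lem = solve-∀
  steps : ∀ j → j ≤ t → Stage j
  steps zero _ = c₀ , (λ _ ()) , (λ i _ → h₀ i) , enough
  steps (suc j) j<t with steps j (<⇒≤ j<t)
  ... | c , lo , hi , bl with fill-blank c (fromℕ< (m<n⇒m<1+n j<t)) (+-cancelʳ-≤ j 1 (blanks c) (≤-trans j<t bl))
  ...   | c' , eb , f , o = c' , lo' , hi' , subst (t ≤_) (trans (cong (_+ j) eb) (sym (+-suc _ _))) bl
    where
    jt = fromℕ< (m<n⇒m<1+n j<t)
    toJ : toℕ jt ≡ j
    toJ = toℕ-fromℕ< (m<n⇒m<1+n j<t)
    lo' : ∀ i → toℕ i < suc j → F (false ∷ class i c') ≡ true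
    lo' i i≤j with i FinP.≟ jt
    ... | yes refl = move-head F sh f (hi i (≤-reflexive (sym toJ)))
    ... | no i≢J = subst (λ v → F (false ∷ v) ≡ true) (o i i≢J)
            (lo i (≤∧≢⇒< (≤-pred i≤j) (λ e → i≢J (toℕ-injective (trans e (sym toJ))))))
    hi' : ∀ i → suc j ≤ toℕ i → F (true ∷ class i c') ≡ true
    hi' i j<i = subst (λ v → F (true ∷ v) ≡ true) (o i (λ e → <-irrefl refl (<-≤-trans j<i (≤-reflexive (trans (cong toℕ e) toJ))))) (hi i (<⇒≤ j<i))
  finish : Stage t → ⊥
  finish (c , lo , hi , _) = nm (just (fromℕ t) ∷ c) go
    where
    go : ∀ i → F (is i (just (fromℕ t)) ∷ class i c) ≡ true
    go i with i FinP.≟ fromℕ t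
    ... | yes e = hi i (≤-reflexive (sym (trans (cong toℕ e) (toℕ-fromℕ t))))
    ... | no i≢ = lo i (≤∧≢⇒< (≤-pred (toℕ<n i)) (λ e → i≢ (toℕ-injective (trans e (sym (toℕ-fromℕ t))))))

-- The number of members of `F` that arise from the given set by adding one element.
ups : Fam n → Vec Bool n → ℕ
ups F [] = 0
ups F (true ∷ v) = ups (F ∘ (true ∷_)) v
ups F (false ∷ v) = bit (F (true ∷ v)) + ups (F ∘ (false ∷_)) v

∑-ups : (F : Fam n) → ∑ (vecs n) (ups F) ≡ ∑ (vecs n) (λ v → bit (F v) * card v)
∑-ups {zero} F = cong (_+ 0) (sym (*-zeroʳ (bit (F []))))
∑-ups {suc n} F = begin
  ∑ (vecs (suc n)) (ups F) ≡⟨ ∑-vecs n (ups F) ⟩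
  ∑ V (λ v → bit (F (true ∷ v)) + ups F₀ v) + ∑ V (ups F₁) ≡⟨ cong₂ _+_ (∑-+ V (λ v → bit (F (true ∷ v))) (ups F₀)) (∑-ups F₁) ⟩
  (∑ V (bit ∘ F₁) + ∑ V (ups F₀)) + ∑ V (λ v → bit (F₁ v) * card v) ≡⟨ cong (λ x → (∑ V (bit ∘ F₁) + x) + ∑ V (λ v → bit (F₁ v) * card v)) (∑-ups F₀) ⟩
  (∑ V (bit ∘ F₁) + ∑ V (λ v → bit (F₀ v) * card v)) + ∑ V (λ v → bit (F₁ v) * card v) ≡⟨ lem (∑ V (bit ∘ F₁)) _ _ ⟩
  ∑ V (λ v → bit (F₀ v) * card v) + (∑ V (bit ∘ F₁) + ∑ V (λ v → bit (F₁ v) * card v))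
    ≡⟨ cong (∑ V (λ v → bit (F₀ v) * card v) +_) (trans (sym (∑-+ V (bit ∘ F₁) (λ v → bit (F₁ v) * card v))) (∑-cong V (λ v → sym (*-suc (bit (F₁ v)) (card v))))) ⟩
  ∑ V (λ v → bit (F₀ v) * card v) + ∑ V (λ v → bit (F₁ v) * suc (card v)) ≡⟨ ∑-vecs n (λ v → bit (F v) * card v) ⟨
  ∑ (vecs (suc n)) (λ v → bit (F v) * card v) ∎
  where
  open ≡-Reasoning
  V = vecs n
  F₀ F₁ : Fam n
  F₀ = F ∘ (false ∷_)
  F₁ = F ∘ (true ∷_)
  lem : ∀ a b c → (a + b) + c ≡ b + (a + c)
  lem = solve-∀

ups≤cocard : (F : Fam n) (v : Vec Bool n) → ups F v ≤ cocard v
ups≤cocard F [] = z≤n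
ups≤cocard F (true ∷ v) = ups≤cocard _ v
ups≤cocard F (false ∷ v) = +-mono-≤ (bit≤1 (F (true ∷ v))) (ups≤cocard _ v)

ups-witness : (F : Fam n) (v : Vec Bool n) → 0 < ups F v → Σ (Vec Bool n) λ w → (v ⋖ w) × F w ≡ true
ups-witness F (true ∷ v) p with ups-witness (F ∘ (true ∷_)) v p
... | w , f , e = true ∷ w , there f , e
ups-witness F (false ∷ v) p with F (true ∷ v) in eq
... | true = true ∷ v , here , eq
... | false with ups-witness (F ∘ (false ∷_)) v p
...   | w , f , e = false ∷ w , there f , e

ShadowIn : Fam n → Fam n → Set
ShadowIn F G = ∀ {v w} → v ⋖ w → F w ≡ true → G v ≡ true

size-uniform : ∀ l (F : Fam n) → Uniform l F → ∑ (vecs n) (λ v → bit (F v) * card v) ≡ l * size F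
size-uniform {n} l F uni = trans (∑-cong (vecs n) pt) (trans (∑-*ʳ (vecs n) (bit ∘ F) l) (*-comm (size F) l))
  where
  pt : ∀ v → bit (F v) * card v ≡ bit (F v) * l
  pt v with F v in eq
  ... | true = cong (1 *_) (uni v eq)
  ... | false = refl

-- Pairs of a member and one of its elements are counted twice: a member has `suc l` elements, and a
-- set of size `l` can be extended in at most `n - l ≤ d` ways.
local-LYM : ∀ l d (F G : Fam n) → Uniform (suc l) F → ShadowIn F G → n ≤ l + d → suc l * size F ≤ d * size G
local-LYM {n} l d F G uni sh n≤ = begin
  suc l * size F ≡⟨ trans (∑-ups F) (size-uniform (suc l) F uni) ⟨
  ∑ (vecs n) (ups F) ≤⟨ ∑-mono (vecs n) pt ⟩
  ∑ (vecs n) (λ v → d * bit (G v)) ≡⟨ ∑-*ˡ d (vecs n) (bit ∘ G) ⟩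
  d * size G ∎
  where
  open ≤-Reasoning
  pt : ∀ v → ups F v ≤ d * bit (G v)
  pt v with ups F v in eq
  ... | zero = z≤n
  ... | suc u with ups-witness F v (subst (0 <_) (sym eq) z<s)
  ...   | w , f , e = begin
    suc u ≡⟨ eq ⟨
    ups F v ≤⟨ ups≤cocard F v ⟩
    cocard v ≤⟨ +-cancelˡ-≤ (card v) (cocard v) d (≤-trans (≤-reflexive (card+cocard v)) (≤-trans n≤ (≤-reflexive (cong (_+ d) (sym (suc-injective (trans (sym (⋖-card f)) (uni w e)))))))) ⟩
    d ≡⟨ *-identityʳ d ⟨
    d * 1 ≡⟨ cong (d *_) (bit-true (sh f e)) ⟨
    d * bit (G v) ∎

size-split : (F : Fam (suc n)) → size F ≡ size (F ∘ (false ∷_)) + size (F ∘ (true ∷_))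
size-split {n} F = ∑-vecs n (bit ∘ F)

size-empty : (F : Fam n) → (∀ v → F v ≡ true → ⊥) → size F ≡ 0
size-empty {n} F h = ∑-zero (vecs n) (λ v → lem v (F v) refl)
  where
  lem : ∀ v b → F v ≡ b → bit b ≡ 0
  lem v true e = ⊥-elim (h v e)
  lem v false _ = refl

blank-head : (F : Fam (suc n)) → ∀ t → NoMatching F t → NoMatching (F ∘ (false ∷_)) t
blank-head F t nm c h = nm (nothing ∷ c) h

-- On fewer than `l * suc t` points `local-LYM` with `d = l * t` is enough. Otherwise induction
-- applies to the members without the head and, by `link-NoMatching`, to the link of the head; their
-- shadows lie in the two separate halves of `G`.
shadow-bound : ∀ n l t (F G : Fam n) → Shifted F → Uniform l F → NoMatching F t → ShadowIn F G → size F ≤ t * size G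
shadow-bound n l t F G sh uni nm sd with l * suc t ≤? n
shadow-bound n zero t F G sh uni nm sd | no ¬p = ⊥-elim (¬p z≤n)
shadow-bound n (suc l) t F G sh uni nm sd | no ¬p = *-cancelˡ-≤ (suc l)
  (≤-trans (local-LYM l (suc l * t) F G uni sd (≤-pred (≤-trans (≰⇒> ¬p) (≤-reflexive (lem l t))))) (≤-reflexive (*-assoc (suc l) t (size G))))
  where
  lem : ∀ l t → suc l * suc t ≡ suc (l + suc l * t)
  lem = solve-∀
shadow-bound zero zero t F G sh uni nm sd | yes p = ≤-trans (≤-reflexive (size-empty F (λ { [] e → nm [] (λ _ → e) }))) z≤n
shadow-bound (suc n) l t F G sh uni nm sd | yes p = begin
  size F ≡⟨ size-split F ⟩
  size (F ∘ (false ∷_)) + size (F ∘ (true ∷_)) ≤⟨ +-mono-≤ first (second l uni p) ⟩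
  t * size (G ∘ (false ∷_)) + t * size (G ∘ (true ∷_)) ≡⟨ *-distribˡ-+ t _ _ ⟨
  t * (size (G ∘ (false ∷_)) + size (G ∘ (true ∷_))) ≡⟨ cong (t *_) (size-split G) ⟨
  t * size G ∎
  where
  open ≤-Reasoning
  first : size (F ∘ (false ∷_)) ≤ t * size (G ∘ (false ∷_))
  first = shadow-bound n l t (F ∘ (false ∷_)) (G ∘ (false ∷_)) (λ q → sh (there q)) (λ v → uni (false ∷ v)) (blank-head F t nm) (λ f → sd (there f))
  second : ∀ l → Uniform l F → l * suc t ≤ suc n → size (F ∘ (true ∷_)) ≤ t * size (G ∘ (true ∷_))
  second zero uni p = ≤-trans (≤-reflexive (size-empty (F ∘ (true ∷_)) (λ v e → case uni (true ∷ v) e of λ ()))) z≤n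
  second (suc l) uni p = shadow-bound n l t (F ∘ (true ∷_)) (G ∘ (true ∷_)) (λ q → sh (there q)) (λ v e → suc-injective (uni (true ∷ v) e))
    (link-NoMatching F sh l t uni nm p) (λ f → sd (there f))

-- Averaging over all rearrangements of a colouring

inserts : A → Vec A n → List (Vec A (suc n))
inserts a [] = (a ∷ []) ∷ []
inserts a (x ∷ u) = (a ∷ x ∷ u) ∷ map (x ∷_) (inserts a u)

-- All orders occur, repeated when entries coincide. With these repetitions, rearranging commutes
-- with mapping a function over the entries, so a class of a random rearrangement is a random
-- rearrangement of the class.
shuffles : Vec A n → List (Vec A n)
shuffles [] = [] ∷ []
shuffles (a ∷ v) = concatMap (inserts a) (shuffles v)

∑-inserts-map : (f : A → B) (a : A) (u : Vec A n) (φ : Vec B (suc n) → ℕ) →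
  ∑ (inserts a u) (φ ∘ Vec.map f) ≡ ∑ (inserts (f a) (Vec.map f u)) φ
∑-inserts-map f a [] φ = refl
∑-inserts-map f a (x ∷ u) φ = cong (φ (f a ∷ f x ∷ Vec.map f u) +_)
  (trans (∑-map (x ∷_) (inserts a u) _) (trans (∑-inserts-map f a u (φ ∘ (f x ∷_))) (sym (∑-map (f x ∷_) (inserts (f a) (Vec.map f u)) φ))))

∑-shuffles-map : (f : A → B) (v : Vec A n) (φ : Vec B n → ℕ) → ∑ (shuffles v) (φ ∘ Vec.map f) ≡ ∑ (shuffles (Vec.map f v)) φ
∑-shuffles-map f [] φ = refl
∑-shuffles-map f (a ∷ v) φ = begin
  ∑ (concatMap (inserts a) (shuffles v)) (φ ∘ Vec.map f) ≡⟨ ∑-concatMap (inserts a) (shuffles v) _ ⟩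
  ∑ (shuffles v) (λ u → ∑ (inserts a u) (φ ∘ Vec.map f)) ≡⟨ ∑-cong (shuffles v) (λ u → ∑-inserts-map f a u φ) ⟩
  ∑ (shuffles v) (λ u → ∑ (inserts (f a) (Vec.map f u)) φ) ≡⟨ ∑-shuffles-map f v (λ u → ∑ (inserts (f a) u) φ) ⟩
  ∑ (shuffles (Vec.map f v)) (λ u → ∑ (inserts (f a) u) φ) ≡⟨ ∑-concatMap (inserts (f a)) (shuffles (Vec.map f v)) φ ⟨
  ∑ (shuffles (Vec.map f (a ∷ v))) φ ∎
  where open ≡-Reasoning

cnt : Bool → Vec Bool n → ℕ
cnt true = card
cnt false = cocard

-- A vector `w` arises once for each entry `b` that can be deleted from it.
∑-inserts : ∀ n b (χ : Vec Bool (suc n) → ℕ) →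
  ∑ (vecs n) (λ u → ∑ (inserts b u) χ) ≡ ∑ (vecs (suc n)) (λ w → cnt b w * χ w)
∑-inserts zero true χ = refl
∑-inserts zero false χ = refl
∑-inserts (suc n) b χ = begin
  ∑ (vecs (suc n)) (λ u → ∑ (inserts b u) χ) ≡⟨ ∑-vecs n _ ⟩
  part false + part true ≡⟨ cong₂ _+_ (step false) (step true) ⟩
  (∑ V (λ u → χ (b ∷ false ∷ u)) + rest false) + (∑ V (λ u → χ (b ∷ true ∷ u)) + rest true)
    ≡⟨ +-interchange (∑ V (λ u → χ (b ∷ false ∷ u))) (rest false) _ (rest true) ⟩
  (∑ V (λ u → χ (b ∷ false ∷ u)) + ∑ V (λ u → χ (b ∷ true ∷ u))) + (rest false + rest true)
    ≡⟨ cong (_+ (rest false + rest true)) (∑-vecs n (χ ∘ (b ∷_))) ⟨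
  ∑ V' (χ ∘ (b ∷_)) + (rest false + rest true) ≡⟨ last b ⟩
  ∑ V' (λ w → cnt b (false ∷ w) * χ (false ∷ w)) + ∑ V' (λ w → cnt b (true ∷ w) * χ (true ∷ w)) ≡⟨ ∑-vecs (suc n) (λ w → cnt b w * χ w) ⟨
  ∑ (vecs (suc (suc n))) (λ w → cnt b w * χ w) ∎
  where
  open ≡-Reasoning
  V = vecs n
  V' = vecs (suc n)
  part rest : Bool → ℕ
  part q = ∑ V (λ u → ∑ (inserts b (q ∷ u)) χ)
  rest q = ∑ V' (λ w → cnt b w * χ (q ∷ w))
  step : ∀ q → part q ≡ ∑ V (λ u → χ (b ∷ q ∷ u)) + rest q
  step q = trans (∑-+ V (λ u → χ (b ∷ q ∷ u)) _) (cong (∑ V (λ u → χ (b ∷ q ∷ u)) +_)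
    (trans (∑-cong V (λ u → ∑-map (q ∷_) (inserts b u) χ)) (∑-inserts n b (χ ∘ (q ∷_)))))
  last : ∀ b → ∑ V' (χ ∘ (b ∷_)) + (∑ V' (λ w → cnt b w * χ (false ∷ w)) + ∑ V' (λ w → cnt b w * χ (true ∷ w)))
    ≡ ∑ V' (λ w → cnt b (false ∷ w) * χ (false ∷ w)) + ∑ V' (λ w → cnt b (true ∷ w) * χ (true ∷ w))
  last true = trans (lem (∑ V' (χ ∘ (true ∷_))) (∑ V' (λ w → card w * χ (false ∷ w))) (∑ V' (λ w → card w * χ (true ∷ w)))) (cong (∑ V' (λ w → card w * χ (false ∷ w)) +_) (sym (∑-+ V' (χ ∘ (true ∷_)) (λ w → card w * χ (true ∷ w)))))
    where
    lem : ∀ a b c → a + (b + c) ≡ b + (a + c)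
    lem = solve-∀
  last false = trans (sym (+-assoc (∑ V' (χ ∘ (false ∷_))) _ _)) (cong (_+ ∑ V' (λ w → cocard w * χ (true ∷ w))) (sym (∑-+ V' (χ ∘ (false ∷_)) (λ w → cocard w * χ (false ∷ w)))))

inserts-card : ∀ b (u : Vec Bool n) (g : ℕ → ℕ) → ∑ (inserts b u) (λ w → g (card w)) ≡ suc n * g (bit b + card u)
inserts-card b [] g = refl
inserts-card {suc n} b (x ∷ u) g = cong (g (bit b + (bit x + card u)) +_) (trans (∑-map (x ∷_) (inserts b u) _)
  (trans (inserts-card b u (λ k → g (bit x + k))) (cong (λ k → suc n * g k) (lem (bit x) (bit b) (card u)))))
  where
  lem : ∀ a b c → a + (b + c) ≡ b + (a + c)
  lem = solve-∀

shuffles-card : (v : Vec Bool n) (g : ℕ → ℕ) → ∑ (shuffles v) (λ w → g (card w)) ≡ ∑ (shuffles v) (λ _ → g (card v))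
shuffles-card [] g = refl
shuffles-card {suc n} (b ∷ v) g = begin
  ∑ (concatMap (inserts b) (shuffles v)) (λ w → g (card w)) ≡⟨ ∑-concatMap (inserts b) (shuffles v) _ ⟩
  ∑ (shuffles v) (λ u → ∑ (inserts b u) (λ w → g (card w))) ≡⟨ ∑-cong (shuffles v) (λ u → inserts-card b u g) ⟩
  ∑ (shuffles v) (λ u → suc n * g (bit b + card u)) ≡⟨ shuffles-card v (λ k → suc n * g (bit b + k)) ⟩
  ∑ (shuffles v) (λ u → suc n * g (bit b + card v)) ≡⟨ ∑-cong (shuffles v) (λ u → inserts-card b u (λ _ → g (bit b + card v))) ⟨
  ∑ (shuffles v) (λ u → ∑ (inserts b u) (λ _ → g (bit b + card v))) ≡⟨ ∑-concatMap (inserts b) (shuffles v) _ ⟨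
  ∑ (concatMap (inserts b) (shuffles v)) (λ _ → g (bit b + card v)) ∎
  where open ≡-Reasoning

inserts-zero : ∀ b (u : Vec Bool n) c (χ : Vec Bool (suc n) → ℕ) → (∀ v → card v ≢ bit b + c → χ v ≡ 0) → card u ≢ c → ∑ (inserts b u) χ ≡ 0
inserts-zero {n} b u c χ sup ne = go b u (λ w → χ w) (λ w e → sup w (λ e' → ne (+-cancelˡ-≡ (bit b) (card u) c (trans (sym e) e'))))
  where
  go : ∀ {n} b (u : Vec Bool n) (χ : Vec Bool (suc n) → ℕ) → (∀ w → card w ≡ bit b + card u → χ w ≡ 0) → ∑ (inserts b u) χ ≡ 0
  go b [] χ h = cong (_+ 0) (h (b ∷ []) refl)
  go b (x ∷ u) χ h = cong₂ _+_ (h (b ∷ x ∷ u) refl) (trans (∑-map (x ∷_) (inserts b u) χ)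
    (go b u (χ ∘ (x ∷_)) (λ w e → h (x ∷ w) (trans (cong (bit x +_) e) (lem (bit x) (bit b) (card u))))))
    where
    lem : ∀ a b c → a + (b + c) ≡ b + (a + c)
    lem = solve-∀

-- A vector with as many elements as `p` is reached `card p ! * cocard p !` times, namely by
-- permuting equal entries among themselves.
∑-shuffles : (p : Vec Bool n) (χ : Vec Bool n → ℕ) → (∀ v → card v ≢ card p → χ v ≡ 0) →
  ∑ (shuffles p) χ ≡ (card p ! * cocard p !) * ∑ (vecs n) χ
∑-shuffles [] χ sup = sym (*-identityˡ _)
∑-shuffles {suc n} (b ∷ p) χ sup = begin
  ∑ (concatMap (inserts b) (shuffles p)) χ ≡⟨ ∑-concatMap (inserts b) (shuffles p) χ ⟩
  ∑ (shuffles p) (λ u → ∑ (inserts b u) χ) ≡⟨ ∑-shuffles p _ (λ v ne → inserts-zero b v (card p) χ sup ne) ⟩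
  κ * ∑ (vecs n) (λ u → ∑ (inserts b u) χ) ≡⟨ cong (κ *_) (∑-inserts n b χ) ⟩
  κ * ∑ (vecs (suc n)) (λ w → cnt b w * χ w) ≡⟨ cong (κ *_) (∑-cong (vecs (suc n)) pt) ⟩
  κ * ∑ (vecs (suc n)) (λ w → cnt b (b ∷ p) * χ w) ≡⟨ cong (κ *_) (∑-*ˡ (cnt b (b ∷ p)) (vecs (suc n)) χ) ⟩
  κ * (cnt b (b ∷ p) * ∑ (vecs (suc n)) χ) ≡⟨ *-assoc κ (cnt b (b ∷ p)) _ ⟨
  κ * cnt b (b ∷ p) * ∑ (vecs (suc n)) χ ≡⟨ cong (_* ∑ (vecs (suc n)) χ) (fac b) ⟩
  (card (b ∷ p) ! * cocard (b ∷ p) !) * ∑ (vecs (suc n)) χ ∎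
  where
  open ≡-Reasoning
  κ = card p ! * cocard p !
  fac : ∀ b → κ * cnt b (b ∷ p) ≡ card (b ∷ p) ! * cocard (b ∷ p) !
  fac true = lem (card p !) (cocard p !) (suc (card p))
    where
    lem : ∀ a b c → a * b * c ≡ c * a * b
    lem = solve-∀
  fac false = lem (card p !) (cocard p !) (suc (cocard p))
    where
    lem : ∀ a b c → a * b * c ≡ a * (c * b)
    lem = solve-∀
  same : ∀ w → card w ≡ card (b ∷ p) → ∀ b' → cnt b' w ≡ cnt b' (b ∷ p)
  same w e true = e
  same w e false = +-cancelˡ-≡ (card w) _ _ (trans (card+cocard w) (trans (sym (card+cocard (b ∷ p))) (cong (_+ cocard (b ∷ p)) (sym e))))
  pt : ∀ w → cnt b w * χ w ≡ cnt b (b ∷ p) * χ w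
  pt w with card w ≟ card (b ∷ p)
  ... | yes e = cong (_* χ w) (same w e b)
  ... | no ne rewrite sup w ne = trans (*-zeroʳ (cnt b w)) (sym (*-zeroʳ (cnt b (b ∷ p))))

equitable : ∀ T r y → T * r ≤ y → Σ (Colouring T y) λ c → ∀ i → card (class i c) ≡ r
equitable zero r y _ = Vec.replicate y nothing , λ ()
equitable (suc T) r y h with equitable T r (y ∸ r) (≤-trans (≤-reflexive (sym (m+n∸m≡n r (T * r)))) (∸-monoˡ-≤ r h))
... | c , hc = subst (λ y → Σ (Colouring (suc T) y) λ c → ∀ i → card (class i c) ≡ r) (m+[n∸m]≡n (≤-trans (m≤m+n r (T * r)) h))
  (Vec.replicate r (just zero) Vec.++ Vec.map (Maybe.map suc) c , go)
  where
  old-zero : ∀ {n} (c : Colouring T n) → card (class zero (Vec.map (Maybe.map suc) c)) ≡ 0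
  old-zero [] = refl
  old-zero (nothing ∷ c) = old-zero c
  old-zero (just _ ∷ c) = old-zero c
  old-suc : ∀ {n} i (c : Colouring T n) → card (class (suc i) (Vec.map (Maybe.map suc) c)) ≡ card (class i c)
  old-suc i [] = refl
  old-suc i (nothing ∷ c) = old-suc i c
  old-suc i (just j ∷ c) = cong (bit (is i (just j)) +_) (old-suc i c)
  new-zero : ∀ r {n} (c : Colouring (suc T) n) → card (class zero (Vec.replicate r (just zero) Vec.++ c)) ≡ r + card (class zero c)
  new-zero zero c = refl
  new-zero (suc r) c = cong suc (new-zero r c)
  new-suc : ∀ r i {n} (c : Colouring (suc T) n) → card (class (suc i) (Vec.replicate r (just zero) Vec.++ c)) ≡ card (class (suc i) c)
  new-suc zero i c = refl
  new-suc (suc r) i c = new-suc r i c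
  go : ∀ i → card (class i (Vec.replicate r (just zero) Vec.++ Vec.map (Maybe.map suc) c)) ≡ r
  go zero = trans (new-zero r _) (trans (cong (r +_) (old-zero c)) (+-identityʳ r))
  go (suc i) = trans (new-suc r i _) (trans (old-suc i c) (hc i))

-- The pigeonhole principle for 0/1-valued functions

module _ (_≟A_ : DecidableEquality A) where

  ∑-eq≤1 : ∀ {xs : List A} → Unique xs → ∀ d → ∑ xs (λ x → bit (does (x ≟A d))) ≤ 1
  ∑-eq≤1 [] d = z≤n
  ∑-eq≤1 {x ∷ xs} (x∉ ∷ u) d with x ≟A d
  ... | no _ = ∑-eq≤1 u d
  ... | yes refl = s≤s (≤-reflexive (∑-zero-∈ xs zero'))
    where
    zero' : ∀ y → y ∈ xs → bit (does (y ≟A x)) ≡ 0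
    zero' y y∈ with y ≟A x
    ... | yes refl = ⊥-elim (All.lookup x∉ y∈ refl)
    ... | no _ = refl

  -- As `xs` has no repetitions, each entry of `D` excludes at most one candidate.
  pick-avoiding : ∀ {xs : List A} → Unique xs → ∀ (φ : A → Bool) D → length D < ∑ xs (bit ∘ φ) → Σ A λ x → x ∈ xs × φ x ≡ true × x ∉ D
  pick-avoiding {xs} u φ D big = found (∑-positive xs (λ x → bit (φ x) ∸ inD x D) pos)
    where
    inD : A → List A → ℕ
    inD x D = ∑ D (λ d → bit (does (x ≟A d)))
    total : ∑ xs (λ x → inD x D) ≤ length D
    total = ≤-trans (≤-reflexive (∑-swap xs D _)) (≤-trans (∑-bound-∈ D 1 (λ d _ → ∑-eq≤1 u d)) (≤-reflexive (*-identityʳ _)))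
    pos : 0 < ∑ xs (λ x → bit (φ x) ∸ inD x D)
    pos = +-cancelˡ-< (length D) 0 _ (≤-trans (s≤s (≤-reflexive (+-identityʳ _))) (≤-trans big (≤-trans (∑-mono xs (λ x → m≤n+m∸n (bit (φ x)) (inD x D)))
      (≤-trans (≤-reflexive (∑-+ xs (λ x → inD x D) _)) (+-monoˡ-≤ _ total)))))
    notin : ∀ x D → 0 < 1 ∸ inD x D → x ∉ D
    notin x (d ∷ D) p (here refl) with x ≟A x
    ... | yes _ = case subst (0 <_) (0∸n≡0 (inD x D)) p of λ ()
    ... | no ne = ne refl
    notin x (d ∷ D) p (there q) = notin x D (≤-trans p (∸-monoʳ-≤ 1 (m≤n+m (inD x D) (bit (does (x ≟A d)))))) q
    found : (Σ A λ x → x ∈ xs × 0 < bit (φ x) ∸ inD x D) → Σ A λ x → x ∈ xs × φ x ≡ true × x ∉ D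
    found (x , x∈ , p) with φ x in eq
    ... | true = x , x∈ , eq , notin x D p
    ... | false = case subst (0 <_) (0∸n≡0 (inD x D)) p of λ ()

fins-unique : ∀ m → Unique (fins m)
fins-unique zero = []
fins-unique (suc m) = All.tabulate (λ {x} x∈ e → lem (fins m) (subst (_∈ map suc (fins m)) (sym e) x∈)) ∷ UniqueP.map⁺ FinP.suc-injective (fins-unique m)
  where
  lem : ∀ (xs : List (Fin m)) → Fin.zero ∈ map Fin.suc xs → ⊥
  lem (x ∷ xs) (there p) = lem xs p

-- Frankl's bound

module _ {T : ℕ} (Sat : ℕ → Fin T → Bool) where

  data Transversal : ℕ → List (Fin T) → Set where
    none : Transversal 0 []
    pick : ∀ {m c cs} → Sat m c ≡ true → c ∉ cs → Transversal m cs → Transversal (suc m) (c ∷ cs)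

  transversal-length : ∀ {m cs} → Transversal m cs → length cs ≡ m
  transversal-length none = refl
  transversal-length (pick _ _ tr) = cong suc (transversal-length tr)

  -- Greedy choice: row `i` finds `i` colours taken, so it can fail only if it accepts at most `i`
  -- colours. Since the rows used later are nested, a single such row already yields `rows-bound`.
  transversal : ∀ m → (Σ (List (Fin T)) (Transversal m)) ⊎ (Σ ℕ λ i → i < m × ∑ (fins T) (bit ∘ Sat i) ≤ i)
  transversal zero = inj₁ ([] , none)
  transversal (suc m) with transversal m
  ... | inj₂ (i , i<m , le) = inj₂ (i , m<n⇒m<1+n i<m , le)
  ... | inj₁ (cs , tr) with ∑ (fins T) (bit ∘ Sat m) ≤? m
  ...   | yes le = inj₂ (m , n<1+n m , le)
  ...   | no gt with pick-avoiding FinP._≟_ (fins-unique T) (Sat m) cs (subst (_< ∑ (fins T) (bit ∘ Sat m)) (sym (transversal-length tr)) (≰⇒> gt))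
  ...     | c , _ , e , c∉ = inj₁ (c ∷ cs , pick e c∉ tr)

  -- Inverse to the choice of colours. Relabelling a colouring by it turns the chosen classes into
  -- the classes of a matching and blanks out the others.
  row-of : ∀ {m cs} → Transversal m cs → Fin T → Maybe (Fin m)
  row-of none c = nothing
  row-of (pick {m} {d} _ _ tr) c = if does (d FinP.≟ c) then just (fromℕ m) else Maybe.map inject₁ (row-of tr c)

  row-class : ∀ {m cs} (tr : Transversal m cs) (i : Fin m) → Σ (Fin T) λ d →
    d ∈ cs × Sat (toℕ i) d ≡ true × (∀ c → is i (row-of tr c) ≡ does (d FinP.≟ c))
  row-class (pick {m} {d} {cs} e d∉ tr) i with view i
  ... | ‵fromℕ = d , here refl , subst (λ j → Sat j d ≡ true) (sym (toℕ-fromℕ m)) e , go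
    where
    last-row : (x : Maybe (Fin m)) → is (fromℕ m) (Maybe.map inject₁ x) ≡ false
    last-row nothing = refl
    last-row (just j) with fromℕ m FinP.≟ inject₁ j
    ... | yes p = ⊥-elim (FinP.fromℕ≢inject₁ p)
    ... | no _ = refl
    go : ∀ c → is (fromℕ m) (row-of (pick e d∉ tr) c) ≡ does (d FinP.≟ c)
    go c with d FinP.≟ c
    ... | yes _ = is-refl (fromℕ m)
    ... | no _ = last-row (row-of tr c)
  ... | ‵inject₁ j with row-class tr j
  ...   | d' , d'∈ , e' , cl = d' , there d'∈ , subst (λ j → Sat j d' ≡ true) (sym (FinP.toℕ-inject₁ j)) e' , go
    where
    earlier-row : (x : Maybe (Fin m)) → is (inject₁ j) (Maybe.map inject₁ x) ≡ is j x
    earlier-row nothing = refl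
    earlier-row (just k) with inject₁ j FinP.≟ inject₁ k | j FinP.≟ k
    ... | yes _ | yes _ = refl
    ... | no _ | no _ = refl
    ... | yes p | no q = ⊥-elim (q (FinP.inject₁-injective p))
    ... | no p | yes q = ⊥-elim (p (cong inject₁ q))
    go : ∀ c → is (inject₁ j) (row-of (pick e d∉ tr) c) ≡ does (d' FinP.≟ c)
    go c with d FinP.≟ c
    ... | no _ = trans (earlier-row (row-of tr c)) (cl c)
    ... | yes refl with d' FinP.≟ d | inject₁ j FinP.≟ fromℕ m
    ...   | no _ | no _ = refl
    ...   | yes refl | _ = ⊥-elim (d∉ d'∈)
    ...   | no _ | yes p = ⊥-elim (FinP.fromℕ≢inject₁ (sym p))

zeros : ∀ m → Vec Bool m
zeros m = Vec.replicate m false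

unit : Fin m → Vec Bool m
unit {suc m} zero = true ∷ zeros m
unit (suc i) = false ∷ unit i

card-zeros : ∀ m → card (zeros m) ≡ 0
card-zeros zero = refl
card-zeros (suc m) = card-zeros m

card-unit : (i : Fin m) → card (unit i) ≡ 1
card-unit {suc m} zero = cong suc (card-zeros m)
card-unit (suc i) = card-unit i

card-++ : ∀ {a b} (v : Vec Bool a) (w : Vec Bool b) → card (v Vec.++ w) ≡ card v + card w
card-++ [] w = refl
card-++ (x ∷ v) w = trans (cong (bit x +_) (card-++ v w)) (sym (+-assoc (bit x) (card v) (card w)))

zeros⋖unit : (i : Fin m) → zeros m ⋖ unit i
zeros⋖unit zero = here
zeros⋖unit (suc i) = there (zeros⋖unit i)

unit-mono : (G : Fam m) → Shifted G → (j i : Fin m) → toℕ j ≤ toℕ i → G (unit j) ≡ true → G (unit i) ≡ true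
unit-mono G sh zero zero _ e = e
unit-mono G sh zero (suc i) _ e = move-head G sh (zeros⋖unit i) e
unit-mono G sh (suc j) (suc i) (s≤s p) e = unit-mono (G ∘ (false ∷_)) (λ q → sh (there q)) j i p e

rainbow : ∀ m → Colouring m m
rainbow zero = []
rainbow (suc m) = just zero ∷ Vec.map (Maybe.map suc) (rainbow m)

class-rainbow : (i : Fin m) → class i (rainbow m) ≡ unit i
class-rainbow {suc m} zero = cong (true ∷_) (lem (rainbow m))
  where
  lem : ∀ {k} (c : Colouring m k) → class zero (Vec.map (Maybe.map suc) c) ≡ zeros k
  lem [] = refl
  lem (nothing ∷ c) = cong (false ∷_) (lem c)
  lem (just _ ∷ c) = cong (false ∷_) (lem c)
class-rainbow {suc m} (suc i) = cong (false ∷_) (trans (lem (rainbow m)) (class-rainbow i))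
  where
  lem : ∀ {k} (c : Colouring m k) → class (suc i) (Vec.map (Maybe.map suc) c) ≡ class i c
  lem [] = refl
  lem (nothing ∷ c) = cong (false ∷_) (lem c)
  lem (just j ∷ c) = cong (is i (just j) ∷_) (lem c)

⟶-++ʳ : ∀ {a b} {v w : Vec Bool a} (u : Vec Bool b) → v ⟶ w → (v Vec.++ u) ⟶ (w Vec.++ u)
⟶-++ʳ u here = here
⟶-++ʳ u (there p) = there (⟶-++ʳ u p)

⟶-++ˡ : ∀ {a b} (u : Vec Bool a) {v w : Vec Bool b} → v ⟶ w → (u Vec.++ v) ⟶ (u Vec.++ w)
⟶-++ˡ [] p = p
⟶-++ˡ (x ∷ u) p = there (⟶-++ˡ u p)

⋖-++ˡ : ∀ {a b} (u : Vec Bool a) {v w : Vec Bool b} → v ⋖ w → (u Vec.++ v) ⋖ (u Vec.++ w)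
⋖-++ˡ [] p = p
⋖-++ˡ (x ∷ u) p = there (⋖-++ˡ u p)

-- For the members that avoid the last positions, this puts the shadow of their family into
-- `row zero`.
move-behind : ∀ {a b} (F : Fam (a + suc b)) → Shifted F → ∀ {v w : Vec Bool a} (u : Vec Bool b) → v ⋖ w →
  F (w Vec.++ (false ∷ u)) ≡ true → F (v Vec.++ (true ∷ u)) ≡ true
move-behind F sh u (here {v = v}) e = move-head F sh (⋖-++ˡ v here) e
move-behind F sh u (there {x = x} p) e = move-behind (F ∘ (x ∷_)) (λ q → sh (there q)) u p e

-- This compares the sums over all vectors other than zero; the two exempted terms change sides so
-- that nothing is subtracted. In `units-bound` the unit vectors are exempted as well.
zeros-bound : ∀ m {φ ψ : Vec Bool m → ℕ} → (∀ v → φ v ≤ ψ v) → ∑ (vecs m) φ + ψ (zeros m) ≤ ∑ (vecs m) ψ + φ (zeros m)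
zeros-bound zero {φ} {ψ} h = ≤-reflexive (lem (φ []) (ψ []))
  where
  lem : ∀ a b → (a + 0) + b ≡ (b + 0) + a
  lem = solve-∀
zeros-bound (suc m) {φ} {ψ} h = begin
  ∑ (vecs (suc m)) φ + ψ z ≡⟨ cong (_+ ψ z) (∑-vecs m φ) ⟩
  (∑ V (φ ∘ (false ∷_)) + ∑ V (φ ∘ (true ∷_))) + ψ z ≡⟨ lem (∑ V (φ ∘ (false ∷_))) _ (ψ z) ⟩
  (∑ V (φ ∘ (false ∷_)) + ψ z) + ∑ V (φ ∘ (true ∷_)) ≤⟨ +-mono-≤ (zeros-bound m (λ v → h (false ∷ v))) (∑-mono V (λ v → h (true ∷ v))) ⟩
  (∑ V (ψ ∘ (false ∷_)) + φ z) + ∑ V (ψ ∘ (true ∷_)) ≡⟨ lem (∑ V (ψ ∘ (false ∷_))) (∑ V (ψ ∘ (true ∷_))) (φ z) ⟨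
  (∑ V (ψ ∘ (false ∷_)) + ∑ V (ψ ∘ (true ∷_))) + φ z ≡⟨ cong (_+ φ z) (∑-vecs m ψ) ⟨
  ∑ (vecs (suc m)) ψ + φ z ∎
  where
  open ≤-Reasoning
  V = vecs m
  z = zeros (suc m)
  lem : ∀ a b c → (a + b) + c ≡ (a + c) + b
  lem = solve-∀

units-bound : ∀ m {φ ψ : Vec Bool m → ℕ} → (∀ v → φ v ≤ ψ v) →
  ∑ (vecs m) φ + (ψ (zeros m) + ∑ (fins m) (ψ ∘ unit)) ≤ ∑ (vecs m) ψ + (φ (zeros m) + ∑ (fins m) (φ ∘ unit))
units-bound zero {φ} {ψ} h = ≤-reflexive (lem (φ []) (ψ []))
  where
  lem : ∀ a b → (a + 0) + (b + 0) ≡ (b + 0) + (a + 0)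
  lem = solve-∀
units-bound (suc m) {φ} {ψ} h = begin
  ∑ (vecs (suc m)) φ + (ψ z + ∑ (fins (suc m)) (ψ ∘ unit)) ≡⟨ cong₂ (λ a b → a + (ψ z + b)) (∑-vecs m φ) (∑-fins m (ψ ∘ unit)) ⟩
  (∑ V (φ ∘ (false ∷_)) + ∑ V (φ ∘ (true ∷_))) + (ψ z + (ψ (true ∷ zeros m) + ∑ (fins m) (ψ ∘ unit ∘ suc))) ≡⟨ lem (∑ V (φ ∘ (false ∷_))) (∑ V (φ ∘ (true ∷_))) (ψ z) _ _ ⟩
  (∑ V (φ ∘ (false ∷_)) + (ψ z + ∑ (fins m) (ψ ∘ unit ∘ suc))) + (∑ V (φ ∘ (true ∷_)) + ψ (true ∷ zeros m))
    ≤⟨ +-mono-≤ (units-bound m (λ v → h (false ∷ v))) (zeros-bound m (λ v → h (true ∷ v))) ⟩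
  (∑ V (ψ ∘ (false ∷_)) + (φ z + ∑ (fins m) (φ ∘ unit ∘ suc))) + (∑ V (ψ ∘ (true ∷_)) + φ (true ∷ zeros m)) ≡⟨ lem (∑ V (ψ ∘ (false ∷_))) (∑ V (ψ ∘ (true ∷_))) (φ z) _ _ ⟨
  (∑ V (ψ ∘ (false ∷_)) + ∑ V (ψ ∘ (true ∷_))) + (φ z + (φ (true ∷ zeros m) + ∑ (fins m) (φ ∘ unit ∘ suc))) ≡⟨ cong₂ (λ a b → a + (φ z + b)) (∑-vecs m ψ) (∑-fins m (φ ∘ unit)) ⟨
  ∑ (vecs (suc m)) ψ + (φ z + ∑ (fins (suc m)) (φ ∘ unit)) ∎
  where
  open ≤-Reasoning
  V = vecs m
  z = zeros (suc m)
  lem : ∀ a b c d e → (a + b) + (c + (d + e)) ≡ (a + (c + e)) + (b + d)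
  lem = solve-∀

initial-sum-bound : ∀ t (b : Fin t → ℕ) i x T → i ≤ t → (∀ j → toℕ j < i → b j ≤ x) → (∀ j → b j ≤ T) → ∑ (fins t) b ≤ i * x + (t ∸ i) * T
initial-sum-bound t b zero x T _ _ h = ≤-trans (∑-bound-∈ (fins t) T (λ j _ → h j)) (≤-reflexive (cong (_* T) (length-fins t)))
initial-sum-bound (suc t) b (suc i) x T (s≤s i≤t) lo h = begin
  ∑ (fins (suc t)) b ≡⟨ ∑-fins t b ⟩
  b zero + ∑ (fins t) (b ∘ suc) ≤⟨ +-mono-≤ (lo zero z<s) (initial-sum-bound t (b ∘ suc) i x T i≤t (λ j p → lo (suc j) (s<s p)) (h ∘ suc)) ⟩
  x + (i * x + (t ∸ i) * T) ≡⟨ +-assoc x (i * x) _ ⟨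
  x + i * x + (t ∸ i) * T ∎
  where open ≤-Reasoning

-- With `x = toℕ i`, the rows up to `i` are at most `x` and the remaining `t - x` rows at most
-- `t + e`. The resulting total falls short of `t * (t + e)` by `(t - x) * x`.
rows-bound : ∀ t e (a : Fin (suc t) → ℕ) (i : Fin (suc t)) → a i ≤ toℕ i → (∀ j → toℕ j ≤ toℕ i → a j ≤ a i) → (∀ j → a j ≤ t + e) →
  ∑ (fins t) (a ∘ suc) + e * a zero ≤ t * (t + e)
rows-bound t e a i ai mono top = begin
  ∑ (fins t) (a ∘ suc) + e * a zero
    ≤⟨ +-mono-≤ (initial-sum-bound t (a ∘ suc) x x (t + e) x≤t (λ j p → ≤-trans (mono (suc j) p) ai) (top ∘ suc)) (*-monoʳ-≤ e (≤-trans (mono zero z≤n) ai)) ⟩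
  x * x + (t ∸ x) * (t + e) + e * x ≤⟨ m≤m+n _ ((t ∸ x) * x) ⟩
  x * x + (t ∸ x) * (t + e) + e * x + (t ∸ x) * x ≡⟨ cong (λ s → x * x + (t ∸ x) * (s + e) + e * x + (t ∸ x) * x) (m+[n∸m]≡n x≤t) ⟨
  x * x + (t ∸ x) * ((x + (t ∸ x)) + e) + e * x + (t ∸ x) * x ≡⟨ lem x (t ∸ x) e ⟩
  (x + (t ∸ x)) * ((x + (t ∸ x)) + e) ≡⟨ cong (λ s → s * (s + e)) (m+[n∸m]≡n x≤t) ⟩
  t * (t + e) ∎
  where
  open ≤-Reasoning
  x = toℕ i
  x≤t : x ≤ t
  x≤t = ≤-pred (toℕ<n i)
  lem : ∀ x d e → x * x + d * ((x + d) + e) + e * x + d * x ≡ (x + d) * ((x + d) + e)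
  lem = solve-∀

prefix-≤ : ∀ p {y b} (v : Vec Bool y) (w : Vec Bool b) → p ≤ y → prefix p (v Vec.++ w) ≡ prefix p v
prefix-≤ zero v w _ = refl
prefix-≤ (suc p) (x ∷ v) w (s≤s h) = cong (bit x +_) (prefix-≤ p v w h)

count-in-prefix : ∀ p y r → p ≤ y → bin p r ≤ ∑ (vecs y) (λ v → bit ((card v == r) ∧ (prefix p v == r)))
count-in-prefix zero y zero _ = ≤-trans (≤-reflexive (sym (count-card y 0))) (∑-mono (vecs y) (λ v → bit-imp {card v == 0} (λ e → cong₂ _∧_ e refl)))
count-in-prefix zero y (suc r) _ = z≤n
count-in-prefix (suc p) (suc y) zero (s≤s h) = ≤-trans (count-in-prefix p y zero h) (≤-trans (m≤m+n _ _)
  (≤-reflexive (sym (∑-vecs y (λ v → bit ((card v == 0) ∧ (prefix (suc p) v == 0)))))))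
count-in-prefix (suc p) (suc y) (suc r) (s≤s h) = begin
  bin p r + bin p (suc r) ≡⟨ +-comm (bin p r) _ ⟩
  bin p (suc r) + bin p r ≤⟨ +-mono-≤ (count-in-prefix p y (suc r) h) (count-in-prefix p y r h) ⟩
  _ ≡⟨ ∑-vecs y (λ v → bit ((card v == suc r) ∧ (prefix (suc p) v == suc r))) ⟨
  ∑ (vecs (suc y)) (λ v → bit ((card v == suc r) ∧ (prefix (suc p) v == suc r))) ∎
  where open ≤-Reasoning

-- The last `suc t` positions act as the first `suc t` vertices in Frankl's argument. A slice
-- collects the traces, on the other `y` positions, of the members that meet the last positions in
-- `u`. The rows are the slices at single positions; they are nested, `row zero` being the smallest.
module Slices {y t r : ℕ} (F : Fam (y + suc t)) (sh : Shifted F) (uni : Uniform (suc r) F) (nm : NoMatching F t) where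

  slice : Vec Bool (suc t) → Fam y
  slice u v = F (v Vec.++ u)

  S₀ : ℕ
  S₀ = size (slice (zeros (suc t)))

  row : Fin (suc t) → Fam y
  row i = slice (unit i)

  row-uniform : ∀ i → Uniform r (row i)
  row-uniform i v e = suc-injective (trans (trans (+-comm 1 (card v)) (cong (card v +_) (sym (card-unit i)))) (trans (sym (card-++ v (unit i))) (uni _ e)))

  row-mono : ∀ j i → toℕ j ≤ toℕ i → ∀ v → row j v ≡ true → row i v ≡ true
  row-mono j i p v = unit-mono (λ u → F (v Vec.++ u)) (λ q → sh (⟶-++ˡ v q)) j i p

  outside-bound : S₀ ≤ t * size (row zero)
  outside-bound = shadow-bound y (suc r) t (slice (zeros (suc t))) (row zero) (λ q → sh (⟶-++ʳ _ q))
    (λ v e → trans (sym (trans (card-++ v (zeros (suc t))) (trans (cong (card v +_) (card-zeros (suc t))) (+-identityʳ (card v))))) (uni _ e))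
    (λ c h → nm (c Vec.++ Vec.replicate (suc t) nothing) (λ i → trans (cong F (trans (map-++ (is i) c (Vec.replicate (suc t) nothing)) (cong (class i c Vec.++_) (map-replicate (is i) nothing (suc t))))) (h i)))
    (λ q → move-behind F sh (zeros t) q)

  -- `transversal` numbers its rows by natural numbers, so the rows are continued by empty families.
  rowℕ : ℕ → Fam y
  rowℕ i v with i <? suc t
  ... | yes p = row (fromℕ< p) v
  ... | no _ = false

  rowℕ-toℕ : ∀ i v → rowℕ (toℕ i) v ≡ row i v
  rowℕ-toℕ i v with toℕ i <? suc t
  ... | yes p = cong (λ j → row j v) (FinP.fromℕ<-toℕ i p)
  ... | no ¬p = ⊥-elim (¬p (toℕ<n i))

  -- The colour classes of c that lie in the nested rows have no system of distinct representatives, for it would extend to a matching of F.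
  colouring-bound : ∀ e (c : Colouring (t + e) y) → let a = λ i → ∑ (fins (t + e)) (λ d → bit (row i (class d c))) in
    ∑ (fins t) (a ∘ suc) + e * a zero ≤ t * (t + e)
  colouring-bound e c with transversal (λ i d → rowℕ i (class d c)) (suc t)
  ... | inj₂ (i , i<t , le) = rows-bound t e a (fromℕ< i<t) small (λ j p → ∑-mono (fins (t + e)) (λ d → bit-imp (row-mono j _ p (class d c))))
      (λ j → ≤-trans (∑-bound-∈ (fins (t + e)) 1 (λ d _ → bit≤1 _)) (≤-reflexive (trans (*-identityʳ _) (length-fins (t + e)))))
    where
    a : Fin (suc t) → ℕ
    a i = ∑ (fins (t + e)) (λ d → bit (row i (class d c)))
    small : a (fromℕ< i<t) ≤ toℕ (fromℕ< i<t)
    small = ≤-trans (≤-reflexive (∑-cong (fins (t + e)) (λ d → cong bit (trans (sym (rowℕ-toℕ (fromℕ< i<t) (class d c))) (cong (λ j → rowℕ j (class d c)) (toℕ-fromℕ< i<t))))))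
      (≤-trans le (≤-reflexive (sym (toℕ-fromℕ< i<t))))
  -- The set chosen for row `i` is completed by the `i`-th of the last positions, which is what
  -- `rainbow` adds.
  ... | inj₁ (cs , tr) = ⊥-elim (nm (Vec.map relabel c Vec.++ rainbow (suc t)) member)
    where
    relabel : Maybe (Fin (t + e)) → Maybe (Fin (suc t))
    relabel nothing = nothing
    relabel (just d) = row-of _ tr d
    member : ∀ i → F (class i (Vec.map relabel c Vec.++ rainbow (suc t))) ≡ true
    member i with row-class _ tr i
    ... | d , _ , sat , cl = trans (cong F (trans (map-++ (is i) (Vec.map relabel c) (rainbow (suc t))) (cong₂ Vec._++_ (same c) (class-rainbow i))))
        (trans (sym (rowℕ-toℕ i (class d c))) sat)
      where
      same : ∀ {k} (c : Colouring (t + e) k) → class i (Vec.map relabel c) ≡ class d c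
      same [] = refl
      same (nothing ∷ c) = cong (false ∷_) (same c)
      same (just x ∷ c) = cong₂ _∷_ (cl x) (same c)

  -- Over all rearrangements of a colouring with `t + e` classes of size `r`, each class becomes
  -- every `r`-set equally often, so averaging `colouring-bound` turns the counts of classes into
  -- sizes of rows.
  rows-average : ∀ e → 0 < t + e → (t + e) * r ≤ y → ∑ (fins t) (size ∘ row ∘ suc) + e * size (row zero) ≤ t * bin y r
  rows-average e pos Tr≤y = *-cancelˡ-≤ (T * κ) {{>-nonZero (*-mono-≤ pos κ>0)}} (begin
    T * κ * (∑ (fins t) (size ∘ row ∘ suc) + e * size (row zero)) ≡⟨ trans (*-distribˡ-+ (T * κ) _ (e * size (row zero))) (cong₂ _+_ (sym (∑-*ˡ (T * κ) (fins t) (size ∘ row ∘ suc))) (lem T κ e (size (row zero)))) ⟩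
    ∑ (fins t) (λ j → T * κ * size (row (suc j))) + e * (T * κ * size (row zero)) ≡⟨ cong₂ _+_ (∑-cong (fins t) (λ j → averaged (suc j))) (cong (e *_) (averaged zero)) ⟨
    ∑ (fins t) (λ j → ∑ sh' (a (suc j))) + e * ∑ sh' (a zero) ≡⟨ cong₂ _+_ (∑-swap (fins t) sh' (a ∘ suc)) (sym (∑-*ˡ e sh' (a zero))) ⟩
    ∑ sh' (λ c → ∑ (fins t) (λ j → a (suc j) c)) + ∑ sh' (λ c → e * a zero c) ≡⟨ ∑-+ sh' (λ c → ∑ (fins t) (λ j → a (suc j) c)) _ ⟨
    ∑ sh' (λ c → ∑ (fins t) (λ j → a (suc j) c) + e * a zero c) ≤⟨ ∑-mono sh' (λ c → colouring-bound e c) ⟩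
    ∑ sh' (λ c → t * T) ≡⟨ trans (∑-cong sh' (λ c → sym (*-identityʳ (t * T)))) (∑-*ˡ (t * T) sh' (λ _ → 1)) ⟩
    t * T * ∑ sh' (λ c → 1) ≡⟨ cong (t * T *_) total ⟩
    t * T * (κ * bin y r) ≡⟨ lem₂ t T κ (bin y r) ⟩
    T * κ * (t * bin y r) ∎)
    where
    open ≤-Reasoning
    T = t + e
    c₀ : Colouring T y
    c₀ = proj₁ (equitable T r y Tr≤y)
    hc₀ : ∀ d → card (class d c₀) ≡ r
    hc₀ = proj₂ (equitable T r y Tr≤y)
    κ : ℕ
    κ = r ! * (y ∸ r) !
    κ>0 : 1 ≤ κ
    κ>0 = *-mono-≤ (1≤n! r) (1≤n! (y ∸ r))
    κ-class : ∀ d → card (class d c₀) ! * cocard (class d c₀) ! ≡ κ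
    κ-class d = cong₂ (λ a b → a ! * b !) (hc₀ d) (trans (sym (m+n∸m≡n (card (class d c₀)) _)) (cong₂ _∸_ (card+cocard (class d c₀)) (hc₀ d)))
    sh' : List (Colouring T y)
    sh' = shuffles c₀
    a : Fin (suc t) → Colouring T y → ℕ
    a i c = ∑ (fins T) (λ d → bit (row i (class d c)))
    lem : ∀ T κ e s → T * κ * (e * s) ≡ e * (T * κ * s)
    lem = solve-∀
    lem₂ : ∀ t T κ b → t * T * (κ * b) ≡ T * κ * (t * b)
    lem₂ = solve-∀
    per-class : ∀ (χ : Fam y) → Uniform r χ → ∀ d → ∑ sh' (λ c → bit (χ (class d c))) ≡ κ * size χ
    per-class χ u d = trans (∑-shuffles-map (is d) c₀ (bit ∘ χ)) (trans (∑-shuffles (class d c₀) (bit ∘ χ) support) (cong (_* size χ) (κ-class d)))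
      where
      support : ∀ v → card v ≢ card (class d c₀) → bit (χ v) ≡ 0
      support v ne with χ v in eq
      ... | false = refl
      ... | true = ⊥-elim (ne (trans (u v eq) (sym (hc₀ d))))
    averaged : ∀ i → ∑ sh' (a i) ≡ T * κ * size (row i)
    averaged i = trans (∑-swap sh' (fins T) (λ c d → bit (row i (class d c)))) (trans (∑-cong (fins T) (per-class (row i) (row-uniform i)))
      (trans (∑-const (fins T) (κ * size (row i))) (trans (cong (_* (κ * size (row i))) (length-fins T)) (sym (*-assoc T κ _)))))
    d₀ : Fin T
    d₀ = fromℕ< pos
    -- Evaluating the averaging formula on the family of all `r`-sets gives the number of
    -- rearrangements in the form that cancels.
    total : ∑ sh' (λ c → 1) ≡ κ * bin y r
    total = begin-equality
      ∑ sh' (λ c → 1) ≡⟨ ∑-shuffles-map (is d₀) c₀ (λ _ → 1) ⟩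
      ∑ (shuffles (class d₀ c₀)) (λ _ → 1) ≡⟨ ∑-cong (shuffles (class d₀ c₀)) (λ _ → bit-true (trans (cong (_== r) (hc₀ d₀)) (==-refl r))) ⟨
      ∑ (shuffles (class d₀ c₀)) (λ _ → bit (card (class d₀ c₀) == r)) ≡⟨ shuffles-card (class d₀ c₀) (λ k → bit (k == r)) ⟨
      ∑ (shuffles (class d₀ c₀)) (λ v → bit (card v == r)) ≡⟨ ∑-shuffles-map (is d₀) c₀ (λ v → bit (card v == r)) ⟨
      ∑ sh' (λ c → bit (card (class d₀ c) == r)) ≡⟨ per-class (λ v → card v == r) (λ v → ==-true (card v) r) d₀ ⟩
      κ * ∑ (vecs y) (λ v → bit (card v == r)) ≡⟨ cong (κ *_) (count-card y r) ⟩
      κ * bin y r ∎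

  -- All sets with two or more elements among the last positions are granted; only the slices at
  -- zero and at the unit vectors have to be estimated.
  size-bound : size F + (bin y (suc r) + suc t * bin y r) ≤ bin (y + suc t) (suc r) + (S₀ + ∑ (fins (suc t)) (size ∘ row))
  size-bound = begin
    size F + (bin y (suc r) + suc t * bin y r)
      ≡⟨ cong₂ _+_ (regroup (bit ∘ F)) (cong₂ _+_ (sym (full-slice (zeros (suc t)) (λ v → trans (cong (card v +_) (card-zeros (suc t))) (+-identityʳ _))))
           (trans (cong (_* bin y r) (sym (length-fins (suc t)))) (trans (sym (∑-const (fins (suc t)) (bin y r)))
             (sym (∑-cong (fins (suc t)) (λ i → unit-slice i)))))) ⟩
    ∑ U (λ u → size (slice u)) + (full (zeros (suc t)) + ∑ (fins (suc t)) (full ∘ unit)) ≤⟨ units-bound (suc t) slice≤full ⟩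
    ∑ U full + (S₀ + ∑ (fins (suc t)) (size ∘ row)) ≡⟨ cong (_+ (S₀ + ∑ (fins (suc t)) (size ∘ row))) (trans (sym (regroup (λ v → bit (card v == suc r)))) (count-card (y + suc t) (suc r))) ⟩
    bin (y + suc t) (suc r) + (S₀ + ∑ (fins (suc t)) (size ∘ row)) ∎
    where
    open ≤-Reasoning
    U = vecs (suc t)
    full : Vec Bool (suc t) → ℕ
    full u = ∑ (vecs y) (λ v → bit (card (v Vec.++ u) == suc r))
    regroup : ∀ (φ : Vec Bool (y + suc t) → ℕ) → ∑ (vecs (y + suc t)) φ ≡ ∑ U (λ u → ∑ (vecs y) (λ v → φ (v Vec.++ u)))
    regroup φ = trans (∑-vecs-++ y (suc t) φ) (∑-swap (vecs y) U (λ v u → φ (v Vec.++ u)))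
    slice≤full : ∀ u → size (slice u) ≤ full u
    slice≤full u = ∑-mono (vecs y) (λ v → bit-imp {slice u v} (λ e → trans (cong (_== suc r) (uni _ e)) (==-refl (suc r))))
    full-slice : ∀ u → (∀ v → card v + card u ≡ card v) → full u ≡ bin y (suc r)
    full-slice u h = trans (∑-cong (vecs y) (λ v → cong (λ x → bit (x == suc r)) (trans (card-++ v u) (h v)))) (count-card y (suc r))
    unit-slice : ∀ i → full (unit i) ≡ bin y r
    unit-slice i = trans (∑-cong (vecs y) (λ v → cong (λ x → bit (x == suc r)) (trans (card-++ v (unit i)) (trans (cong (card v +_) (card-unit i)) (+-comm (card v) 1))))) (count-card y r)

  -- A set of a row has the same elements among the first `p` positions as the member it comes from.
  -- By `few` it is therefore none of the `bin p r` sets of size `r` inside that segment.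
  row-bound : ∀ p → p ≤ y → (∀ v → F v ≡ true → prefix p v < r) → ∀ i → size (row i) + bin p r ≤ bin y r
  row-bound p p≤y few i = begin
    size (row i) + bin p r ≤⟨ +-monoʳ-≤ (size (row i)) (count-in-prefix p y r p≤y) ⟩
    size (row i) + ∑ (vecs y) (λ v → bit ((card v == r) ∧ (prefix p v == r))) ≡⟨ ∑-+ (vecs y) (bit ∘ row i) _ ⟨
    ∑ (vecs y) (λ v → bit (row i v) + bit ((card v == r) ∧ (prefix p v == r))) ≤⟨ ∑-mono (vecs y) pt ⟩
    ∑ (vecs y) (λ v → bit (card v == r)) ≡⟨ count-card y r ⟩
    bin y r ∎
    where
    open ≤-Reasoning
    pt : ∀ v → bit (row i v) + bit ((card v == r) ∧ (prefix p v == r)) ≤ bit (card v == r)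
    pt v with row i v in eq
    ... | false = bit-imp {(card v == r) ∧ (prefix p v == r)} (λ e → proj₁ (∧-true _ _ e))
    ... | true with prefix p v == r in eq'
    ...   | true = ⊥-elim (<-irrefl (==-true (prefix p v) r eq') (subst (_< r) (prefix-≤ p v (unit i) p≤y) (few _ eq)))
    ...   | false rewrite row-uniform i v eq | ==-refl r = ≤-refl

  -- By `outside-bound` the slices to be estimated contribute at most `suc t * a₀ + a₊`. There are
  -- two inequalities: `a₊ + c * a₀ ≤ t * b` by averaging and `a₊ + t * q ≤ t * b` by `few`.
  -- Weighted with `suc t` and `z`, which add up to `c`, they give `c * (suc t * a₀ + a₊) + z * (t *
  -- q) ≤ c * (t * b)`. For `z = 0` this is Frankl's theorem; the term with `q` is the gain.
  shifted-bound : ∀ p z → p ≤ y → (∀ v → F v ≡ true → prefix p v < r) → r * (2 * t + 1 + z) ≤ y →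
    (t + 1 + z) * size F + (t + 1 + z) * bin (suc y) (suc r) + z * (t * bin p r) ≤ (t + 1 + z) * bin (y + suc t) (suc r)
  shifted-bound p z p≤y few big = +-cancelʳ-≤ (c * (t * b)) _ _ (begin
    (c * size F + c * (b + b') + z * (t * q)) + c * (t * b) ≡⟨ lem₁ c (size F) b b' (z * (t * q)) t ⟩
    c * (size F + (b' + suc t * b)) + z * (t * q) ≤⟨ +-monoˡ-≤ (z * (t * q)) (*-monoʳ-≤ c size-bound) ⟩
    c * (n' + (S₀ + ∑ (fins (suc t)) (size ∘ row))) + z * (t * q) ≡⟨ cong (λ x → c * (n' + (S₀ + x)) + z * (t * q)) (∑-fins t (size ∘ row)) ⟩
    c * (n' + (S₀ + (a₀ + a₊))) + z * (t * q) ≤⟨ +-monoˡ-≤ (z * (t * q)) (*-monoʳ-≤ c (+-monoʳ-≤ n' (+-monoˡ-≤ (a₀ + a₊) outside-bound))) ⟩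
    c * (n' + (t * a₀ + (a₀ + a₊))) + z * (t * q) ≡⟨ lem₂ t z n' a₀ a₊ (t * q) ⟩
    c * n' + (suc t * (a₊ + c * a₀) + z * (a₊ + t * q)) ≤⟨ +-monoʳ-≤ (c * n') (+-mono-≤ (*-monoʳ-≤ (suc t) average) (*-monoʳ-≤ z gain)) ⟩
    c * n' + (suc t * (t * b) + z * (t * b)) ≡⟨ lem₃ t z (c * n') (t * b) ⟩
    c * n' + c * (t * b) ∎)
    where
    open ≤-Reasoning
    c = t + 1 + z
    b = bin y r
    b' = bin y (suc r)
    q = bin p r
    n' = bin (y + suc t) (suc r)
    a₀ = size (row zero)
    a₊ = ∑ (fins t) (size ∘ row ∘ suc)
    -- Taking `e = c` means `2 * t + 1 + z` colour classes of size `r`, which is what `big` provides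
    -- for.
    average : a₊ + c * a₀ ≤ t * b
    average = rows-average c (≤-trans z<s (≤-trans (≤-reflexive (lem t z)) (m≤n+m c t))) (≤-trans (≤-reflexive (lem' r t z)) big)
      where
      lem : ∀ t z → suc (t + z) ≡ t + 1 + z
      lem = solve-∀
      lem' : ∀ r t z → (t + (t + 1 + z)) * r ≡ r * (2 * t + 1 + z)
      lem' = solve-∀
    gain : a₊ + t * q ≤ t * b
    gain = begin
      a₊ + t * q ≡⟨ cong (a₊ +_) (trans (∑-const (fins t) q) (cong (_* q) (length-fins t))) ⟨
      a₊ + ∑ (fins t) (λ _ → q) ≡⟨ ∑-+ (fins t) (size ∘ row ∘ suc) (λ _ → q) ⟨
      ∑ (fins t) (λ i → size (row (suc i)) + q) ≤⟨ ∑-bound-∈ (fins t) b (λ i _ → row-bound p p≤y few (suc i)) ⟩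
      length (fins t) * b ≡⟨ cong (_* b) (length-fins t) ⟩
      t * b ∎
    lem₁ : ∀ c s b b' w t → (c * s + c * (b + b') + w) + c * (t * b) ≡ c * (s + (b' + suc t * b)) + w
    lem₁ = solve-∀
    lem₂ : ∀ t z n a₀ a x → (t + 1 + z) * (n + (t * a₀ + (a₀ + a))) + z * x ≡ (t + 1 + z) * n + (suc t * (a + (t + 1 + z) * a₀) + z * (a + x))
    lem₂ = solve-∀
    lem₃ : ∀ t z x w → x + (suc t * w + z * w) ≡ x + (t + 1 + z) * w
    lem₃ = solve-∀

frankl : ∀ {y t r} p z (F : Fam (y + suc t)) → Uniform (suc r) F → NoMatching F t → p ≤ y → (∀ v → F v ≡ true → prefix p v < r) → r * (2 * t + 1 + z) ≤ y →
  (t + 1 + z) * size F + (t + 1 + z) * bin (suc y) (suc r) + z * (t * bin p r) ≤ (t + 1 + z) * bin (y + suc t) (suc r)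
frankl {y} {t} {r} p z F uni nm p≤y few big with shifted-family P P-shift F (uni , nm , few)
  where
  P : Fam (y + suc t) → Set
  P F = Uniform (suc r) F × NoMatching F t × (∀ v → F v ≡ true → prefix p v < r)
  P-shift : ∀ j F → P F → P (shift j F)
  P-shift j F (uni , nm , few) = shift-⊆ j F (λ v → card v ≡ suc r) (λ q e → trans (sym (⟶-card q)) e) uni
    , shift-NoMatching j F t nm
    , shift-⊆ j F (λ v → prefix p v < r) (λ q e → ≤-<-trans (⟶-prefix p q) e) few
... | F' , (uni' , nm' , few') , sh , sz = subst (λ s → (t + 1 + z) * s + (t + 1 + z) * bin (suc y) (suc r) + z * (t * bin p r) ≤ (t + 1 + z) * bin (y + suc t) (suc r)) sz
  (Slices.shifted-bound F' sh uni' nm' p z p≤y few' big)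

-- Combinations and sublists

combs : ℕ → List A → List (List A)
combs zero xs = [] ∷ []
combs (suc l) [] = []
combs (suc l) (x ∷ xs) = map (x ∷_) (combs l xs) ++ combs (suc l) xs

-- The empty sublist is kept apart, since sampling distinguishes the blocks that a set misses from
-- those that it meets.
nonempties : List A → List (List A)
nonempties [] = []
nonempties (x ∷ xs) = map (x ∷_) ([] ∷ nonempties xs) ++ nonempties xs

subs : List A → List (List A)
subs xs = [] ∷ nonempties xs

∑-combs : ∀ l (x : A) xs φ → ∑ (combs (suc l) (x ∷ xs)) φ ≡ ∑ (combs l xs) (φ ∘ (x ∷_)) + ∑ (combs (suc l) xs) φ
∑-combs l x xs φ = trans (∑-++ (map (x ∷_) (combs l xs)) _ φ) (cong (_+ ∑ (combs (suc l) xs) φ) (∑-map (x ∷_) (combs l xs) φ))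

∑-subs : ∀ (x : A) xs φ → ∑ (subs (x ∷ xs)) φ ≡ ∑ (subs xs) φ + ∑ (subs xs) (φ ∘ (x ∷_))
∑-subs x xs φ = trans (cong (φ [] +_) (trans (∑-++ (map (x ∷_) (subs xs)) (nonempties xs) φ) (cong (_+ ∑ (nonempties xs) φ) (∑-map (x ∷_) (subs xs) φ))))
  (lem (φ []) _ _)
  where
  lem : ∀ a b c → a + (b + c) ≡ (a + c) + b
  lem = solve-∀

∑-subs-++ : ∀ (xs ys : List A) φ → ∑ (subs (xs ++ ys)) φ ≡ ∑ (subs xs) (λ f → ∑ (subs ys) (λ g → φ (f ++ g)))
∑-subs-++ [] ys φ = sym (+-identityʳ _)
∑-subs-++ (x ∷ xs) ys φ = trans (∑-subs x (xs ++ ys) φ) (trans (cong₂ _+_ (∑-subs-++ xs ys φ) (∑-subs-++ xs ys (φ ∘ (x ∷_))))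
  (sym (∑-subs x xs (λ f → ∑ (subs ys) (λ g → φ (f ++ g))))))

∑-subs-length : ∀ l (xs : List A) φ → ∑ (subs xs) (λ f → bit (length f == l) * φ f) ≡ ∑ (combs l xs) φ
∑-subs-length zero [] φ = lem (φ [])
  where
  lem : ∀ a → a + 0 + 0 ≡ a + 0
  lem = solve-∀
∑-subs-length (suc l) [] φ = refl
∑-subs-length zero (x ∷ xs) φ = trans (∑-subs x xs (λ f → bit (length f == 0) * φ f)) (trans (cong₂ _+_ (∑-subs-length zero xs φ) (∑-zero (subs xs) (λ _ → refl))) (+-identityʳ _))
∑-subs-length (suc l) (x ∷ xs) φ = trans (∑-subs x xs (λ f → bit (length f == suc l) * φ f)) (trans (cong₂ _+_ (∑-subs-length (suc l) xs φ) (∑-subs-length l xs (φ ∘ (x ∷_))))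
  (trans (+-comm (∑ (combs (suc l) xs) φ) _) (sym (∑-combs l x xs φ))))

length-combs : ∀ l (xs : List A) → length (combs l xs) ≡ bin (length xs) l
length-combs zero [] = refl
length-combs zero (x ∷ xs) = refl
length-combs (suc l) [] = refl
length-combs (suc l) (x ∷ xs) = trans (length-++ (map (x ∷_) (combs l xs))) (cong₂ _+_ (trans (length-map (x ∷_) (combs l xs)) (length-combs l xs)) (length-combs (suc l) xs))

∑-combs≤ : ∀ l (xs : List A) φ c → (∀ f → φ f ≤ c) → ∑ (combs l xs) φ ≤ c * bin (length xs) l
∑-combs≤ l xs φ c h = ≤-trans (∑-bound-∈ (combs l xs) c (λ f _ → h f)) (≤-reflexive (trans (cong (_* c) (length-combs l xs)) (*-comm _ c)))

combs-split : ∀ p (xs : List A) {ys} → ys ∈ combs p xs → Σ (List A) λ zs → (xs ↭ ys ++ zs) × length ys ≡ p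
combs-split zero xs (here refl) = xs , ↭-refl , refl
combs-split (suc p) (x ∷ xs) m with ∈-++⁻ (map (x ∷_) (combs p xs)) m
... | inj₁ m' with ∈-map⁻ (x ∷_) m'
...   | ys , ys∈ , refl with combs-split p xs ys∈
...     | zs , pm , e = zs , prep x pm , cong suc e
combs-split (suc p) (x ∷ xs) m | inj₂ m' with combs-split (suc p) xs m'
... | zs , pm , e = x ∷ zs , ↭-trans (prep x pm) (↭-sym (PermP.shift x _ zs)) , e

∑-combs-↭ : ∀ l {xs ys : List A} (φ : List A → ℕ) → (∀ {f g} → f ↭ g → φ f ≡ φ g) → xs ↭ ys → ∑ (combs l xs) φ ≡ ∑ (combs l ys) φ
∑-combs-↭ zero φ inv p = refl
∑-combs-↭ (suc l) φ inv Perm.refl = refl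
∑-combs-↭ (suc l) {x ∷ xs} {_ ∷ ys} φ inv (prep _ p) = trans (∑-combs l x xs φ) (trans
  (cong₂ _+_ (∑-combs-↭ l (φ ∘ (x ∷_)) (λ q → inv (prep x q)) p) (∑-combs-↭ (suc l) φ inv p)) (sym (∑-combs l x ys φ)))
∑-combs-↭ (suc l) φ inv (Perm.trans p q) = trans (∑-combs-↭ (suc l) φ inv p) (∑-combs-↭ (suc l) φ inv q)
∑-combs-↭ (suc l) {x ∷ y ∷ xs} {_ ∷ _ ∷ ys} φ inv (swap _ _ p) = begin
  ∑ (combs (suc l) (x ∷ y ∷ xs)) φ ≡⟨ expand x y xs ⟩
  ∑ (combs l (y ∷ xs)) (φ ∘ (x ∷_)) + (∑ (combs l xs) (φ ∘ (y ∷_)) + ∑ (combs (suc l) xs) φ) ≡⟨ exchange l ⟩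
  ∑ (combs l (x ∷ xs)) (φ ∘ (y ∷_)) + (∑ (combs l xs) (φ ∘ (x ∷_)) + ∑ (combs (suc l) xs) φ)
    ≡⟨ cong₂ _+_ (∑-combs-↭ l (φ ∘ (y ∷_)) (λ q → inv (prep y q)) (prep x p)) (cong₂ _+_ (∑-combs-↭ l (φ ∘ (x ∷_)) (λ q → inv (prep x q)) p) (∑-combs-↭ (suc l) φ inv p)) ⟩
  ∑ (combs l (x ∷ ys)) (φ ∘ (y ∷_)) + (∑ (combs l ys) (φ ∘ (x ∷_)) + ∑ (combs (suc l) ys) φ) ≡⟨ expand y x ys ⟨
  ∑ (combs (suc l) (y ∷ x ∷ ys)) φ ∎
  where
  open ≡-Reasoning
  expand : ∀ x y xs → ∑ (combs (suc l) (x ∷ y ∷ xs)) φ ≡ ∑ (combs l (y ∷ xs)) (φ ∘ (x ∷_)) + (∑ (combs l xs) (φ ∘ (y ∷_)) + ∑ (combs (suc l) xs) φ)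
  expand x y xs = trans (∑-combs l x (y ∷ xs) φ) (cong (∑ (combs l (y ∷ xs)) (φ ∘ (x ∷_)) +_) (∑-combs l y xs φ))
  exchange : ∀ l → ∑ (combs l (y ∷ xs)) (φ ∘ (x ∷_)) + (∑ (combs l xs) (φ ∘ (y ∷_)) + ∑ (combs (suc l) xs) φ)
      ≡ ∑ (combs l (x ∷ xs)) (φ ∘ (y ∷_)) + (∑ (combs l xs) (φ ∘ (x ∷_)) + ∑ (combs (suc l) xs) φ)
  exchange zero = lem (φ (x ∷ [])) (φ (y ∷ [])) (∑ (combs 1 xs) φ)
    where
    lem : ∀ a b c → a + 0 + (b + 0 + c) ≡ b + 0 + (a + 0 + c)
    lem = solve-∀
  exchange (suc l) = trans (cong (_+ (∑ (combs (suc l) xs) (φ ∘ (y ∷_)) + rest)) (∑-combs l y xs (φ ∘ (x ∷_))))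
    (trans (cong (λ a → a + ∑ (combs (suc l) xs) (φ ∘ (x ∷_)) + (∑ (combs (suc l) xs) (φ ∘ (y ∷_)) + rest)) (∑-cong (combs l xs) (λ f → inv (swap x y ↭-refl))))
    (trans (lem (∑ (combs l xs) (λ f → φ (y ∷ x ∷ f))) (∑ (combs (suc l) xs) (φ ∘ (x ∷_))) (∑ (combs (suc l) xs) (φ ∘ (y ∷_))) rest)
      (cong (_+ (∑ (combs (suc l) xs) (φ ∘ (x ∷_)) + rest)) (sym (∑-combs l x xs (φ ∘ (y ∷_)))))))
    where
    rest = ∑ (combs (suc (suc l)) xs) φ
    lem : ∀ a b c d → a + b + (c + d) ≡ a + c + (b + d)
    lem = solve-∀

combs-front-≤ : ∀ l (ys xs : List A) φ c → (∀ f → φ f ≤ c) →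
  ∑ (combs (suc l) (ys ++ xs)) φ ≤ ∑ (combs (suc l) xs) φ + c * (length ys * bin (length (ys ++ xs)) l)
combs-front-≤ l [] xs φ c h = m≤m+n _ _
combs-front-≤ l (y ∷ ys) xs φ c h = begin
  ∑ (combs (suc l) (y ∷ ys ++ xs)) φ ≡⟨ ∑-combs l y (ys ++ xs) φ ⟩
  ∑ (combs l (ys ++ xs)) (φ ∘ (y ∷_)) + ∑ (combs (suc l) (ys ++ xs)) φ
    ≤⟨ +-mono-≤ (≤-trans (∑-combs≤ l (ys ++ xs) _ c (h ∘ (y ∷_))) (*-monoʳ-≤ c grow))
         (≤-trans (combs-front-≤ l ys xs φ c h) (+-monoʳ-≤ (∑ (combs (suc l) xs) φ) (*-monoʳ-≤ c (*-monoʳ-≤ (length ys) grow)))) ⟩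
  c * B' + (∑ (combs (suc l) xs) φ + c * (length ys * B')) ≡⟨ lem c B' (∑ (combs (suc l) xs) φ) (length ys) ⟩
  ∑ (combs (suc l) xs) φ + c * (suc (length ys) * B') ∎
  where
  open ≤-Reasoning
  B' = bin (suc (length (ys ++ xs))) l
  grow : bin (length (ys ++ xs)) l ≤ B'
  grow = bin-mono l (n≤1+n _)
  lem : ∀ c b s y → c * b + (s + c * (y * b)) ≡ s + c * (suc y * b)
  lem = solve-∀

-- At most one is lost for each `l`-subset that meets `ys`. The exact number of these subsets is
-- needed, for it is the price of deleting the heavy vertices and has to match the change in the
-- degree condition.
combs-front-exact : ∀ l (ys xs : List A) φ → (∀ f → φ f ≤ 1) →
  ∑ (combs l (ys ++ xs)) φ + bin (length xs) l ≤ ∑ (combs l xs) φ + bin (length (ys ++ xs)) l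
combs-front-exact l [] xs φ h = ≤-refl
combs-front-exact zero (y ∷ ys) xs φ h = ≤-refl
combs-front-exact (suc l) (y ∷ ys) xs φ h = begin
  ∑ (combs (suc l) (y ∷ ys ++ xs)) φ + bin (length xs) (suc l) ≡⟨ cong (_+ bin (length xs) (suc l)) (∑-combs l y (ys ++ xs) φ) ⟩
  ∑ (combs l (ys ++ xs)) (φ ∘ (y ∷_)) + ∑ (combs (suc l) (ys ++ xs)) φ + bin (length xs) (suc l) ≡⟨ +-assoc (∑ (combs l (ys ++ xs)) (φ ∘ (y ∷_))) _ _ ⟩
  ∑ (combs l (ys ++ xs)) (φ ∘ (y ∷_)) + (∑ (combs (suc l) (ys ++ xs)) φ + bin (length xs) (suc l))
    ≤⟨ +-mono-≤ (≤-trans (∑-combs≤ l (ys ++ xs) _ 1 (h ∘ (y ∷_))) (≤-reflexive (*-identityˡ _))) (combs-front-exact (suc l) ys xs φ h) ⟩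
  bin (length (ys ++ xs)) l + (∑ (combs (suc l) xs) φ + bin (length (ys ++ xs)) (suc l)) ≡⟨ lem (bin (length (ys ++ xs)) l) (∑ (combs (suc l) xs) φ) (bin (length (ys ++ xs)) (suc l)) ⟩
  ∑ (combs (suc l) xs) φ + (bin (length (ys ++ xs)) l + bin (length (ys ++ xs)) (suc l)) ∎
  where
  open ≤-Reasoning
  lem : ∀ a b c → a + (b + c) ≡ b + (a + c)
  lem = solve-∀

-- Sampling

bump : List A → ℕ → ℕ
bump [] i = i
bump (_ ∷ _) i = suc i

-- The sum over all sublists f of the concatenation, with the number i of blocks that f meets.
∑ᵇ : List (List A) → (ℕ → List A → ℕ) → ℕ
∑ᵇ [] φ = φ 0 []
∑ᵇ (e ∷ bl) φ = ∑ (subs e) (λ f₀ → ∑ᵇ bl (λ i f → φ (bump f₀ i) (f₀ ++ f)))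

∑ᵇ-mono : ∀ (bl : List (List A)) {φ ψ} → (∀ i f → i ≤ length bl → i ≤ length f → φ i f ≤ ψ i f) → ∑ᵇ bl φ ≤ ∑ᵇ bl ψ
∑ᵇ-mono [] h = h 0 [] z≤n z≤n
∑ᵇ-mono (e ∷ bl) h = ∑-mono (subs e) (λ f₀ → ∑ᵇ-mono bl (λ i f i≤ i≤f → h _ _ (≤-trans (bump≤ f₀ i) (s≤s i≤)) (bump-length f₀ i f i≤f)))
  where
  bump≤ : ∀ f₀ i → bump {A = _} f₀ i ≤ suc i
  bump≤ [] i = n≤1+n i
  bump≤ (_ ∷ _) i = ≤-refl
  bump-length : ∀ (f₀ : List _) i f → i ≤ length f → bump f₀ i ≤ length (f₀ ++ f)
  bump-length [] i f p = p
  bump-length (x ∷ f₀) i f p = s≤s (≤-trans p (≤-trans (m≤n+m (length f) (length f₀)) (≤-reflexive (sym (length-++ f₀)))))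

∑ᵇ-+ : ∀ (bl : List (List A)) φ ψ → ∑ᵇ bl (λ i f → φ i f + ψ i f) ≡ ∑ᵇ bl φ + ∑ᵇ bl ψ
∑ᵇ-+ [] φ ψ = refl
∑ᵇ-+ (e ∷ bl) φ ψ = trans (∑-cong (subs e) (λ f₀ → ∑ᵇ-+ bl (λ i f → φ (bump f₀ i) (f₀ ++ f)) (λ i f → ψ (bump f₀ i) (f₀ ++ f))))
  (∑-+ (subs e) (λ f₀ → ∑ᵇ bl (λ i f → φ (bump f₀ i) (f₀ ++ f))) (λ f₀ → ∑ᵇ bl (λ i f → ψ (bump f₀ i) (f₀ ++ f))))

∑ᵇ-*ˡ : ∀ c (bl : List (List A)) φ → ∑ᵇ bl (λ i f → c * φ i f) ≡ c * ∑ᵇ bl φ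
∑ᵇ-*ˡ c [] φ = refl
∑ᵇ-*ˡ c (e ∷ bl) φ = trans (∑-cong (subs e) (λ f₀ → ∑ᵇ-*ˡ c bl _)) (∑-*ˡ c (subs e) _)

∑ᵇ-concat : ∀ (bl : List (List A)) ψ → ∑ᵇ bl (λ i f → ψ f) ≡ ∑ (subs (concat bl)) ψ
∑ᵇ-concat [] ψ = sym (+-identityʳ _)
∑ᵇ-concat (e ∷ bl) ψ = trans (∑-cong (subs e) (λ f₀ → ∑ᵇ-concat bl (ψ ∘ (f₀ ++_)))) (sym (∑-subs-++ e (concat bl) ψ))

-- The number of p-subsets of a y-set that contain i given elements (for i ≤ y).
containing : ℕ → ℕ → ℕ → ℕ
containing y p zero = bin y p
containing zero p (suc i) = 0
containing (suc y) zero (suc i) = 0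
containing (suc y) (suc p) (suc i) = containing y p i

containing-pascal : ∀ y p i → i ≤ y → containing (suc y) (suc p) i ≡ containing y p i + containing y (suc p) i
containing-pascal y p zero _ = refl
containing-pascal (suc y) zero (suc zero) (s≤s i≤y) = refl
containing-pascal (suc (suc y)) zero (suc (suc i)) (s≤s i≤y) = refl
containing-pascal (suc y) (suc p) (suc i) (s≤s i≤y) = containing-pascal y p i i≤y

nonempties-shape : ∀ (xs : List A) {f} → f ∈ nonempties xs → Σ A λ x → Σ (List A) λ g → f ≡ x ∷ g
nonempties-shape (x ∷ xs) m with ∈-++⁻ (map (x ∷_) (subs xs)) m
... | inj₂ m' = nonempties-shape xs m'
... | inj₁ m' with ∈-map⁻ (x ∷_) m'
...   | g , _ , e = x , g , e

-- A sublist that meets `i` blocks is covered by the samples that include these blocks. The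
-- induction distinguishes, as Pascal's rule does, whether the first block is drawn; a block that
-- the sublist meets must be drawn.
∑-samples : ∀ p (bl : List (List A)) ψ →
  ∑ᵇ bl (λ i f → containing (length bl) p i * ψ f) ≤ ∑ (combs p bl) (λ bs → ∑ (subs (concat bs)) ψ)
∑-samples zero bl ψ = ≤-trans (go bl (λ f → f) ) (≤-reflexive (sym (trans (+-identityʳ _) (+-identityʳ _))))
  where
  go : ∀ bl (h : List _ → List _) → ∑ᵇ bl (λ i f → containing (length bl) 0 i * ψ (h f)) ≤ ψ (h [])
  go [] h = ≤-reflexive (*-identityˡ _)
  go (e ∷ bl) h = begin
    ∑ᵇ bl (λ i f → containing (suc (length bl)) 0 i * ψ (h f)) + ∑ (nonempties e) (λ f₀ → ∑ᵇ bl (λ i f → containing (suc (length bl)) 0 (bump f₀ i) * ψ (h (f₀ ++ f))))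
      ≤⟨ +-mono-≤ (∑ᵇ-mono bl {ψ = λ i f → containing (length bl) 0 i * ψ (h f)} (λ i f i≤ _ → *-monoˡ-≤ (ψ (h f)) (fewer (length bl) i i≤)))
           (≤-reflexive (∑-zero-∈ (nonempties e) rest)) ⟩
    ∑ᵇ bl (λ i f → containing (length bl) 0 i * ψ (h f)) + 0 ≡⟨ +-identityʳ _ ⟩
    ∑ᵇ bl (λ i f → containing (length bl) 0 i * ψ (h f)) ≤⟨ go bl h ⟩
    ψ (h []) ∎
    where
    open ≤-Reasoning
    fewer : ∀ y i → i ≤ y → containing (suc y) 0 i ≤ containing y 0 i
    fewer y zero _ = ≤-refl
    fewer (suc y) (suc i) _ = z≤n
    rest : ∀ f₀ → f₀ ∈ nonempties e → ∑ᵇ bl (λ i f → containing (suc (length bl)) 0 (bump f₀ i) * ψ (h (f₀ ++ f))) ≡ 0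
    rest f₀ m with nonempties-shape e m
    ... | x , g , refl = ∑ᵇ-*ˡ 0 bl (λ i f → ψ (h (f₀ ++ f)))
∑-samples (suc p) [] ψ = z≤n
∑-samples (suc p) (e ∷ bl) ψ = begin
  ∑ᵇ bl (λ i f → ct (suc y) (suc p) i * ψ f) + ∑ (nonempties e) (λ f₀ → ∑ᵇ bl (λ i f → ct (suc y) (suc p) (bump f₀ i) * ψ (f₀ ++ f)))
    ≤⟨ +-mono-≤ (≤-trans (∑ᵇ-mono bl (λ i f i≤ _ → ≤-reflexive (trans (cong (_* ψ f) (containing-pascal y p i i≤)) (*-distribʳ-+ (ψ f) (ct y p i) (ct y (suc p) i)))))
           (≤-reflexive (∑ᵇ-+ bl (λ i f → ct y p i * ψ f) (λ i f → ct y (suc p) i * ψ f))))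
         (≤-reflexive (∑-cong-∈ (nonempties e) same)) ⟩
  (∑ᵇ bl (λ i f → ct y p i * ψ f) + ∑ᵇ bl (λ i f → ct y (suc p) i * ψ f)) + ∑ (nonempties e) (λ f₀ → ∑ᵇ bl (λ i f → ct y p i * ψ (f₀ ++ f)))
    ≡⟨ lem (∑ᵇ bl (λ i f → ct y p i * ψ f)) _ _ ⟩
  ∑ (subs e) (λ f₀ → ∑ᵇ bl (λ i f → ct y p i * ψ (f₀ ++ f))) + ∑ᵇ bl (λ i f → ct y (suc p) i * ψ f)
    ≤⟨ +-mono-≤ (∑-mono (subs e) (λ f₀ → ∑-samples p bl (λ f → ψ (f₀ ++ f)))) (∑-samples (suc p) bl ψ) ⟩
  ∑ (subs e) (λ f₀ → ∑ (combs p bl) (λ bs → ∑ (subs (concat bs)) (λ f → ψ (f₀ ++ f)))) + ∑ (combs (suc p) bl) (λ bs → ∑ (subs (concat bs)) ψ)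
    ≡⟨ cong (_+ ∑ (combs (suc p) bl) (λ bs → ∑ (subs (concat bs)) ψ)) (trans (∑-swap (subs e) (combs p bl) _) (∑-cong (combs p bl) (λ bs → sym (∑-subs-++ e (concat bs) ψ)))) ⟩
  ∑ (combs p bl) (λ bs → ∑ (subs (e ++ concat bs)) ψ) + ∑ (combs (suc p) bl) (λ bs → ∑ (subs (concat bs)) ψ)
    ≡⟨ ∑-combs p e bl (λ bs → ∑ (subs (concat bs)) ψ) ⟨
  ∑ (combs (suc p) (e ∷ bl)) (λ bs → ∑ (subs (concat bs)) ψ) ∎
  where
  open ≤-Reasoning
  ct = containing
  y = length bl
  lem : ∀ a b c → (a + b) + c ≡ (a + c) + b
  lem = solve-∀
  same : ∀ f₀ → f₀ ∈ nonempties e → ∑ᵇ bl (λ i f → ct (suc y) (suc p) (bump f₀ i) * ψ (f₀ ++ f)) ≡ ∑ᵇ bl (λ i f → ct y p i * ψ (f₀ ++ f))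
  same f₀ m with nonempties-shape e m
  ... | x , g , refl = refl

bin-absorb : ∀ n k → suc k * bin (suc n) (suc k) ≡ suc n * bin n k
bin-absorb zero zero = refl
bin-absorb zero (suc k) = *-zeroʳ (suc (suc k))
bin-absorb (suc n) zero = trans (cong (λ x → 1 * (1 + (1 + x))) (bin-1 n)) (lem n)
  where
  lem : ∀ n → 1 * (1 + (1 + n)) ≡ suc (suc n) * 1
  lem = solve-∀
bin-absorb (suc n) (suc k) = begin
  (2 + k) * (x + bin (suc n) (2 + k)) ≡⟨ *-distribˡ-+ (2 + k) x (bin (suc n) (2 + k)) ⟩
  (2 + k) * x + (2 + k) * bin (suc n) (2 + k) ≡⟨ cong ((2 + k) * x +_) (bin-absorb n (suc k)) ⟩
  (2 + k) * x + suc n * bin n (suc k) ≡⟨ lem₁ k x (suc n * bin n (suc k)) ⟩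
  x + (suc k * x + suc n * bin n (suc k)) ≡⟨ cong (λ w → x + (w + suc n * bin n (suc k))) (bin-absorb n k) ⟩
  x + (suc n * bin n k + suc n * bin n (suc k)) ≡⟨ cong (x +_) (*-distribˡ-+ (suc n) (bin n k) (bin n (suc k))) ⟨
  suc (suc n) * x ∎
  where
  open ≡-Reasoning
  x = bin (suc n) (suc k)
  lem₁ : ∀ k x w → (2 + k) * x + w ≡ x + (suc k * x + w)
  lem₁ = solve-∀

-- Drawing p of y elements hits a given set of at most l elements with at least the frequency of independent draws of rate τ / b.
Dense : (τ b l y p : ℕ) → Set
Dense τ b l y p = ∀ j → j < l → τ * (y ∸ j) ≤ b * (p ∸ j)

-- The frequency of samples that contain `i` given blocks is the product of `(p - j) / (y - j)` over
-- `j < i`, and `Dense` bounds each factor below by `τ / b`.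
containing-bound : ∀ τ b l y p → Dense τ b l y p → ∀ i → i ≤ l → i ≤ y → bin y p * τ ^ i ≤ b ^ i * containing y p i
containing-bound τ b l y p d zero _ _ = ≤-reflexive (*-comm (bin y p) 1)
containing-bound τ b (suc l) (suc y) zero d (suc i) (s≤s i≤l) (s≤s i≤y) with τ | ≤-trans (d 0 z<s) (≤-reflexive (*-zeroʳ b))
... | zero | _ = z≤n
containing-bound τ b (suc l) (suc y) (suc p) d (suc i) (s≤s i≤l) (s≤s i≤y) = begin
  bin (suc y) (suc p) * (τ * τ ^ i) ≡⟨ *-assoc (bin (suc y) (suc p)) τ (τ ^ i) ⟨
  bin (suc y) (suc p) * τ * τ ^ i ≤⟨ *-monoˡ-≤ (τ ^ i) first ⟩
  b * bin y p * τ ^ i ≡⟨ *-assoc b (bin y p) (τ ^ i) ⟩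
  b * (bin y p * τ ^ i) ≤⟨ *-monoʳ-≤ b (containing-bound τ b l y p (λ j j<l → d (suc j) (s<s j<l)) i i≤l i≤y) ⟩
  b * (b ^ i * containing y p i) ≡⟨ *-assoc b (b ^ i) _ ⟨
  b ^ suc i * containing y p i ∎
  where
  open ≤-Reasoning
  first : bin (suc y) (suc p) * τ ≤ b * bin y p
  first = *-cancelˡ-≤ (suc p) (begin
    suc p * (bin (suc y) (suc p) * τ) ≡⟨ *-assoc (suc p) (bin (suc y) (suc p)) τ ⟨
    suc p * bin (suc y) (suc p) * τ ≡⟨ cong (_* τ) (bin-absorb y p) ⟩
    suc y * bin y p * τ ≡⟨ lem (suc y) (bin y p) τ ⟩
    τ * suc y * bin y p ≤⟨ *-monoˡ-≤ (bin y p) (d 0 z<s) ⟩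
    b * suc p * bin y p ≡⟨ lem' b (suc p) (bin y p) ⟩
    suc p * (b * bin y p) ∎)
    where
    lem : ∀ y x t → y * x * t ≡ t * y * x
    lem = solve-∀
    lem' : ∀ y x t → y * x * t ≡ x * (y * t)
    lem' = solve-∀

-- A set `f` that meets `i` blocks survives with frequency at least `(τ / b) ^ i`. As `i ≤ length f`
-- and `τ ≤ b`, this is at least `(τ / b) ^ length f`: elements in a common block only help.
sampling : ∀ τ b l p (bl : List (List A)) (ψ : List A → ℕ) → Dense τ b l (length bl) p → τ ≤ b → (∀ f → l < length f → ψ f ≡ 0) →
  bin (length bl) p * ∑ (subs (concat bl)) (λ f → τ ^ length f * ψ f) ≤ ∑ (combs p bl) (λ bs → ∑ (subs (concat bs)) (λ f → b ^ length f * ψ f))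
sampling τ b l p bl ψ d τ≤b small = begin
  bin y p * ∑ (subs (concat bl)) (λ f → τ ^ length f * ψ f) ≡⟨ cong (bin y p *_) (∑ᵇ-concat bl _) ⟨
  bin y p * ∑ᵇ bl (λ _ f → τ ^ length f * ψ f) ≡⟨ ∑ᵇ-*ˡ (bin y p) bl _ ⟨
  ∑ᵇ bl (λ _ f → bin y p * (τ ^ length f * ψ f)) ≤⟨ ∑ᵇ-mono bl pt ⟩
  ∑ᵇ bl (λ i f → containing y p i * (b ^ length f * ψ f)) ≤⟨ ∑-samples p bl (λ f → b ^ length f * ψ f) ⟩
  ∑ (combs p bl) (λ bs → ∑ (subs (concat bs)) (λ f → b ^ length f * ψ f)) ∎
  where
  open ≤-Reasoning
  y = length bl
  pt : ∀ i f → i ≤ y → i ≤ length f → bin y p * (τ ^ length f * ψ f) ≤ containing y p i * (b ^ length f * ψ f)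
  pt i f i≤y i≤f with length f ≤? l
  ... | no big = ≤-reflexive (trans (cong (λ x → bin y p * (τ ^ length f * x)) z) (trans (lem (bin y p) (τ ^ length f)) (sym (trans (cong (λ x → containing y p i * (b ^ length f * x)) z) (lem (containing y p i) (b ^ length f))))))
    where
    z = small f (≰⇒> big)
    lem : ∀ a b → a * (b * 0) ≡ 0
    lem = solve-∀
  ... | yes f≤l = begin
    bin y p * (τ ^ length f * ψ f) ≡⟨ cong (λ x → bin y p * (x * ψ f)) (trans (cong (τ ^_) (sym (m+[n∸m]≡n i≤f))) (^-distribˡ-+-* τ i k)) ⟩
    bin y p * (τ ^ i * τ ^ k * ψ f) ≡⟨ lem (bin y p) (τ ^ i) (τ ^ k) (ψ f) ⟩
    bin y p * τ ^ i * (τ ^ k * ψ f) ≤⟨ *-mono-≤ (containing-bound τ b l y p d i (≤-trans i≤f f≤l) i≤y) (*-monoˡ-≤ (ψ f) (^-monoˡ-≤ k τ≤b)) ⟩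
    b ^ i * containing y p i * (b ^ k * ψ f) ≡⟨ lem' (b ^ i) (containing y p i) (b ^ k) (ψ f) ⟩
    containing y p i * (b ^ i * b ^ k * ψ f) ≡⟨ cong (λ x → containing y p i * (x * ψ f)) (trans (sym (^-distribˡ-+-* b i k)) (cong (b ^_) (m+[n∸m]≡n i≤f))) ⟩
    containing y p i * (b ^ length f * ψ f) ∎
    where
    k = length f ∸ i
    lem : ∀ a b c d → a * (b * c * d) ≡ a * b * (c * d)
    lem = solve-∀
    lem' : ∀ a b c d → a * b * (c * d) ≡ b * (a * c * d)
    lem' = solve-∀

-- Frankl's bound for sublists of a list

mask : (xs : List A) → Vec Bool (length xs) → List A
mask [] [] = []
mask (x ∷ xs) (true ∷ v) = x ∷ mask xs v
mask (x ∷ xs) (false ∷ v) = mask xs v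

length-mask : (xs : List A) (v : Vec Bool (length xs)) → length (mask xs v) ≡ card v
length-mask [] [] = refl
length-mask (x ∷ xs) (true ∷ v) = cong suc (length-mask xs v)
length-mask (x ∷ xs) (false ∷ v) = length-mask xs v

mask-⊆ : (xs : List A) (v : Vec Bool (length xs)) {y : A} → y ∈ mask xs v → y ∈ xs
mask-⊆ [] [] ()
mask-⊆ (x ∷ xs) (true ∷ v) (here e) = here e
mask-⊆ (x ∷ xs) (true ∷ v) (there p) = there (mask-⊆ xs v p)
mask-⊆ (x ∷ xs) (false ∷ v) p = there (mask-⊆ xs v p)

mask-disjoint : {xs : List A} → Unique xs → (c : Colouring m (length xs)) → ∀ {i j} → i ≢ j → Disjoint (mask xs (class i c)) (mask xs (class j c))
mask-disjoint [] [] i≢j (() , _)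
mask-disjoint (x∉ ∷ u) (nothing ∷ c) i≢j pq = mask-disjoint u c i≢j pq
mask-disjoint {m = m} {x ∷ xs} (x∉ ∷ u) (just a ∷ c) {i} {j} i≢j (p , q) with i FinP.≟ a | j FinP.≟ a
... | yes refl | yes refl = i≢j refl
... | no _ | no _ = mask-disjoint u c i≢j (p , q)
... | yes _ | no _ with p
...   | here refl = All.lookup x∉ (mask-⊆ xs _ q) refl
...   | there p' = mask-disjoint u c i≢j (p' , q)
mask-disjoint {m = m} {x ∷ xs} (x∉ ∷ u) (just a ∷ c) {i} {j} i≢j (p , q) | no _ | yes _ with q
...   | here refl = All.lookup x∉ (mask-⊆ xs _ p) refl
...   | there q' = mask-disjoint u c i≢j (p , q')

-- The first list becomes an initial segment of the ground set, so the number of elements taken from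
-- it becomes `prefix`.
∑-mask : ∀ (xs ys : List A) (ψ : ℕ → List A → ℕ) →
  ∑ (subs xs) (λ f → ∑ (subs ys) (λ g → ψ (length f) (f ++ g))) ≡ ∑ (vecs (length (xs ++ ys))) (λ v → ψ (prefix (length xs) v) (mask (xs ++ ys) v))
∑-mask [] ys ψ = trans (+-identityʳ _) (go ys (ψ 0))
  where
  go : ∀ ys φ → ∑ (subs ys) φ ≡ ∑ (vecs (length ys)) (φ ∘ mask ys)
  go [] φ = refl
  go (y ∷ ys) φ = trans (∑-subs y ys φ) (trans (cong₂ _+_ (go ys φ) (go ys (φ ∘ (y ∷_)))) (sym (∑-vecs (length ys) (φ ∘ mask (y ∷ ys)))))
∑-mask (x ∷ xs) ys ψ = trans (∑-subs x xs (λ f → ∑ (subs ys) (λ g → ψ (length f) (f ++ g))))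
  (trans (cong₂ _+_ (∑-mask xs ys ψ) (∑-mask xs ys (λ h f → ψ (suc h) (x ∷ f)))) (sym (∑-vecs (length (xs ++ ys)) _)))

-- The argument h is the number of elements of f in the first stratum.
Selected : ℕ → (List A → Bool) → ℕ → List A → Bool
Selected r χ h f = ((length f == suc r) ∧ (h <ᵇ r)) ∧ χ f

frankl-at : ∀ {n y t r} p z (F : Fam n) → n ≡ y + suc t → Uniform (suc r) F → NoMatching F t → p ≤ y → (∀ v → F v ≡ true → prefix p v < r) → r * (2 * t + 1 + z) ≤ y →
  (t + 1 + z) * size F + (t + 1 + z) * bin (suc y) (suc r) + z * (t * bin p r) ≤ (t + 1 + z) * bin (y + suc t) (suc r)
frankl-at p z F refl = frankl p z F

NoFamily : (List A → Bool) → ℕ → ℕ → List A → Set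
NoFamily {A} χ r t xs = (f : Fin (suc t) → List A) → (∀ i → χ (f i) ≡ true) → (∀ i → length (f i) ≡ suc r) →
  (∀ i j → i ≢ j → Disjoint (f i) (f j)) → (∀ i {x} → x ∈ f i → x ∈ xs) → ⊥

frankl-list : ∀ (χ : List A → Bool) (xs ys : List A) r t z y → Unique (xs ++ ys) → length (xs ++ ys) ≡ y + suc t → length xs ≤ y → r * (2 * t + 1 + z) ≤ y →
  NoFamily χ r t (xs ++ ys) →
  (t + 1 + z) * ∑ (subs xs) (λ f → ∑ (subs ys) (λ g → bit (Selected r χ (length f) (f ++ g)))) + (t + 1 + z) * bin (suc y) (suc r) + z * (t * bin (length xs) r)
    ≤ (t + 1 + z) * bin (y + suc t) (suc r)
frankl-list {A} χ xs ys r t z y uniq len xs≤ big nm = subst (λ s → (t + 1 + z) * s + (t + 1 + z) * bin (suc y) (suc r) + z * (t * bin (length xs) r) ≤ (t + 1 + z) * bin (y + suc t) (suc r))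
    (sym (∑-mask xs ys (λ h f → bit (Selected r χ h f))))
    (frankl-at (length xs) z F len (λ v e → trans (sym (length-mask zs v)) (proj₁ (parts v e))) no-matching xs≤ (λ v e → proj₁ (proj₂ (parts v e))) big)
  where
  zs = xs ++ ys
  F : Fam (length zs)
  F v = Selected r χ (prefix (length xs) v) (mask zs v)
  parts : ∀ v → F v ≡ true → (length (mask zs v) ≡ suc r) × (prefix (length xs) v < r) × (χ (mask zs v) ≡ true)
  parts v e with ∧-true _ (χ (mask zs v)) e
  ... | e₁ , e₂ with ∧-true (length (mask zs v) == suc r) _ e₁
  ...   | e₃ , e₄ = ==-true _ _ e₃ , <ᵇ⇒< _ _ (subst Bool.T (sym e₄) _) , e₂
  no-matching : NoMatching F t
  no-matching c h = nm (λ i → mask zs (class i c)) (λ i → proj₂ (proj₂ (parts _ (h i)))) (λ i → proj₁ (parts _ (h i)))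
    (λ i j i≢j → mask-disjoint uniq c i≢j) (λ i → mask-⊆ zs (class i c))

∑-pigeonhole : ∀ (xs : List A) φ c → 0 < length xs → length xs * c ≤ ∑ xs φ → Σ A λ x → x ∈ xs × c ≤ φ x
∑-pigeonhole (x ∷ xs) φ c _ h with c ≤? φ x
... | yes p = x , here refl , p
... | no ¬p with xs
...   | [] = ⊥-elim (¬p (≤-trans (m≤m+n c 0) (≤-trans h (≤-reflexive (+-identityʳ _)))))
...   | x' ∷ xs' with ∑-pigeonhole (x' ∷ xs') φ c z<s (+-cancelˡ-≤ (φ x) _ _ (≤-trans (+-monoˡ-≤ _ (<⇒≤ (≰⇒> ¬p))) h))
...     | y , y∈ , p = y , there y∈ , p

pick-sample : ∀ τ b l p (bl : List (List A)) (ψ : List A → ℕ) → Dense τ b l (length bl) p → p ≤ length bl → τ ≤ b → (∀ f → l < length f → ψ f ≡ 0) →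
  Σ (List (List A)) λ bs → bs ∈ combs p bl × ∑ (subs (concat bl)) (λ f → τ ^ length f * ψ f) ≤ ∑ (subs (concat bs)) (λ f → b ^ length f * ψ f)
pick-sample τ b l p bl ψ d p≤ τ≤b small = ∑-pigeonhole (combs p bl) _ _ (subst (0 <_) (sym (length-combs p bl)) (bin-self-pos p≤))
  (≤-trans (≤-reflexive (cong (_* ∑ (subs (concat bl)) (λ f → τ ^ length f * ψ f)) (length-combs p bl))) (sampling τ b l p bl ψ d τ≤b small))

-- Triple sums over three strata, each with its own weight

-- The strata are sampled one after another. An element weighs `τ` in a stratum still to be sampled
-- and `b` in a sampled one, hence the three separate weights.
∑³ : (xs ys zs : List A) (u v w : ℕ) (ψ : List A → List A → List A → ℕ) → ℕ
∑³ xs ys zs u v w ψ = ∑ (subs xs) (λ f → ∑ (subs ys) (λ g → ∑ (subs zs) (λ h → u ^ length f * (v ^ length g * (w ^ length h * ψ f g h)))))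

∑³-rotate : ∀ (xs ys zs : List A) u v w ψ → ∑³ xs ys zs u v w ψ ≡ ∑³ ys zs xs v w u (λ g h f → ψ f g h)
∑³-rotate xs ys zs u v w ψ = trans (∑-swap (subs xs) (subs ys) _) (∑-cong (subs ys) (λ g → trans (∑-swap (subs xs) (subs zs) _)
  (∑-cong (subs zs) (λ h → ∑-cong (subs xs) (λ f → lem (u ^ length f) (v ^ length g) (w ^ length h) (ψ f g h))))))
  where
  lem : ∀ a b c d → a * (b * (c * d)) ≡ b * (c * (a * d))
  lem = solve-∀

∑³-sample : ∀ τ b l p (bl : List (List A)) (ys zs : List A) v w ψ → Dense τ b l (length bl) p → p ≤ length bl → τ ≤ b → (∀ f g h → l < length f → ψ f g h ≡ 0) →
  Σ (List (List A)) λ bs → bs ∈ combs p bl × ∑³ (concat bl) ys zs τ v w ψ ≤ ∑³ (concat bs) ys zs b v w ψ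
∑³-sample {A} τ b l p bl ys zs v w ψ d p≤ τ≤b small with pick-sample τ b l p bl inner d p≤ τ≤b (λ f l<f → ∑-zero (subs ys) (λ g → ∑-zero (subs zs) (λ h →
    trans (cong (λ x → v ^ length g * (w ^ length h * x)) (small f g h l<f)) (lem (v ^ length g) (w ^ length h)))))
  where
  inner : List A → ℕ
  inner f = ∑ (subs ys) (λ g → ∑ (subs zs) (λ h → v ^ length g * (w ^ length h * ψ f g h)))
  lem : ∀ a b → a * (b * 0) ≡ 0
  lem = solve-∀
... | bs , bs∈ , le = bs , bs∈ , ≤-trans (≤-reflexive (factor τ (concat bl))) (≤-trans le (≤-reflexive (sym (factor b (concat bs)))))
  where
  factor : ∀ u xs → ∑³ xs ys zs u v w ψ ≡ ∑ (subs xs) (λ f → u ^ length f * ∑ (subs ys) (λ g → ∑ (subs zs) (λ h → v ^ length g * (w ^ length h * ψ f g h))))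
  factor u xs = ∑-cong (subs xs) (λ f → trans (∑-cong (subs ys) (λ g → ∑-*ˡ (u ^ length f) (subs zs) _)) (∑-*ˡ (u ^ length f) (subs ys) _))

∑³-uniform : ∀ (xs ys zs : List A) u l ψ → (∀ f g h → length f + (length g + length h) ≢ l → ψ f g h ≡ 0) →
  ∑³ xs ys zs u u u ψ ≡ u ^ l * ∑ (subs xs) (λ f → ∑ (subs ys) (λ g → ∑ (subs zs) (λ h → ψ f g h)))
∑³-uniform xs ys zs u l ψ sup = trans (∑-cong (subs xs) (λ f → trans (∑-cong (subs ys) (λ g → trans (∑-cong (subs zs) (λ h → pt f g h)) (∑-*ˡ (u ^ l) (subs zs) _)))
    (∑-*ˡ (u ^ l) (subs ys) _))) (∑-*ˡ (u ^ l) (subs xs) _)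
  where
  pt : ∀ f g h → u ^ length f * (u ^ length g * (u ^ length h * ψ f g h)) ≡ u ^ l * ψ f g h
  pt f g h with length f + (length g + length h) ≟ l
  ... | no ne rewrite sup f g h ne = lem (u ^ length f) (u ^ length g) (u ^ length h) (u ^ l)
    where
    lem : ∀ a b c d → a * (b * (c * 0)) ≡ d * 0
    lem = solve-∀
  ... | yes e = begin
    u ^ length f * (u ^ length g * (u ^ length h * ψ f g h)) ≡⟨ lem (u ^ length f) (u ^ length g) (u ^ length h) (ψ f g h) ⟩
    u ^ length f * (u ^ length g * u ^ length h) * ψ f g h ≡⟨ cong (λ x → u ^ length f * x * ψ f g h) (^-distribˡ-+-* u (length g) (length h)) ⟨
    u ^ length f * u ^ (length g + length h) * ψ f g h ≡⟨ cong (_* ψ f g h) (^-distribˡ-+-* u (length f) (length g + length h)) ⟨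
    u ^ (length f + (length g + length h)) * ψ f g h ≡⟨ cong (λ x → u ^ x * ψ f g h) e ⟩
    u ^ l * ψ f g h ∎
    where
    open ≡-Reasoning
    lem : ∀ a b c d → a * (b * (c * d)) ≡ a * (b * c) * d
    lem = solve-∀

concat-↭ : {xs ys : List (List A)} → xs ↭ ys → concat xs ↭ concat ys
concat-↭ Perm.refl = ↭-refl
concat-↭ (prep x p) = PermP.++⁺ˡ x (concat-↭ p)
concat-↭ (swap x y p) = ↭-trans (PermP.++⁺ˡ x (PermP.++⁺ˡ y (concat-↭ p))) (PermP.shifts x y)
concat-↭ (Perm.trans p q) = ↭-trans (concat-↭ p) (concat-↭ q)

concat-++-list : ∀ (xs ys : List (List A)) → concat (xs ++ ys) ≡ concat xs ++ concat ys
concat-++-list [] ys = refl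
concat-++-list (x ∷ xs) ys = trans (cong (x ++_) (concat-++-list xs ys)) (sym (++-assoc x _ _))

length-concat : ∀ k (bl : List (List A)) → (∀ e → e ∈ bl → length e ≡ k) → length (concat bl) ≡ k * length bl
length-concat k [] h = sym (*-zeroʳ k)
length-concat k (e ∷ bl) h = trans (length-++ e) (trans (cong₂ _+_ (h e (here refl)) (length-concat k bl (λ e' p → h e' (there p)))) (sym (*-suc k (length bl))))

interleave-↭ : ∀ (a a' b b' c c' : List A) → (a ++ a') ++ (b ++ b') ++ (c ++ c') ↭ (a ++ b ++ c) ++ (a' ++ b' ++ c')
interleave-↭ a a' b b' c c' = ↭-trans (PermP.++⁺ˡ (a ++ a') (step b b' c c')) (step a a' (b ++ c) (b' ++ c'))
  where
  step : ∀ (a a' b b' : List _) → (a ++ a') ++ (b ++ b') ↭ (a ++ b) ++ (a' ++ b')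
  step a a' b b' = ↭-trans (Perm.↭-reflexive (++-assoc a a' (b ++ b'))) (↭-trans (PermP.++⁺ˡ a (PermP.shifts a' b)) (Perm.↭-reflexive (sym (++-assoc a b (a' ++ b')))))

unique-↭ : {xs ys : List A} → xs ↭ ys → Unique xs → Unique ys
unique-↭ Perm.refl u = u
unique-↭ (prep x p) (x∉ ∷ u) = PermP.All-resp-↭ p x∉ ∷ unique-↭ p u
unique-↭ (swap x y p) ((x≢y ∷ x∉) ∷ y∉ ∷ u) = ((x≢y ∘ sym) ∷ PermP.All-resp-↭ p y∉) ∷ PermP.All-resp-↭ p x∉ ∷ unique-↭ p u
unique-↭ (Perm.trans p q) u = unique-↭ q (unique-↭ p u)

unique-++ˡ : (xs : List A) {ys : List A} → Unique (xs ++ ys) → Unique xs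
unique-++ˡ [] u = []
unique-++ˡ (x ∷ xs) (x∉ ∷ u) = AllP.++⁻ˡ xs x∉ ∷ unique-++ˡ xs u

-- Vertices as blocks of size one, so that single vertices and bad edges are drawn by the same
-- lemma.
singles : List A → List (List A)
singles = map (_∷ [])

∈-singles : (xs : List A) {e : List A} → e ∈ singles xs → length e ≡ 1
∈-singles xs m with ∈-map⁻ (_∷ []) m
... | _ , _ , refl = refl

selected³ : (χ : List A → Bool) → ℕ → List A → List A → List A → ℕ
selected³ χ r f g h = bit (Selected r χ (length f) (f ++ (g ++ h)))

∑-selected : (χ : List A → Bool) → ℕ → List A → List A → List A → ℕ
∑-selected χ r ws gs bs = ∑ (subs ws) (λ f → ∑ (subs gs) (λ g → ∑ (subs bs) (selected³ χ r f g)))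

selected³-off : ∀ (χ : List A → Bool) r f g h → length f + (length g + length h) ≢ suc r → selected³ χ r f g h ≡ 0
selected³-off χ r f g h ne with length (f ++ (g ++ h)) == suc r in eq
... | false = refl
... | true = ⊥-elim (ne (trans (sym (trans (length-++ f) (cong (length f +_) (length-++ g)))) (==-true _ _ eq)))

selected³-long : ∀ (χ : List A → Bool) r f g h → suc r < length f + (length g + length h) → selected³ χ r f g h ≡ 0
selected³-long χ r f g h l< = selected³-off χ r f g h (λ e → <-irrefl (sym e) l<)

module SampledBound {A : Set} (χ : List A → Bool) (ws gs : List A) (bl : List (List A)) (r k t z y τ b pW pG : ℕ)
  (uniq : Unique (ws ++ (gs ++ concat bl))) (sizes : ∀ e → e ∈ bl → length e ≡ k)
  (dW : Dense τ b (suc r) (length ws) pW) (dG : Dense τ b (suc r) (length gs) pG) (dB : Dense τ b (suc r) (length bl) t)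
  (pW≤ : pW ≤ length ws) (pG≤ : pG ≤ length gs) (t≤ : t ≤ length bl) (τ≤b : τ ≤ b)
  (total : pW + (pG + k * t) ≡ y + suc t) (pW≤y : pW ≤ y) (big : r * (2 * t + 1 + z) ≤ y)
  (nm : ∀ bs → bs ∈ combs t bl → NoFamily χ r t (ws ++ (gs ++ concat bs))) where

  W′ G′ : List (List A)
  W′ = singles ws
  G′ = singles gs
  W≡ : concat W′ ≡ ws
  W≡ = concat-map-[_] ws
  G≡ : concat G′ ≡ gs
  G≡ = concat-map-[_] gs
  lenW : length W′ ≡ length ws
  lenW = length-map (_∷ []) ws
  lenG : length G′ ≡ length gs
  lenG = length-map (_∷ []) gs

  module _ (XW XG XB : List (List A)) (XW∈ : XW ∈ combs pW W′) (XG∈ : XG ∈ combs pG G′) (XB∈ : XB ∈ combs t bl)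
    (selected : τ ^ suc r * ∑-selected χ r ws gs (concat bl) ≤ b ^ suc r * ∑-selected χ r (concat XW) (concat XG) (concat XB)) where

    splitW = combs-split pW W′ XW∈
    splitG = combs-split pG G′ XG∈
    splitB = combs-split t bl XB∈
    xs = concat XW
    ys = concat XG ++ concat XB
    lenXW : length xs ≡ pW
    lenXW = trans (length-concat 1 XW (λ e m → ∈-singles ws (∈-resp-↭ (↭-sym (proj₁ (proj₂ splitW))) (∈-++⁺ˡ m)))) (trans (*-identityˡ _) (proj₂ (proj₂ splitW)))
    lenXG : length (concat XG) ≡ pG
    lenXG = trans (length-concat 1 XG (λ e m → ∈-singles gs (∈-resp-↭ (↭-sym (proj₁ (proj₂ splitG))) (∈-++⁺ˡ m)))) (trans (*-identityˡ _) (proj₂ (proj₂ splitG)))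
    lenXB : length (concat XB) ≡ k * t
    lenXB = trans (length-concat k XB (λ e m → sizes e (∈-resp-↭ (↭-sym (proj₁ (proj₂ splitB))) (∈-++⁺ˡ m)))) (cong (k *_) (proj₂ (proj₂ splitB)))
    part : ∀ {ps : List (List A)} (qs zs : List (List A)) → ps ↭ qs ++ zs → concat ps ↭ concat qs ++ concat zs
    part qs zs p = ↭-trans (concat-↭ p) (Perm.↭-reflexive (concat-++-list qs zs))
    whole : ws ++ (gs ++ concat bl) ↭ (xs ++ ys) ++ (concat (proj₁ splitW) ++ concat (proj₁ splitG) ++ concat (proj₁ splitB))
    whole = ↭-trans (Perm.↭-reflexive (cong₂ (λ a b → a ++ (b ++ concat bl)) (sym W≡) (sym G≡)))
      (↭-trans (PermP.++⁺ (part XW (proj₁ splitW) (proj₁ (proj₂ splitW))) (PermP.++⁺ (part XG (proj₁ splitG) (proj₁ (proj₂ splitG))) (part XB (proj₁ splitB) (proj₁ (proj₂ splitB)))))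
        (interleave-↭ xs (concat (proj₁ splitW)) (concat XG) (concat (proj₁ splitG)) (concat XB) (concat (proj₁ splitB))))
    uniqX : Unique (xs ++ ys)
    uniqX = unique-++ˡ (xs ++ ys) (unique-↭ whole uniq)
    inside : ∀ {x} → x ∈ xs ++ ys → x ∈ ws ++ (gs ++ concat XB)
    inside m with ∈-++⁻ xs m
    ... | inj₁ p = ∈-++⁺ˡ (subst (_ ∈_) W≡ (∈-resp-↭ (↭-sym (part XW (proj₁ splitW) (proj₁ (proj₂ splitW)))) (∈-++⁺ˡ p)))
    ... | inj₂ p with ∈-++⁻ (concat XG) p
    ...   | inj₁ q = ∈-++⁺ʳ ws (∈-++⁺ˡ (subst (_ ∈_) G≡ (∈-resp-↭ (↭-sym (part XG (proj₁ splitG) (proj₁ (proj₂ splitG)))) (∈-++⁺ˡ q))))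
    ...   | inj₂ q = ∈-++⁺ʳ ws (∈-++⁺ʳ gs q)
    c = t + 1 + z
    Λ = ∑-selected χ r (concat XW) (concat XG) (concat XB)
    bound : c * Λ + c * bin (suc y) (suc r) + z * (t * bin pW r) ≤ c * bin (y + suc t) (suc r)
    bound = subst₂ (λ s p → c * s + c * bin (suc y) (suc r) + z * (t * bin p r) ≤ c * bin (y + suc t) (suc r))
      (∑-cong (subs xs) (λ f → ∑-subs-++ (concat XG) (concat XB) (λ g → bit (Selected r χ (length f) (f ++ g))))) lenXW
      (frankl-list χ xs ys r t z y uniqX (trans (length-++ xs) (trans (cong₂ _+_ lenXW (trans (length-++ (concat XG)) (cong₂ _+_ lenXG lenXB))) total))
        (subst (_≤ y) (sym lenXW) pW≤y) big
        (λ f a b c d → nm XB (XB∈) f a b c (λ i p → inside (d i p))))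
    -- Frankl's gain concerns the `pW` sampled vertices of `ws`. Sampling the `r`-subsets of `ws`
    -- relates it to all of `ws`; this auxiliary sample matters only through its size.
    gain : τ ^ r * bin (length ws) r ≤ b ^ r * bin pW r
    gain with pick-sample τ b (suc r) pW W′ (λ f → bit (length f == r)) (subst (λ n → Dense τ b (suc r) n pW) (sym lenW) dW) (subst (pW ≤_) (sym lenW) pW≤) τ≤b
           (λ f l< → lem f l< )
      where
      lem : ∀ (f : List A) → suc r < length f → bit (length f == r) ≡ 0
      lem f l< with length f == r in eq
      ... | false = refl
      ... | true = ⊥-elim (<-irrefl (sym (==-true _ _ eq)) (<-trans (n<1+n r) l<))
    ... | bs , bs∈ , le = ≤-trans (≤-reflexive (sym (trans (cong (λ a → ∑ (subs a) (λ f → τ ^ length f * bit (length f == r))) W≡) (count τ ws))))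
        (≤-trans le (≤-reflexive (trans (count b (concat bs)) (cong (λ x → b ^ r * bin x r) lenbs))))
      where
      lenbs : length (concat bs) ≡ pW
      lenbs = trans (length-concat 1 bs (λ e m → ∈-singles ws (∈-resp-↭ (↭-sym (proj₁ (proj₂ (combs-split pW W′ bs∈)))) (∈-++⁺ˡ m)))) (trans (*-identityˡ _) (proj₂ (proj₂ (combs-split pW W′ bs∈))))
      count : ∀ u (vs : List A) → ∑ (subs vs) (λ f → u ^ length f * bit (length f == r)) ≡ u ^ r * bin (length vs) r
      count u vs = trans (∑-cong (subs vs) pt) (trans (∑-subs-length r vs (λ _ → u ^ r)) (trans (∑-const (combs r vs) (u ^ r)) (trans (*-comm _ (u ^ r)) (cong (u ^ r *_) (length-combs r vs)))))
        where
        pt : ∀ (f : List A) → u ^ length f * bit (length f == r) ≡ bit (length f == r) * u ^ r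
        pt f with length f == r in eq
        ... | false = *-zeroʳ (u ^ length f)
        ... | true = trans (*-comm (u ^ length f) 1) (cong (λ x → 1 * u ^ x) (==-true (length f) r eq))
    result : c * (τ ^ suc r * ∑-selected χ r ws gs (concat bl)) + c * (b ^ suc r * bin (suc y) (suc r)) + z * (t * (b * (τ ^ r * bin (length ws) r)))
      ≤ c * (b ^ suc r * bin (y + suc t) (suc r))
    result = begin
      c * (τ ^ suc r * ∑-selected χ r ws gs (concat bl)) + c * (b ^ suc r * bin (suc y) (suc r)) + z * (t * (b * (τ ^ r * bin (length ws) r)))
        ≤⟨ +-mono-≤ (+-monoˡ-≤ _ (*-monoʳ-≤ c selected)) (*-monoʳ-≤ z (*-monoʳ-≤ t (*-monoʳ-≤ b gain))) ⟩
      c * (b ^ suc r * Λ) + c * (b ^ suc r * bin (suc y) (suc r)) + z * (t * (b * (b ^ r * bin pW r)))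
        ≡⟨ lem c (b ^ suc r) Λ (bin (suc y) (suc r)) z t b (b ^ r) (bin pW r) ⟩
      b ^ suc r * (c * Λ + c * bin (suc y) (suc r)) + z * (t * (b * b ^ r * bin pW r))
        ≡⟨ lem₂ (b ^ suc r) (c * Λ + c * bin (suc y) (suc r)) z t (bin pW r) ⟩
      b ^ suc r * (c * Λ + c * bin (suc y) (suc r) + z * (t * bin pW r)) ≤⟨ *-monoʳ-≤ (b ^ suc r) bound ⟩
      b ^ suc r * (c * bin (y + suc t) (suc r)) ≡⟨ lem₃ (b ^ suc r) c (bin (y + suc t) (suc r)) ⟩
      c * (b ^ suc r * bin (y + suc t) (suc r)) ∎
      where
      open ≤-Reasoning
      lem : ∀ c x l y z t b w q → c * (x * l) + c * (x * y) + z * (t * (b * (w * q))) ≡ x * (c * l + c * y) + z * (t * (b * w * q))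
      lem = solve-∀
      lem₂ : ∀ x a z t q → x * a + z * (t * (x * q)) ≡ x * (a + z * (t * q))
      lem₂ = solve-∀
      lem₃ : ∀ x c q → x * (c * q) ≡ c * (x * q)
      lem₃ = solve-∀

-- The number of selected sublists is at most (b / τ) ^ suc r times the number of those in a suitable sample, and the sample obeys Frankl's bound.
sampled-frankl : ∀ {A : Set} (χ : List A → Bool) (ws gs : List A) (bl : List (List A)) (r k t z y τ b pW pG : ℕ)
  (uniq : Unique (ws ++ (gs ++ concat bl))) (sizes : ∀ e → e ∈ bl → length e ≡ k)
  (dW : Dense τ b (suc r) (length ws) pW) (dG : Dense τ b (suc r) (length gs) pG) (dB : Dense τ b (suc r) (length bl) t)
  (pW≤ : pW ≤ length ws) (pG≤ : pG ≤ length gs) (t≤ : t ≤ length bl) (τ≤b : τ ≤ b)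
  (total : pW + (pG + k * t) ≡ y + suc t) (pW≤y : pW ≤ y) (big : r * (2 * t + 1 + z) ≤ y)
  (nm : ∀ bs → bs ∈ combs t bl → NoFamily χ r t (ws ++ (gs ++ concat bs))) →
  (t + 1 + z) * (τ ^ suc r * ∑-selected χ r ws gs (concat bl)) + (t + 1 + z) * (b ^ suc r * bin (suc y) (suc r)) + z * (t * (b * (τ ^ r * bin (length ws) r)))
    ≤ (t + 1 + z) * (b ^ suc r * bin (y + suc t) (suc r))
sampled-frankl χ ws gs bl r k t z y τ b pW pG uniq sizes dW dG dB pW≤ pG≤ t≤ τ≤b total pW≤y big nm
  with ∑³-sample τ b (suc r) pW (singles ws) (concat (singles gs)) (concat bl) τ τ (selected³ χ r) (subst (λ n → Dense τ b (suc r) n pW) (sym (length-map (_∷ []) ws)) dW)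
         (subst (pW ≤_) (sym (length-map (_∷ []) ws)) pW≤) τ≤b (λ f g h l< → selected³-long χ r f g h (<-≤-trans l< (m≤m+n (length f) _)))
... | XW , XW∈ , leW
  with ∑³-sample τ b (suc r) pG (singles gs) (concat bl) (concat XW) τ b (λ g h f → selected³ χ r f g h) (subst (λ n → Dense τ b (suc r) n pG) (sym (length-map (_∷ []) gs)) dG)
         (subst (pG ≤_) (sym (length-map (_∷ []) gs)) pG≤) τ≤b (λ g h f l< → selected³-long χ r f g h (<-≤-trans l< (≤-trans (m≤m+n (length g) (length h)) (m≤n+m _ (length f)))))
... | XG , XG∈ , leG
  with ∑³-sample τ b (suc r) t bl (concat XW) (concat XG) b b (λ h f g → selected³ χ r f g h) dB t≤ τ≤b
         (λ h f g l< → selected³-long χ r f g h (<-≤-trans l< (≤-trans (m≤n+m (length h) (length g)) (m≤n+m _ (length f)))))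
... | XB , XB∈ , leB = SampledBound.result χ ws gs bl r k t z y τ b pW pG uniq sizes dW dG dB pW≤ pG≤ t≤ τ≤b total pW≤y big nm XW XG XB XW∈ XG∈ XB∈ selected
  where
  ψ = selected³ χ r
  W′ = singles ws
  G′ = singles gs
  selected : τ ^ suc r * ∑-selected χ r ws gs (concat bl) ≤ b ^ suc r * ∑-selected χ r (concat XW) (concat XG) (concat XB)
  selected = begin
    τ ^ suc r * ∑-selected χ r ws gs (concat bl) ≡⟨ cong₂ (λ a b → τ ^ suc r * ∑-selected χ r a b (concat bl)) (concat-map-[_] ws) (concat-map-[_] gs) ⟨
    τ ^ suc r * ∑-selected χ r (concat W′) (concat G′) (concat bl) ≡⟨ ∑³-uniform (concat W′) (concat G′) (concat bl) τ (suc r) ψ (selected³-off χ r) ⟨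
    ∑³ (concat W′) (concat G′) (concat bl) τ τ τ ψ ≤⟨ leW ⟩
    -- The rotations bring the next stratum to be sampled to the front; a third one restores the
    -- order.
    ∑³ (concat XW) (concat G′) (concat bl) b τ τ ψ ≡⟨ ∑³-rotate (concat XW) (concat G′) (concat bl) b τ τ ψ ⟩
    ∑³ (concat G′) (concat bl) (concat XW) τ τ b (λ g h f → ψ f g h) ≤⟨ leG ⟩
    ∑³ (concat XG) (concat bl) (concat XW) b τ b (λ g h f → ψ f g h) ≡⟨ ∑³-rotate (concat XG) (concat bl) (concat XW) b τ b _ ⟩
    ∑³ (concat bl) (concat XW) (concat XG) τ b b (λ h f g → ψ f g h) ≤⟨ leB ⟩
    ∑³ (concat XB) (concat XW) (concat XG) b b b (λ h f g → ψ f g h) ≡⟨ ∑³-rotate (concat XB) (concat XW) (concat XG) b b b _ ⟩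
    ∑³ (concat XW) (concat XG) (concat XB) b b b ψ ≡⟨ ∑³-uniform (concat XW) (concat XG) (concat XB) b (suc r) ψ (selected³-off χ r) ⟩
    b ^ suc r * ∑-selected χ r (concat XW) (concat XG) (concat XB) ∎
    where open ≤-Reasoning

-- Augmenting a matching

unique-++-disjoint : {xs ys : List A} → Unique (xs ++ ys) → Disjoint xs ys
unique-++-disjoint {xs = x ∷ xs} (x∉ ∷ u) (here refl , q) = All.lookup x∉ (∈-++⁺ʳ xs q) refl
unique-++-disjoint {xs = x ∷ xs} (x∉ ∷ u) (there p , q) = unique-++-disjoint u (p , q)

unique-++ʳ : (xs : List A) {ys : List A} → Unique (xs ++ ys) → Unique ys
unique-++ʳ [] u = u
unique-++ʳ (x ∷ xs) (_ ∷ u) = unique-++ʳ xs u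

combs-⊆ : ∀ p (xs : List A) {ys} → ys ∈ combs p xs → ∀ {x} → x ∈ ys → x ∈ xs
combs-⊆ p xs m x∈ with combs-split p xs m
... | zs , pm , _ = ∈-resp-↭ (↭-sym pm) (∈-++⁺ˡ x∈)

∈-combs-[] : (xs : List A) → [] ∈ combs 0 xs
∈-combs-[] xs = here refl

∑-combs-1 : ∀ (xs : List A) φ → ∑ (combs 1 xs) φ ≡ ∑ xs (λ x → φ (x ∷ []))
∑-combs-1 [] φ = refl
∑-combs-1 (x ∷ xs) φ = trans (∑-combs 0 x xs φ) (cong₂ _+_ (+-identityʳ _) (∑-combs-1 xs φ))

allPairs-++ : ∀ {R : A → A → Set} {xs ys : List A} → AllPairs R xs → AllPairs R ys → (∀ x y → x ∈ xs → y ∈ ys → R x y) → AllPairs R (xs ++ ys)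
allPairs-++ [] q h = q
allPairs-++ (px ∷ p) q h = AllP.++⁺ px (All.tabulate (λ {y} y∈ → h _ y (here refl) y∈)) ∷ allPairs-++ p q (λ x y x∈ y∈ → h x y (there x∈) y∈)

blocks-disjoint : (bl : List (List A)) → Unique (concat bl) → AllPairs Disjoint bl
blocks-disjoint [] u = []
blocks-disjoint (e ∷ bl) u = All.tabulate (λ {e'} e'∈ (p , q) → unique-++-disjoint u (p , ∈-concat⁺′ q e'∈)) ∷ blocks-disjoint bl (unique-++ʳ e u)

m≤[1+n]*m : ∀ n m → m ≤ (n + 1) * m
m≤[1+n]*m n m = ≤-trans (m≤m+n m (n * m)) (≤-reflexive (cong (_* m) (+-comm 1 n)))

family-budget : ∀ l t t₀ q r Q → t ≤ t₀ → (suc l + 1) * (suc t₀ * suc l) ≤ q → q + r ≤ Q → l * suc t + suc t ≤ Q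
family-budget l t t₀ q r Q t≤ budget q≤Q = begin
  l * suc t + suc t ≡⟨ trans (+-comm (l * suc t) (suc t)) (*-comm (suc l) (suc t)) ⟩
  suc t * suc l ≤⟨ *-monoˡ-≤ (suc l) (s≤s t≤) ⟩
  suc t₀ * suc l ≤⟨ m≤[1+n]*m (suc l) (suc t₀ * suc l) ⟩
  (suc l + 1) * (suc t₀ * suc l) ≤⟨ budget ⟩
  q ≤⟨ m≤m+n q r ⟩
  q + r ≤⟨ q≤Q ⟩
  Q ∎
  where open ≤-Reasoning

augment-budget : ∀ k t t₀ q x → x ≡ k * suc t → t ≤ t₀ → (k + 1) * (suc t₀ * k) ≤ q → x + k * x ≤ q
augment-budget k t t₀ q x refl t≤ budget = ≤-trans (≤-reflexive (lem k t)) (≤-trans (*-monoʳ-≤ (k + 1) (*-monoˡ-≤ k (s≤s t≤))) budget)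
  where
  lem : ∀ k t → k * suc t + k * (k * suc t) ≡ (k + 1) * (suc t * k)
  lem = solve-∀

first-member : (xs : List A) → 0 < length xs → Σ A λ x → x ∈ xs
first-member (x ∷ _) _ = x , here refl

blockOf : A × List A → List A
blockOf (u , g) = u ∷ g

-- Separate from `Local`, because heaviness decides how the matching is split into good and bad
-- blocks.
module Rich {A : Set} (edge : List A → Bool) (Q : ℕ) (ws : List A) where

  degree-in : List A → ℕ
  degree-in f = ∑ ws (λ w → bit (edge (w ∷ f)))

  rich : List A → Bool
  rich f = Q <ᵇ degree-in f

  rich⇒ : ∀ {f} → rich f ≡ true → Q < degree-in f
  rich⇒ e = <ᵇ⇒< _ _ (subst Bool.T (sym e) _)

  -- At most q * bin (length ws) r₀ of the subsets of ws with suc r₀ elements meet a given set of q vertices.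
  Heavy : ℕ → ℕ → A → Set
  Heavy q r₀ u = q * bin (length ws) r₀ < ∑ (combs (suc r₀) ws) (λ g → bit (rich (u ∷ g)))

-- A matching is given by its blocks: ws lists the uncovered vertices, each good block has its heavy vertex in front, and bl lists the bad blocks.
module Local (_≟A_ : DecidableEquality A)
  (edge : List A → Bool) (edge-ext : ∀ {f g} → (∀ {x} → x ∈ f → x ∈ g) → (∀ {x} → x ∈ g → x ∈ f) → edge f ≡ edge g)
  (r₀ Q q t₀ : ℕ) (budget : (3 + r₀ + 1) * (suc t₀ * (3 + r₀)) ≤ q) (q≤Q : q + suc r₀ ≤ Q)
  (ws : List A) (good : List (A × List A)) (bl : List (List A))
  (uniq : Unique (ws ++ (concat (map blockOf good) ++ concat bl)))
  (good-edges : ∀ p → p ∈ good → edge (blockOf p) ≡ true) (bad-edges : ∀ e → e ∈ bl → edge e ≡ true)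
  (maximal : ∀ M → All (λ e → edge e ≡ true) M → AllPairs Disjoint M → length M ≡ suc (length good + length bl) → ⊥)
  (heavy : ∀ p → p ∈ good → Rich.Heavy edge Q ws q r₀ (proj₁ p))
  where

  open DecMem _≟A_ using (_∈?_)
  open Rich edge Q ws

  r l k : ℕ
  r = suc r₀
  l = suc r
  k = suc l

  gs ss gb : List A
  gs = concat (map proj₂ good)
  ss = map proj₁ good
  gb = concat (map blockOf good)

  edge-↭ : ∀ {f g} → f ↭ g → edge f ≡ edge g
  edge-↭ p = edge-ext (∈-resp-↭ p) (∈-resp-↭ (↭-sym p))

  rich-↭ : ∀ {f g} → f ↭ g → rich f ≡ rich g
  rich-↭ p = cong (Q <ᵇ_) (∑-cong ws (λ w → cong bit (edge-↭ (prep w p))))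

  unique-ws : Unique ws
  unique-ws = unique-++ˡ ws uniq

  unique-gb : Unique gb
  unique-gb = unique-++ˡ gb (unique-++ʳ ws uniq)

  unique-bl : Unique (concat bl)
  unique-bl = unique-++ʳ gb (unique-++ʳ ws uniq)

  ws-gb : Disjoint ws gb
  ws-gb (p , q) = unique-++-disjoint uniq (p , ∈-++⁺ˡ q)

  ws-bl : Disjoint ws (concat bl)
  ws-bl (p , q) = unique-++-disjoint uniq (p , ∈-++⁺ʳ gb q)

  gb-bl : Disjoint gb (concat bl)
  gb-bl (p , q) = unique-++-disjoint (unique-++ʳ ws uniq) (p , q)

  -- Every entry of `D` lies in at most `bin (length ws) r₀` of the `r`-subsets of `ws`, and
  -- striking it out costs no more than that.
  avoid : ∀ (D : List A) (φ : List A → ℕ) → (∀ {f g} → f ↭ g → φ f ≡ φ g) → (∀ f → φ f ≤ 1) → Σ (List A) λ xs →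
    Unique xs × (∀ {x} → x ∈ xs → x ∈ ws × x ∉ D) × length xs ≤ length ws × ∑ (combs r ws) φ ≤ ∑ (combs r xs) φ + length D * bin (length ws) r₀
  avoid [] φ inv le = ws , unique-ws , (λ p → p , λ ()) , ≤-refl , ≤-reflexive (sym (+-identityʳ _))
  avoid (d ∷ D) φ inv le with avoid D φ inv le
  ... | xs , ux , sub , len , s with d ∈? xs
  ...   | no d∉ = xs , ux , (λ p → proj₁ (sub p) , λ { (here refl) → d∉ p ; (there q) → proj₂ (sub p) q }) , len ,
            ≤-trans s (+-monoʳ-≤ (∑ (combs r xs) φ) (m≤n+m _ (bin (length ws) r₀)))
  ...   | yes d∈ with ∈-∃++ d∈
  ...     | as , bs , refl with unique-↭ (PermP.shift d as bs) ux
  ...       | d∉ ∷ ux' = as ++ bs , ux' , (λ p → proj₁ (sub (from p)) , λ { (here refl) → All.lookup d∉ p refl ; (there q) → proj₂ (sub (from p)) q }) ,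
                ≤-trans (n≤1+n _) len' , bound
    where
    from : ∀ {x} → x ∈ as ++ bs → x ∈ as ++ d ∷ bs
    from p = ∈-resp-↭ (↭-sym (PermP.shift d as bs)) (there p)
    len' : suc (length (as ++ bs)) ≤ length ws
    len' = ≤-trans (≤-reflexive (sym (↭-length (PermP.shift d as bs)))) len
    bound : ∑ (combs r ws) φ ≤ ∑ (combs r (as ++ bs)) φ + (bin (length ws) r₀ + length D * bin (length ws) r₀)
    bound = begin
      ∑ (combs r ws) φ ≤⟨ s ⟩
      ∑ (combs r (as ++ d ∷ bs)) φ + length D * bin (length ws) r₀ ≡⟨ cong (_+ length D * bin (length ws) r₀) (∑-combs-↭ r φ inv (PermP.shift d as bs)) ⟩
      ∑ (combs r (d ∷ as ++ bs)) φ + length D * bin (length ws) r₀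
        ≤⟨ +-monoˡ-≤ (length D * bin (length ws) r₀) (≤-trans (combs-front-≤ r₀ (d ∷ []) (as ++ bs) φ 1 le)
             (+-monoʳ-≤ (∑ (combs r (as ++ bs)) φ) (≤-trans (≤-reflexive (trans (*-identityˡ _) (*-identityˡ _))) (bin-mono r₀ len')))) ⟩
      ∑ (combs r (as ++ bs)) φ + bin (length ws) r₀ + length D * bin (length ws) r₀ ≡⟨ +-assoc (∑ (combs r (as ++ bs)) φ) _ _ ⟩
      ∑ (combs r (as ++ bs)) φ + (bin (length ws) r₀ + length D * bin (length ws) r₀) ∎
      where open ≤-Reasoning

  partner : ∀ f D → rich f ≡ true → length D ≤ Q → Σ A λ w → w ∈ ws × edge (w ∷ f) ≡ true × w ∉ D
  partner f D e len = pick-avoiding _≟A_ unique-ws (λ w → edge (w ∷ f)) D (≤-<-trans len (rich⇒ e))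

  -- `D` spoils at most `q * bin (length ws) r₀` of the sets `g`, so heaviness leaves a rich set
  -- `u ∷ g` with `g` outside `D`. Richness then provides a last vertex outside `D` and `g`, as
  -- `q + r ≤ Q`.
  resupply : ∀ u D → Heavy q r₀ u → length D ≤ q → Σ (List A) λ g → length g ≡ l × edge (u ∷ g) ≡ true × (∀ {x} → x ∈ g → x ∈ ws × x ∉ D)
  resupply u D hv len with avoid D (λ g → bit (rich (u ∷ g))) (λ p → cong bit (rich-↭ (prep u p))) (λ g → bit≤1 (rich (u ∷ g)))
  ... | xs , _ , sub , _ , s with ∑-positive (combs r xs) (λ g → bit (rich (u ∷ g)))
            (+-cancelʳ-< (length D * bin (length ws) r₀) 0 _ (≤-<-trans (*-monoˡ-≤ (bin (length ws) r₀) len) (<-≤-trans hv s)))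
  ...   | g , g∈ , pos with partner (u ∷ g) (D ++ g) (bit-pos _ pos) (≤-trans (≤-reflexive (trans (length-++ D) (cong (length D +_) (proj₂ (proj₂ (combs-split r xs g∈)))))) (≤-trans (+-monoˡ-≤ r len) q≤Q))
  ...     | w , w∈ , e , w∉ = w ∷ g , cong suc (proj₂ (proj₂ (combs-split r xs g∈))) , trans (edge-↭ (swap u w ↭-refl)) e ,
              λ { (here refl) → w∈ , (λ p → w∉ (∈-++⁺ˡ p)) ; (there p) → sub (combs-⊆ r xs g∈ p) }

  remove : ∀ {x} (F : List A) → x ∈ F → Σ (List A) λ F' → length F ≡ suc (length F') × (∀ {y} → y ∈ F → y ≡ x ⊎ y ∈ F') × (∀ {y} → y ∈ F' → y ∈ F)
  remove {x} F x∈ with ∈-∃++ x∈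
  ... | as , bs , refl = as ++ bs , ↭-length (PermP.shift x as bs) ,
    (λ p → case ∈-resp-↭ (PermP.shift x as bs) p of λ { (here e) → inj₁ e ; (there p) → inj₂ p }) , (λ p → ∈-resp-↭ (↭-sym (PermP.shift x as bs)) (there p))

  goods : List (A × List A) → List A
  goods gd = concat (map blockOf gd)

  -- Substitutes for the blocks of `gd`, one for each, where `D` lists the forbidden vertices of
  -- `ws` and `F` the forbidden vertices of the good blocks.
  record Replacement (gd : List (A × List A)) (D F : List A) : Set where
    field
      edges    : List (List A)
      len      : length edges ≡ length gd
      valid    : All (λ e → edge e ≡ true) edges
      disjoint : AllPairs Disjoint edges
      located  : ∀ {e x} → e ∈ edges → x ∈ e → (x ∈ ws × x ∉ D) ⊎ (x ∈ goods gd × x ∉ F)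

  keep-block : ∀ u g gd D F → Unique (ws ++ ((u ∷ g) ++ goods gd)) → edge (u ∷ g) ≡ true → u ∉ F → (∀ {x} → x ∈ g → x ∉ F) →
    Replacement gd D F → Replacement ((u , g) ∷ gd) D F
  keep-block u g gd D F uq e u∉ free R = record
    { edges = (u ∷ g) ∷ R.edges ; len = cong suc R.len ; valid = e ∷ R.valid ; disjoint = All.tabulate apart ∷ R.disjoint ; located = locate }
    where
    module R = Replacement R
    apart : ∀ {e} → e ∈ R.edges → Disjoint (u ∷ g) e
    apart e∈ (p , q) with R.located e∈ q
    ... | inj₁ (w , _) = unique-++-disjoint uq (w , ∈-++⁺ˡ p)
    ... | inj₂ (b , _) = unique-++-disjoint (unique-++ʳ ws uq) (p , b)
    locate : ∀ {e x} → e ∈ (u ∷ g) ∷ R.edges → x ∈ e → (x ∈ ws × x ∉ D) ⊎ (x ∈ (u ∷ g) ++ goods gd × x ∉ F)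
    locate (here refl) (here refl) = inj₂ (here refl , u∉)
    locate (here refl) (there q) = inj₂ (there (∈-++⁺ˡ q) , free q)
    locate (there m) q with R.located m q
    ... | inj₁ w = inj₁ w
    ... | inj₂ (b , f) = inj₂ (∈-++⁺ʳ (u ∷ g) b , f)

  -- Only the heavy vertex `u` stays. The element `y` of `F` lies in this block and in no later one,
  -- so the remaining blocks need only avoid `F'`.
  swap-block : ∀ u g gd D F g' F' {y} → Unique (ws ++ ((u ∷ g) ++ goods gd)) → u ∉ F → y ∈ g → (∀ {x} → x ∈ F → x ≡ y ⊎ x ∈ F') →
    edge (u ∷ g') ≡ true → (∀ {x} → x ∈ g' → x ∈ ws × x ∉ D) → Replacement gd (g' ++ D) F' → Replacement ((u , g) ∷ gd) D F
  swap-block u g gd D F g' F' {y} uq u∉ y∈ covers e' loc' R = record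
    { edges = (u ∷ g') ∷ R.edges ; len = cong suc R.len ; valid = e' ∷ R.valid ; disjoint = All.tabulate apart ∷ R.disjoint ; located = locate }
    where
    module R = Replacement R
    apart : ∀ {e} → e ∈ R.edges → Disjoint (u ∷ g') e
    apart e∈ (p , q) with R.located e∈ q
    apart e∈ (here refl , q) | inj₁ (w , _) = unique-++-disjoint uq (w , here refl)
    apart e∈ (here refl , q) | inj₂ (b , _) = unique-++-disjoint (unique-++ʳ ws uq) (here refl , b)
    apart e∈ (there p , q) | inj₁ (_ , n) = n (∈-++⁺ˡ p)
    apart e∈ (there p , q) | inj₂ (b , _) = unique-++-disjoint uq (proj₁ (loc' p) , ∈-++⁺ʳ (u ∷ g) b)
    locate : ∀ {e x} → e ∈ (u ∷ g') ∷ R.edges → x ∈ e → (x ∈ ws × x ∉ D) ⊎ (x ∈ (u ∷ g) ++ goods gd × x ∉ F)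
    locate (here refl) (here refl) = inj₂ (here refl , u∉)
    locate (here refl) (there q) = inj₁ (loc' q)
    locate (there m) q with R.located m q
    ... | inj₁ (w , n) = inj₁ (w , λ d → n (∈-++⁺ʳ g' d))
    ... | inj₂ (b , n) = inj₂ (∈-++⁺ʳ (u ∷ g) b , λ f → case covers f of λ where
            (inj₁ refl) → unique-++-disjoint (unique-++ʳ ws uq) (there y∈ , b)
            (inj₂ f') → n f')

  meets? : ∀ (g F : List A) → (Σ A λ x → x ∈ g × x ∈ F) ⊎ (∀ {x} → x ∈ g → x ∉ F)
  meets? [] F = inj₂ λ ()
  meets? (x ∷ g) F with x ∈? F | meets? g F
  ... | yes p | _ = inj₁ (x , here refl , p)
  ... | no _ | inj₁ (y , y∈ , p) = inj₁ (y , there y∈ , p)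
  ... | no ¬p | inj₂ h = inj₂ λ { (here refl) → ¬p ; (there q) → h q }

  drop-block : ∀ e (xs : List A) → Unique (ws ++ (e ++ xs)) → Unique (ws ++ xs)
  drop-block e xs uq = unique-++ʳ e (unique-↭ (PermP.shifts ws e) uq)

  -- An element of `F` is worth `k` in the budget, which covers the `l` vertices that the
  -- replacement adds to `D`.
  spend : ∀ (g' D F F' : List A) → length g' ≡ l → length F ≡ suc (length F') → length (g' ++ D) + k * length F' ≤ length D + k * length F
  spend g' D F F' eg eF = begin
    length (g' ++ D) + k * f ≡⟨ cong (_+ k * f) (trans (length-++ g') (cong (_+ length D) eg)) ⟩
    l + length D + k * f ≤⟨ n≤1+n _ ⟩
    suc l + length D + k * f ≡⟨ cong (_+ k * f) (+-comm k (length D)) ⟩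
    length D + k + k * f ≡⟨ +-assoc (length D) k (k * f) ⟩
    length D + (k + k * f) ≡⟨ cong (length D +_) (*-suc k f) ⟨
    length D + k * suc f ≡⟨ cong (λ x → length D + k * x) eF ⟨
    length D + k * length F ∎
    where
    open ≤-Reasoning
    f = length F'

  -- Each replacement of a block that meets F spends one element of F and l elements of ws.
  replace : ∀ gd (D F : List A) → (∀ p → p ∈ gd → p ∈ good) → Unique (ws ++ goods gd) → (∀ p → p ∈ gd → proj₁ p ∉ F) →
    length D + k * length F ≤ q → Replacement gd D F
  replace [] D F sub u u∉ bud = record { edges = [] ; len = refl ; valid = [] ; disjoint = [] ; located = λ () }
  replace ((u , g) ∷ gd) D F sub uq u∉ bud = go (meets? g F)
    where
    swapped : ∀ {x} → x ∈ g → (Σ (List A) λ F' → length F ≡ suc (length F') × (∀ {y} → y ∈ F → y ≡ x ⊎ y ∈ F') × (∀ {y} → y ∈ F' → y ∈ F)) →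
      (Σ (List A) λ g' → length g' ≡ l × edge (u ∷ g') ≡ true × (∀ {x} → x ∈ g' → x ∈ ws × x ∉ D)) → Replacement ((u , g) ∷ gd) D F
    swapped x∈g (F' , lenF , covers , back) (g' , len' , e' , loc') = swap-block u g gd D F g' F' uq (u∉ _ (here refl)) x∈g covers e' loc'
      (replace gd (g' ++ D) F' (λ p m → sub p (there m)) (drop-block (u ∷ g) (goods gd) uq) (λ p m f → u∉ p (there m) (back f)) (≤-trans (spend g' D F F' len' lenF) bud))
    go : (Σ A λ x → x ∈ g × x ∈ F) ⊎ (∀ {x} → x ∈ g → x ∉ F) → Replacement ((u , g) ∷ gd) D F
    go (inj₂ free) = keep-block u g gd D F uq (good-edges _ (sub _ (here refl))) (u∉ _ (here refl)) free
      (replace gd D F (λ p m → sub p (there m)) (drop-block (u ∷ g) (goods gd) uq) (λ p m → u∉ p (there m)) bud)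
    go (inj₁ (x , x∈g , x∈F)) = swapped x∈g (remove F x∈F) (resupply u D (heavy _ (sub _ (here refl))) (≤-trans (m≤m+n (length D) (k * length F)) bud))

  extend : ∀ (es new rest : List (List A)) → All (λ e → edge e ≡ true) es → All (λ e → edge e ≡ true) new → All (λ e → edge e ≡ true) rest →
    AllPairs Disjoint es → AllPairs Disjoint new → AllPairs Disjoint rest →
    (∀ {e x} → e ∈ new → x ∈ e → x ∉ concat es) → (∀ {x} → x ∈ concat rest → x ∉ concat es) → (∀ {e x} → e ∈ new → x ∈ e → x ∉ concat rest) →
    length es + (length new + length rest) ≡ suc (length good + length bl) → ⊥
  extend es new rest e₁ e₂ e₃ d₁ d₂ d₃ apart₁ apart₂ apart₃ len = maximal (es ++ (new ++ rest)) (AllP.++⁺ e₁ (AllP.++⁺ e₂ e₃))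
    (allPairs-++ d₁ (allPairs-++ d₂ d₃ (λ e f e∈ f∈ {x} (p , q) → apart₃ e∈ p (∈-concat⁺′ q f∈))) cross)
    (trans (length-++ es) (trans (cong (length es +_) (length-++ new)) len))
    where
    cross : ∀ e f → e ∈ es → f ∈ new ++ rest → Disjoint e f
    cross e f e∈ f∈ (p , q) with ∈-++⁻ new f∈
    ... | inj₁ f∈new = apart₁ f∈new q (∈-concat⁺′ p e∈)
    ... | inj₂ f∈rest = apart₂ (∈-concat⁺′ q f∈rest) (∈-concat⁺′ p e∈)

  good-↭ : gb ↭ ss ++ gs
  good-↭ = go good
    where
    go : ∀ gd → concat (map blockOf gd) ↭ map proj₁ gd ++ concat (map proj₂ gd)
    go [] = ↭-refl
    go ((u , g) ∷ gd) = prep u (↭-trans (PermP.++⁺ˡ g (go gd)) (PermP.shifts g (map proj₁ gd)))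

  gs⊆gb : ∀ {x} → x ∈ gs → x ∈ gb
  gs⊆gb p = ∈-resp-↭ (↭-sym good-↭) (∈-++⁺ʳ ss p)

  head-avoids : ∀ p → p ∈ good → ∀ bs rest → bl ↭ bs ++ rest → proj₁ p ∉ ws ++ (gs ++ concat bs)
  head-avoids p p∈ bs rest pm m with ∈-map⁺ proj₁ p∈ | ∈-++⁻ ws m
  ... | u∈ | inj₁ q = ws-gb (q , ∈-resp-↭ (↭-sym good-↭) (∈-++⁺ˡ u∈))
  ... | u∈ | inj₂ q with ∈-++⁻ gs q
  ...   | inj₁ q' = unique-++-disjoint (unique-↭ good-↭ unique-gb) (u∈ , q')
  ...   | inj₂ q' = gb-bl (∈-resp-↭ (↭-sym good-↭) (∈-++⁺ˡ u∈) , ∈-resp-↭ (↭-sym (concat-↭ pm)) (subst (_ ∈_) (sym (concat-++-list bs rest)) (∈-++⁺ˡ q')))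

  replacement-⊥ : ∀ t bs rest → bl ↭ bs ++ rest → length bs ≡ t → ∀ es → All (λ e → edge e ≡ true) es → AllPairs Disjoint es → length es ≡ suc t →
    (∀ {x} → x ∈ concat es → x ∈ ws ++ (gs ++ concat bs)) → Replacement good (concat es) (concat es) → ⊥
  replacement-⊥ t bs rest pm lenbs es ed dis len inside R = extend es R.edges rest ed R.valid (All.tabulate (λ m → bad-edges _ (rest⊆ m))) dis R.disjoint
      (blocks-disjoint rest (unique-++ʳ (concat bs) uniq-split)) apart₁ apart₂ apart₃ total
    where
    F = concat es
    module R = Replacement R
    rest⊆ : ∀ {e} → e ∈ rest → e ∈ bl
    rest⊆ m = ∈-resp-↭ (↭-sym pm) (∈-++⁺ʳ bs m)
    split-↭ : concat bl ↭ concat bs ++ concat rest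
    split-↭ = ↭-trans (concat-↭ pm) (Perm.↭-reflexive (concat-++-list bs rest))
    uniq-split : Unique (concat bs ++ concat rest)
    uniq-split = unique-↭ split-↭ unique-bl
    rest∈bl : ∀ {x} → x ∈ concat rest → x ∈ concat bl
    rest∈bl p = ∈-resp-↭ (↭-sym split-↭) (∈-++⁺ʳ (concat bs) p)
    apart₁ : ∀ {e x} → e ∈ R.edges → x ∈ e → x ∉ F
    apart₁ e∈ p with R.located e∈ p
    ... | inj₁ (_ , n) = n
    ... | inj₂ (_ , n) = n
    apart₂ : ∀ {x} → x ∈ concat rest → x ∉ F
    apart₂ p m with ∈-++⁻ ws (inside m)
    ... | inj₁ w = ws-bl (w , rest∈bl p)
    ... | inj₂ q with ∈-++⁻ gs q
    ...   | inj₁ g = gb-bl (gs⊆gb g , rest∈bl p)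
    ...   | inj₂ b = unique-++-disjoint uniq-split (b , p)
    apart₃ : ∀ {e x} → e ∈ R.edges → x ∈ e → x ∉ concat rest
    apart₃ e∈ p m with R.located e∈ p
    ... | inj₁ (w , _) = ws-bl (w , rest∈bl m)
    ... | inj₂ (g , _) = gb-bl (g , rest∈bl m)
    total : length es + (length R.edges + length rest) ≡ suc (length good + length bl)
    total = begin
      length es + (length R.edges + length rest) ≡⟨ cong₂ (λ a b → a + (b + length rest)) len R.len ⟩
      suc t + (length good + length rest) ≡⟨ lem t (length good) (length rest) ⟩
      suc (length good + (t + length rest)) ≡⟨ cong (λ x → suc (length good + (x + length rest))) lenbs ⟨
      suc (length good + (length bs + length rest)) ≡⟨ cong (λ x → suc (length good + x)) (trans (↭-length pm) (length-++ bs)) ⟨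
      suc (length good + length bl) ∎
      where
      open ≡-Reasoning
      lem : ∀ t a b → suc t + (a + b) ≡ suc (a + (t + b))
      lem = solve-∀

  -- The good blocks met by es contain unused heavy vertices, through which they are replaced; then es and the replacements enlarge the matching.
  no-augmentation : ∀ t bs → t ≤ t₀ → bs ∈ combs t bl → ∀ es → All (λ e → edge e ≡ true) es → AllPairs Disjoint es → length es ≡ suc t →
    (∀ e → e ∈ es → length e ≡ k) → (∀ {x} → x ∈ concat es → x ∈ ws ++ (gs ++ concat bs)) → ⊥
  no-augmentation t bs t≤ bs∈ es ed dis len sizes inside with combs-split t bl bs∈
  ... | rest , pm , lenbs = replacement-⊥ t bs rest pm lenbs es ed dis len inside
    -- The vertices of `es` are forbidden both in `ws` and in the good blocks.
    (replace good (concat es) (concat es) (λ p m → m) (unique-++ˡ (ws ++ gb) (subst Unique (sym (++-assoc ws gb (concat bl))) uniq))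
      (λ p p∈ m → head-avoids p p∈ bs rest pm (inside m))
      (augment-budget k t t₀ q (length (concat es)) (trans (length-concat k es sizes) (cong (k *_) len)) t≤ budget))

  record Attached (fl : List (List A)) (D : List A) : Set where
    field
      edges    : List (List A)
      len      : length edges ≡ length fl
      valid    : All (λ e → edge e ≡ true) edges
      disjoint : AllPairs Disjoint edges
      located  : ∀ {e} → e ∈ edges → Σ A λ w → Σ (List A) λ f → e ≡ w ∷ f × f ∈ fl × w ∈ ws × w ∉ D

  -- Partners are chosen one at a time; `D` collects the vertices of the rich sets and the partners
  -- so far, and the bound `Q` is never exceeded.
  attach : ∀ fl D → All (λ f → rich f ≡ true) fl → AllPairs Disjoint fl → (∀ {f x} → f ∈ fl → x ∈ f → x ∈ D) → length D + length fl ≤ Q → Attached fl D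
  attach [] D _ _ _ _ = record { edges = [] ; len = refl ; valid = [] ; disjoint = [] ; located = λ () }
  attach (f ∷ fl) D (rf ∷ rfl) (df ∷ dfl) within bud = go (partner f D rf (≤-trans (m≤m+n (length D) _) bud))
    where
    go : (Σ A λ w → w ∈ ws × edge (w ∷ f) ≡ true × w ∉ D) → Attached (f ∷ fl) D
    go (w , w∈ , e , w∉) = record { edges = (w ∷ f) ∷ R.edges ; len = cong suc R.len ; valid = e ∷ R.valid ; disjoint = All.tabulate apart ∷ R.disjoint ; located = locate }
      where
      module R = Attached (attach fl (w ∷ D) rfl dfl (λ m p → there (within (there m) p)) (≤-trans (≤-reflexive (sym (+-suc (length D) (length fl)))) bud))
      apart : ∀ {e} → e ∈ R.edges → Disjoint (w ∷ f) e
      apart e∈ pq with R.located e∈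
      apart e∈ (here refl , here refl) | w' , f' , refl , f'∈ , w'∈ , w'∉ = w'∉ (here refl)
      apart e∈ (here refl , there q) | w' , f' , refl , f'∈ , w'∈ , w'∉ = w∉ (within (there f'∈) q)
      apart e∈ (there p , here refl) | w' , f' , refl , f'∈ , w'∈ , w'∉ = w'∉ (there (within (here refl) p))
      apart e∈ (there p , there q) | w' , f' , refl , f'∈ , w'∈ , w'∉ = All.lookup df f'∈ (p , q)
      locate : ∀ {e} → e ∈ (w ∷ f) ∷ R.edges → Σ A λ w → Σ (List A) λ f' → e ≡ w ∷ f' × f' ∈ f ∷ fl × w ∈ ws × w ∉ D
      locate (here refl) = w , f , refl , here refl , w∈ , w∉
      locate (there m) with R.located m
      ... | w' , f' , eq , f'∈ , w'∈ , w'∉ = w' , f' , eq , there f'∈ , w'∈ , (λ d → w'∉ (there d))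

  attached-⊥ : ∀ t bs → t ≤ t₀ → bs ∈ combs t bl → ∀ fl D → length fl ≡ suc t → (∀ g → g ∈ fl → length g ≡ l) →
    (∀ {g x} → g ∈ fl → x ∈ g → x ∈ ws ++ (gs ++ concat bs)) → Attached fl D → ⊥
  attached-⊥ t bs t≤ bs∈ fl D lenfl sized within R = no-augmentation t bs t≤ bs∈ R.edges R.valid R.disjoint (trans R.len lenfl) sizes inside
    where
    module R = Attached R
    sizes : ∀ e → e ∈ R.edges → length e ≡ k
    sizes e m with R.located m
    ... | w , g , refl , g∈ , _ , _ = cong suc (sized g g∈)
    inside : ∀ {x} → x ∈ concat R.edges → x ∈ ws ++ (gs ++ concat bs)
    inside m with ∈-concat⁻′ R.edges m
    ... | e , x∈ , e∈ with R.located e∈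
    inside m | e , here refl , e∈ | w , g , refl , g∈ , w∈ , _ = ∈-++⁺ˡ w∈
    inside m | e , there x∈ , e∈ | w , g , refl , g∈ , w∈ , _ = within g∈ x∈

  no-family : ∀ t bs → t ≤ t₀ → bs ∈ combs t bl → NoFamily rich r t (ws ++ (gs ++ concat bs))
  no-family t bs t≤ bs∈ f richf lenf disf insf = attached-⊥ t bs t≤ bs∈ fl (concat fl) lenfl sized within
    (attach fl (concat fl) (AllP.map⁺ (All.tabulate (λ {i} _ → richf i))) (AllPairsP.map⁺ (AllPairs.map {S = λ i j → Disjoint (f i) (f j)} (λ {i} {j} i≢j {x} → disf i j i≢j {x}) (fins-unique (suc t))))
      (λ m p → ∈-concat⁺′ p m) bud)
    where
    fl = map f (fins (suc t))
    lenfl : length fl ≡ suc t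
    lenfl = trans (length-map f (fins (suc t))) (length-fins (suc t))
    from : ∀ {g} → g ∈ fl → Σ (Fin (suc t)) λ i → g ≡ f i
    from m with ∈-map⁻ f m
    ... | i , _ , e = i , e
    sized : ∀ g → g ∈ fl → length g ≡ l
    sized g m with from m
    ... | i , refl = lenf i
    within : ∀ {g x} → g ∈ fl → x ∈ g → x ∈ ws ++ (gs ++ concat bs)
    within g∈ p with from g∈
    ... | i , refl = insf i p
    bud : length (concat fl) + length fl ≤ Q
    bud = ≤-trans (≤-reflexive (cong₂ _+_ (trans (length-concat l fl sized) (cong (l *_) lenfl)) lenfl)) (family-budget l t t₀ q r Q t≤ budget q≤Q)

  us : List A
  us = ws ++ (gs ++ concat bl)

  -- The case `t = 0` of `no-augmentation`: a single edge that avoids the deleted vertices and all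
  -- bad blocks would already enlarge the matching.
  isolated : ∀ f → length f ≡ l → (∀ {x} → x ∈ f → x ∈ ws ++ gs) → degree-in f ≡ 0
  isolated f lenf inside = ∑-zero-∈ ws pt
    where
    pt : ∀ w → w ∈ ws → bit (edge (w ∷ f)) ≡ 0
    pt w w∈ with edge (w ∷ f) in e
    ... | false = refl
    ... | true = ⊥-elim (no-augmentation 0 [] z≤n (∈-combs-[] bl) ((w ∷ f) ∷ []) (e ∷ []) ([] ∷ []) refl (λ { _ (here refl) → cong suc lenf })
        (λ {x} m → subst (x ∈_) (cong (ws ++_) (sym (++-identityʳ gs))) (local (subst (x ∈_) (++-identityʳ (w ∷ f)) m))))
      where
      local : ∀ {x} → x ∈ w ∷ f → x ∈ ws ++ gs
      local (here refl) = ∈-++⁺ˡ w∈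
      local (there p) = inside p

  isolated-poor : ∀ f → length f ≡ l → (∀ {x} → x ∈ f → x ∈ ws ++ gs) → bit (rich f) ≡ 0
  isolated-poor f lenf inside with rich f in e
  ... | false = refl
  ... | true = ⊥-elim (n≮0 (subst (Q <_) (isolated f lenf inside) (rich⇒ e)))

  Λ : ℕ
  Λ = ∑-selected rich r ws gs (concat bl)

  -- Sets inside `ws ++ gs` are isolated and hence not rich. A rich set outside the count `Λ` thus
  -- consists of `r` elements of `ws` and one vertex of a bad block, and each such vertex accounts
  -- for at most `K` of them.
  rich-count : ∀ K → (∀ u → u ∈ concat bl → ∑ (combs r ws) (λ g → bit (rich (u ∷ g))) ≤ K) →
    ∑ (combs l us) (bit ∘ rich) ≤ Λ + length (concat bl) * K
  rich-count K light = begin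
    ∑ (combs l us) (bit ∘ rich) ≡⟨ ∑-subs-length l us (bit ∘ rich) ⟨
    ∑ (subs us) (λ f → bit (length f == l) * bit (rich f)) ≡⟨ ∑-subs-++ ws R (λ f → bit (length f == l) * bit (rich f)) ⟩
    ∑ (subs ws) (λ f → ∑ (subs R) (λ g → bit (length (f ++ g) == l) * bit (rich (f ++ g)))) ≤⟨ ∑-mono (subs ws) (λ f → ∑-mono (subs R) (λ g → pt f g)) ⟩
    ∑ (subs ws) (λ f → ∑ (subs R) (λ g → sel f g + (one f g + two f g))) ≡⟨ spread ⟩
    ∑ (subs ws) (λ f → ∑ (subs R) (sel f)) + (∑ (subs ws) (λ f → ∑ (subs R) (one f)) + ∑ (subs ws) (λ f → ∑ (subs R) (two f)))
      ≤⟨ +-mono-≤ (≤-reflexive (∑-cong (subs ws) (λ f → ∑-subs-++ gs (concat bl) (sel f)))) (+-mono-≤ ones (≤-reflexive twos)) ⟩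
    Λ + (length (concat bl) * K + 0) ≡⟨ cong (Λ +_) (+-identityʳ _) ⟩
    Λ + length (concat bl) * K ∎
    where
    open ≤-Reasoning
    R = gs ++ concat bl
    sel one two : List A → List A → ℕ
    sel f g = bit (Selected r rich (length f) (f ++ g))
    one f g = bit (length f == r) * (bit (length g == 1) * bit (rich (f ++ g)))
    two f g = bit (length f == l) * (bit (length g == 0) * bit (rich (f ++ g)))
    spread : ∑ (subs ws) (λ f → ∑ (subs R) (λ g → sel f g + (one f g + two f g)))
      ≡ ∑ (subs ws) (λ f → ∑ (subs R) (sel f)) + (∑ (subs ws) (λ f → ∑ (subs R) (one f)) + ∑ (subs ws) (λ f → ∑ (subs R) (two f)))
    spread = trans (∑-cong (subs ws) (λ f → trans (∑-+ (subs R) (sel f) (λ g → one f g + two f g)) (cong (∑ (subs R) (sel f) +_) (∑-+ (subs R) (one f) (two f)))))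
      (trans (∑-+ (subs ws) (λ f → ∑ (subs R) (sel f)) _) (cong (∑ (subs ws) (λ f → ∑ (subs R) (sel f)) +_) (∑-+ (subs ws) (λ f → ∑ (subs R) (one f)) _)))
    pt : ∀ f g → bit (length (f ++ g) == l) * bit (rich (f ++ g)) ≤ sel f g + (one f g + two f g)
    pt f g with length (f ++ g) == l in e | rich (f ++ g)
    ... | false | _ = z≤n
    ... | true | false = z≤n
    ... | true | true = cases (<-cmp (length f) r)
      where
      total : length f + length g ≡ suc r
      total = trans (sym (length-++ f)) (==-true _ _ e)
      cases : Tri (length f < r) (length f ≡ r) (length f > r) → 1 ≤ bit ((length f <ᵇ r) ∧ true) + (bit (length f == r) * (bit (length g == 1) * 1) + bit (length f == l) * (bit (length g == 0) * 1))
      cases (tri< lt _ _) = ≤-trans (≤-reflexive (sym (bit-true (cong₂ _∧_ (<ᵇ-true lt) refl)))) (m≤m+n _ _)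
        where
        <ᵇ-true : ∀ {a b} → a < b → (a <ᵇ b) ≡ true
        <ᵇ-true {zero} (s≤s _) = refl
        <ᵇ-true {suc a} (s≤s (s≤s p)) = <ᵇ-true {a} (s≤s p)
      cases (tri≈ _ eq _) = ≤-trans (≤-reflexive (sym (cong₂ (λ x y → bit x * (bit y * 1)) (trans (cong (_== r) eq) (==-refl r))
          (trans (cong (_== 1) (+-cancelˡ-≡ r (length g) 1 (trans (cong (_+ length g) (sym eq)) (trans total (+-comm 1 r))))) refl))))
        (≤-trans (m≤m+n _ (bit (length f == l) * (bit (length g == 0) * 1))) (m≤n+m _ (bit ((length f <ᵇ r) ∧ true))))
      cases (tri> _ _ gt) = ≤-trans (≤-reflexive (sym (cong₂ (λ x y → bit x * (bit y * 1)) (trans (cong (_== l) eqf) (==-refl l)) (cong (_== 0) eqg))))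
        (≤-trans (m≤n+m _ (bit (length f == r) * (bit (length g == 1) * 1))) (m≤n+m _ (bit ((length f <ᵇ r) ∧ true))))
        where
        eqf : length f ≡ l
        eqf = ≤-antisym (≤-trans (m≤m+n (length f) (length g)) (≤-reflexive total)) gt
        eqg : length g ≡ 0
        eqg = +-cancelˡ-≡ l (length g) 0 (trans (cong (_+ length g) (sym eqf)) (trans total (sym (+-identityʳ l))))
    combos : ∀ a b → ∑ (subs ws) (λ f → ∑ (subs R) (λ g → bit (length f == a) * (bit (length g == b) * bit (rich (f ++ g))))) ≡ ∑ (combs a ws) (λ f → ∑ (combs b R) (λ g → bit (rich (f ++ g))))
    combos a b = trans (∑-cong (subs ws) (λ f → trans (∑-*ˡ (bit (length f == a)) (subs R) _) (cong (bit (length f == a) *_) (∑-subs-length b R _)))) (∑-subs-length a ws _)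
    twos : ∑ (subs ws) (λ f → ∑ (subs R) (two f)) ≡ 0
    twos = trans (combos l 0) (∑-zero-∈ (combs l ws) (λ f f∈ → trans (+-identityʳ _) (trans (cong (bit ∘ rich) (++-identityʳ f))
      (isolated-poor f (proj₂ (proj₂ (combs-split l ws f∈))) (λ p → ∈-++⁺ˡ (combs-⊆ l ws f∈ p))))))
    ones : ∑ (subs ws) (λ f → ∑ (subs R) (one f)) ≤ length (concat bl) * K
    ones = begin
      ∑ (subs ws) (λ f → ∑ (subs R) (one f)) ≡⟨ combos r 1 ⟩
      ∑ (combs r ws) (λ f → ∑ (combs 1 R) (λ g → bit (rich (f ++ g)))) ≡⟨ ∑-cong (combs r ws) (λ f → ∑-combs-1 R _) ⟩
      ∑ (combs r ws) (λ f → ∑ R (λ u → bit (rich (f ++ u ∷ [])))) ≡⟨ ∑-swap (combs r ws) R _ ⟩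
      ∑ R (λ u → ∑ (combs r ws) (λ f → bit (rich (f ++ u ∷ [])))) ≡⟨ ∑-++ gs (concat bl) _ ⟩
      ∑ gs (λ u → ∑ (combs r ws) (λ f → bit (rich (f ++ u ∷ [])))) + ∑ (concat bl) (λ u → ∑ (combs r ws) (λ f → bit (rich (f ++ u ∷ []))))
        ≤⟨ +-mono-≤ (≤-reflexive (∑-zero-∈ gs (λ u u∈ → ∑-zero-∈ (combs r ws) (λ f f∈ → isolated-poor (f ++ u ∷ [])
             (trans (length-++ f) (trans (cong (_+ 1) (proj₂ (proj₂ (combs-split r ws f∈)))) (+-comm r 1))) (within u∈ f∈)))))
             (∑-bound-∈ (concat bl) K (λ u u∈ → ≤-trans (≤-reflexive (∑-cong (combs r ws) (λ f → cong bit (rich-↭ (PermP.++-comm f (u ∷ [])))))) (light u u∈))) ⟩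
      length (concat bl) * K ∎
      where
      within : ∀ {u f} → u ∈ gs → f ∈ combs r ws → ∀ {x} → x ∈ f ++ u ∷ [] → x ∈ ws ++ gs
      within {u} {f} u∈ f∈ p with ∈-++⁻ f p
      ... | inj₁ q = ∈-++⁺ˡ (combs-⊆ r ws f∈ q)
      ... | inj₂ (here refl) = ∈-++⁺ʳ ws u∈

  -- A rich set contributes at most `length ws`, any other set at most `Q`, and a set that misses
  -- the bad blocks nothing at all.
  degree-count : ∀ K → (∀ u → u ∈ concat bl → ∑ (combs r ws) (λ g → bit (rich (u ∷ g))) ≤ K) →
    ∑ (combs l us) degree-in ≤ length ws * (Λ + length (concat bl) * K) + Q * (length (concat bl) * bin (length us) r)
  degree-count K light = begin
    ∑ (combs l us) degree-in ≤⟨ ∑-mono (combs l us) (λ f → m≤n+m∸n (degree-in f) (W * bit (rich f))) ⟩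
    ∑ (combs l us) (λ f → W * bit (rich f) + φ f) ≡⟨ trans (∑-+ (combs l us) (λ f → W * bit (rich f)) φ) (cong (_+ ∑ (combs l us) φ) (∑-*ˡ W (combs l us) (bit ∘ rich))) ⟩
    W * ∑ (combs l us) (bit ∘ rich) + ∑ (combs l us) φ ≤⟨ +-mono-≤ (*-monoʳ-≤ W (rich-count K light)) poor ⟩
    W * (Λ + length (concat bl) * K) + Q * (length (concat bl) * bin (length us) r) ∎
    where
    open ≤-Reasoning
    W = length ws
    -- The part of `degree-in` that richness does not pay for: zero for rich sets and at most `Q`
    -- for the others.
    φ : List A → ℕ
    φ f = degree-in f ∸ W * bit (rich f)
    φ≤Q : ∀ f → φ f ≤ Q
    φ≤Q f with Q <ᵇ degree-in f in e
    ... | true = ≤-trans (≤-reflexive (m≤n⇒m∸n≡0 (∑-bound-∈ ws 1 (λ w _ → bit≤1 _)))) z≤n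
    ... | false = ≤-trans (m∸n≤m (degree-in f) (W * 0)) (≮⇒≥ (λ lt → subst Bool.T e (<⇒<ᵇ lt)))
    swap-↭ : us ↭ concat bl ++ (ws ++ gs)
    swap-↭ = ↭-trans (Perm.↭-reflexive (sym (++-assoc ws gs (concat bl)))) (PermP.++-comm (ws ++ gs) (concat bl))
    φ-↭ : ∀ {f g} → f ↭ g → φ f ≡ φ g
    φ-↭ p = cong₂ (λ a b → a ∸ W * bit b) (∑-cong ws (λ w → cong bit (edge-↭ (prep w p)))) (rich-↭ p)
    poor : ∑ (combs l us) φ ≤ Q * (length (concat bl) * bin (length us) r)
    poor = begin
      ∑ (combs l us) φ ≡⟨ ∑-combs-↭ l φ φ-↭ swap-↭ ⟩
      ∑ (combs l (concat bl ++ (ws ++ gs))) φ ≤⟨ combs-front-≤ r (concat bl) (ws ++ gs) φ Q φ≤Q ⟩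
      ∑ (combs l (ws ++ gs)) φ + Q * (length (concat bl) * bin (length (concat bl ++ (ws ++ gs))) r)
        ≡⟨ cong₂ (λ a b → a + Q * (length (concat bl) * bin b r)) (∑-zero-∈ (combs l (ws ++ gs)) (λ f f∈ → n≤0⇒n≡0 (≤-trans (m∸n≤m (degree-in f) (W * bit (rich f)))
             (≤-reflexive (isolated f (proj₂ (proj₂ (combs-split l (ws ++ gs) f∈))) (combs-⊆ l (ws ++ gs) f∈)))))) (sym (↭-length swap-↭)) ⟩
      Q * (length (concat bl) * bin (length us) r) ∎

  -- Deleting `ss` destroys at most `bin N l - bin u l` edges at `w`. This is precisely the drop of
  -- the first term of the degree condition, so the subtracted term `bin v l` stays the same.
  vertex-degree : ∀ w → w ∈ ws → ∀ N u v → length us ≡ suc u → length (ws ++ (gb ++ concat bl)) ≡ suc N →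
    (∀ rest → ws ++ (gb ++ concat bl) ↭ w ∷ rest → suc (bin N l) ≤ ∑ (combs l rest) (λ f → bit (edge (w ∷ f))) + bin v l) →
    suc (bin u l) ≤ ∑ (combs l us) (λ f → bit (edge (w ∷ f))) + bin v l
  vertex-degree w w∈ N u v lenu lenN deg with ∈-∃++ w∈
  ... | as , bs , refl = +-cancelʳ-≤ (bin N l) _ _ (begin
    suc (bin u l) + bin N l ≡⟨ lem (bin u l) (bin N l) ⟩
    suc (bin N l) + bin u l ≤⟨ +-monoˡ-≤ (bin u l) (deg (ss ++ us') (↭-trans all-↭ (PermP.shift w ss us'))) ⟩
    ∑ (combs l (ss ++ us')) φ + bin v l + bin u l ≡⟨ lem₂ (∑ (combs l (ss ++ us')) φ) (bin v l) (bin u l) ⟩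
    ∑ (combs l (ss ++ us')) φ + bin u l + bin v l ≤⟨ +-monoˡ-≤ (bin v l) exact ⟩
    ∑ (combs l us') φ + bin N l + bin v l ≤⟨ +-monoˡ-≤ (bin v l) (+-monoˡ-≤ (bin N l) grow) ⟩
    ∑ (combs l us) φ + bin N l + bin v l ≡⟨ lem₂ (∑ (combs l us) φ) (bin N l) (bin v l) ⟩
    ∑ (combs l us) φ + bin v l + bin N l ∎)
    where
    open ≤-Reasoning
    φ : List A → ℕ
    φ f = bit (edge (w ∷ f))
    us' = (as ++ bs) ++ (gs ++ concat bl)
    w-↭ : us ↭ w ∷ us'
    w-↭ = PermP.++⁺ʳ (gs ++ concat bl) (PermP.shift w as bs)
    all-↭ : ws ++ (gb ++ concat bl) ↭ ss ++ (w ∷ us')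
    all-↭ = ↭-trans (PermP.++⁺ˡ ws (PermP.++⁺ʳ (concat bl) good-↭)) (↭-trans (PermP.++⁺ˡ ws (Perm.↭-reflexive (++-assoc ss gs (concat bl))))
      (↭-trans (PermP.shifts ws ss) (PermP.++⁺ˡ ss w-↭)))
    lenu' : length us' ≡ u
    lenu' = suc-injective (trans (sym (↭-length w-↭)) lenu)
    lenr : length (ss ++ us') ≡ N
    lenr = suc-injective (trans (sym (trans (↭-length all-↭) (↭-length (PermP.shift w ss us')))) lenN)
    exact : ∑ (combs l (ss ++ us')) φ + bin u l ≤ ∑ (combs l us') φ + bin N l
    exact = subst₂ (λ a b → ∑ (combs l (ss ++ us')) φ + bin a l ≤ ∑ (combs l us') φ + bin b l) lenu' lenr (combs-front-exact l ss us' φ (λ f → bit≤1 _))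
    -- Admitting lists that contain `w` itself can only increase the sum, and it gives all vertices
    -- of `ws` the common ground list `us`.
    grow : ∑ (combs l us') φ ≤ ∑ (combs l us) φ
    grow = ≤-trans (m≤n+m _ (∑ (combs r us') (φ ∘ (w ∷_)))) (≤-reflexive (trans (sym (∑-combs r w us' φ)) (sym (∑-combs-↭ l φ (λ p → cong bit (edge-↭ (prep w p))) w-↭))))
    lem : ∀ a b → suc a + b ≡ suc b + a
    lem = solve-∀
    lem₂ : ∀ a b c → a + b + c ≡ a + c + b
    lem₂ = solve-∀

  local-count : ∀ N u v K → length us ≡ suc u → length (ws ++ (gb ++ concat bl)) ≡ suc N →
    (∀ w → w ∈ ws → ∀ rest → ws ++ (gb ++ concat bl) ↭ w ∷ rest → suc (bin N l) ≤ ∑ (combs l rest) (λ f → bit (edge (w ∷ f))) + bin v l) →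
    (∀ x → x ∈ concat bl → ∑ (combs r ws) (λ g → bit (rich (x ∷ g))) ≤ K) →
    length ws * suc (bin u l) ≤ length ws * bin v l + (length ws * (Λ + length (concat bl) * K) + Q * (length (concat bl) * bin (length us) r))
  local-count N u v K lenu lenN deg light = begin
    W * suc (bin u l) ≡⟨ ∑-const ws (suc (bin u l)) ⟨
    ∑ ws (λ _ → suc (bin u l)) ≤⟨ ∑-mono-∈ ws (λ w w∈ → vertex-degree w w∈ N u v lenu lenN (deg w w∈)) ⟩
    ∑ ws (λ w → ∑ (combs l us) (λ f → bit (edge (w ∷ f))) + bin v l) ≡⟨ ∑-+ ws (λ w → ∑ (combs l us) (λ f → bit (edge (w ∷ f)))) (λ _ → bin v l) ⟩
    ∑ ws (λ w → ∑ (combs l us) (λ f → bit (edge (w ∷ f)))) + ∑ ws (λ _ → bin v l) ≡⟨ cong₂ _+_ (∑-swap ws (combs l us) _) (∑-const ws (bin v l)) ⟩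
    ∑ (combs l us) degree-in + W * bin v l ≤⟨ +-monoˡ-≤ (W * bin v l) (degree-count K light) ⟩
    W * (Λ + length (concat bl) * K) + Q * (length (concat bl) * bin (length us) r) + W * bin v l ≡⟨ +-comm _ (W * bin v l) ⟩
    W * bin v l + (W * (Λ + length (concat bl) * K) + Q * (length (concat bl) * bin (length us) r)) ∎
    where
    open ≤-Reasoning
    W = length ws

  us-↭ : ws ++ (gb ++ concat bl) ↭ ss ++ us
  us-↭ = ↭-trans (PermP.++⁺ˡ ws (PermP.++⁺ʳ (concat bl) good-↭)) (↭-trans (PermP.++⁺ˡ ws (Perm.↭-reflexive (++-assoc ss gs (concat bl)))) (PermP.shifts ws ss))

  unique-us : Unique us
  unique-us = unique-++ʳ ss (unique-↭ us-↭ uniq)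

  no-blocks : ∀ N u v → concat bl ≡ [] → length us ≡ suc u → length (ws ++ (gb ++ concat bl)) ≡ suc N → 0 < length ws → v ≤ u →
    (∀ w → w ∈ ws → ∀ rest → ws ++ (gb ++ concat bl) ↭ w ∷ rest → suc (bin N l) ≤ ∑ (combs l rest) (λ f → bit (edge (w ∷ f))) + bin v l) → ⊥
  no-blocks N u v no-bl lenu lenN 0<ws v≤u deg = go (first-member ws 0<ws)
    where
    inside : ∀ {x} → x ∈ us → x ∈ ws ++ gs
    inside {x} p = subst (x ∈_) (trans (cong (λ c → ws ++ (gs ++ c)) no-bl) (cong (ws ++_) (++-identityʳ gs))) p
    silent : ∑ (combs l us) degree-in ≡ 0
    silent = ∑-zero-∈ (combs l us) (λ f f∈ → isolated f (proj₂ (proj₂ (combs-split l us f∈))) (λ p → inside (combs-⊆ l us f∈ p)))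
    go : (Σ A λ w → w ∈ ws) → ⊥
    go (w , w∈) = 1+n≰n (≤-trans (vertex-degree w w∈ N u v lenu lenN (deg w w∈)) (≤-trans (+-monoˡ-≤ (bin v l) (≤-reflexive single)) (bin-mono l v≤u)))
      where
      single : ∑ (combs l us) (λ f → bit (edge (w ∷ f))) ≡ 0
      single = n≤0⇒n≡0 (≤-trans (∑-mono (combs l us) (λ f → ∑-term (λ w → bit (edge (w ∷ f))) w∈)) (≤-reflexive silent))

-- Numerical estimates

-- The mean value estimate, by which an additive error in the base passes to the power.
pow-upper : ∀ a d r → (a + d) ^ suc r ≤ a ^ suc r + suc r * (d * (a + d) ^ r)
pow-upper a d zero = ≤-reflexive (lem a d)
  where
  lem : ∀ a d → (a + d) * 1 ≡ a * 1 + 1 * (d * 1)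
  lem = solve-∀
pow-upper a d (suc r) = begin
  (a + d) * s ≡⟨ *-distribʳ-+ s a d ⟩
  a * s + d * s ≤⟨ +-monoˡ-≤ (d * s) (*-monoʳ-≤ a (pow-upper a d r)) ⟩
  a * (a ^ suc r + suc r * (d * (a + d) ^ r)) + d * s ≡⟨ lem a (a ^ suc r) (suc r) d ((a + d) ^ r) (d * s) ⟩
  a * a ^ suc r + suc r * (d * (a * (a + d) ^ r)) + d * s ≤⟨ +-monoˡ-≤ (d * s) (+-monoʳ-≤ (a * a ^ suc r) (*-monoʳ-≤ (suc r) (*-monoʳ-≤ d (*-monoˡ-≤ ((a + d) ^ r) (m≤m+n a d))))) ⟩
  a * a ^ suc r + suc r * (d * s) + d * s ≡⟨ lem₂ (a * a ^ suc r) r (d * s) ⟩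
  a ^ suc (suc r) + suc (suc r) * (d * s) ∎
  where
  open ≤-Reasoning
  s = (a + d) ^ suc r
  lem : ∀ a p r d w e → a * (p + r * (d * w)) + e ≡ a * p + r * (d * (a * w)) + e
  lem = solve-∀
  lem₂ : ∀ p r e → p + suc r * e + e ≡ p + suc (suc r) * e
  lem₂ = solve-∀

pow-lower : ∀ w r → suc r * w ^ r + w ^ suc r ≤ suc w ^ suc r
pow-lower w zero = ≤-reflexive (lem w)
  where
  lem : ∀ w → 1 * 1 + w * 1 ≡ suc w * 1
  lem = solve-∀
pow-lower w (suc r) = begin
  suc (suc r) * w ^ suc r + w * w ^ suc r ≤⟨ m≤m+n _ (suc r * w ^ r) ⟩
  suc (suc r) * (w * w ^ r) + w * (w * w ^ r) + suc r * w ^ r ≡⟨ lem w r (w ^ r) ⟩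
  suc w * (suc r * w ^ r + w * w ^ r) ≤⟨ *-monoʳ-≤ (suc w) (pow-lower w r) ⟩
  suc w * suc w ^ suc r ∎
  where
  open ≤-Reasoning
  lem : ∀ w r p → suc (suc r) * (w * p) + w * (w * p) + suc r * p ≡ suc w * (suc r * p + w * p)
  lem = solve-∀

!*bin≤^ : ∀ w r → r ! * bin w r ≤ w ^ r
!*bin≤^ w zero = ≤-refl
!*bin≤^ zero (suc r) = ≤-reflexive (*-zeroʳ (suc r !))
!*bin≤^ (suc w) (suc r) = begin
  suc r * r ! * bin (suc w) (suc r) ≡⟨ lem (suc r) (r !) (bin (suc w) (suc r)) ⟩
  r ! * (suc r * bin (suc w) (suc r)) ≡⟨ cong (r ! *_) (bin-absorb w r) ⟩
  r ! * (suc w * bin w r) ≡⟨ lem₂ (r !) (suc w) (bin w r) ⟩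
  suc w * (r ! * bin w r) ≤⟨ *-monoʳ-≤ (suc w) (≤-trans (!*bin≤^ w r) (^-monoˡ-≤ r (n≤1+n w))) ⟩
  suc w * suc w ^ r ∎
  where
  open ≤-Reasoning
  lem : ∀ a b c → a * b * c ≡ b * (a * c)
  lem = solve-∀
  lem₂ : ∀ a b c → a * (b * c) ≡ b * (a * c)
  lem₂ = solve-∀

-- The right-hand side is the product of the numbers from `v + 1` to `v + r`.
^≤!*bin : ∀ v r → suc v ^ r ≤ r ! * bin (v + r) r
^≤!*bin v zero = ≤-refl
^≤!*bin v (suc r) = begin
  suc v * suc v ^ r ≤⟨ *-mono-≤ (s≤s (m≤m+n v r)) (^≤!*bin v r) ⟩
  suc (v + r) * (r ! * bin (v + r) r) ≡⟨ lem (suc (v + r)) (r !) (bin (v + r) r) ⟩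
  r ! * (suc (v + r) * bin (v + r) r) ≡⟨ cong (r ! *_) (bin-absorb (v + r) r) ⟨
  r ! * (suc r * bin (suc (v + r)) (suc r)) ≡⟨ lem₂ (r !) (suc r) (bin (suc (v + r)) (suc r)) ⟩
  suc r * r ! * bin (suc (v + r)) (suc r) ≡⟨ cong (λ x → suc r * r ! * bin x (suc r)) (+-suc v r) ⟨
  suc r ! * bin (v + suc r) (suc r) ∎
  where
  open ≤-Reasoning
  lem : ∀ a b c → a * (b * c) ≡ b * (a * c)
  lem = solve-∀
  lem₂ : ∀ a b c → a * (b * c) ≡ b * a * c
  lem₂ = solve-∀

-- Both sides of each inequality are moved so that no subtraction occurs: l! (bin (w + t) l - bin w l) ≤ (w + t) ^ l - w ^ l, and similarly from below.
bin-difference-upper : ∀ w t r → suc r ! * bin (w + t) (suc r) + w ^ suc r ≤ (w + t) ^ suc r + suc r ! * bin w (suc r)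
bin-difference-upper w zero r rewrite +-identityʳ w = ≤-reflexive (+-comm _ (w ^ suc r))
bin-difference-upper w (suc t) r = subst (λ x → suc r ! * bin x (suc r) + w ^ suc r ≤ x ^ suc r + suc r ! * bin w (suc r)) (sym (+-suc w t)) (begin
  l! * (bin x r + bin x (suc r)) + w ^ suc r ≡⟨ lem l! (bin x r) (bin x (suc r)) (w ^ suc r) ⟩
  l! * bin x r + (l! * bin x (suc r) + w ^ suc r) ≤⟨ +-mono-≤ (≤-trans (≤-reflexive (*-assoc (suc r) (r !) (bin x r))) (*-monoʳ-≤ (suc r) (!*bin≤^ x r))) (bin-difference-upper w t r) ⟩
  suc r * x ^ r + (x ^ suc r + l! * bin w (suc r)) ≡⟨ +-assoc (suc r * x ^ r) _ _ ⟨
  suc r * x ^ r + x ^ suc r + l! * bin w (suc r) ≤⟨ +-monoˡ-≤ (l! * bin w (suc r)) (pow-lower x r) ⟩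
  suc x ^ suc r + l! * bin w (suc r) ∎)
  where
  open ≤-Reasoning
  l! = suc r !
  x = w + t
  lem : ∀ a b c d → a * (b + c) + d ≡ a * b + (a * c + d)
  lem = solve-∀

bin-difference-lower : ∀ x b r → (x + b) ^ suc r + suc r ! * bin (x + r) (suc r) ≤ x ^ suc r + suc r ! * bin (x + b + r) (suc r)
bin-difference-lower x zero r rewrite +-identityʳ x = ≤-refl
bin-difference-lower x (suc b) r = subst (λ y → y ^ suc r + l! * bin (x + r) (suc r) ≤ x ^ suc r + l! * bin (y + r) (suc r)) (sym (+-suc x b)) (begin
  suc v ^ suc r + l! * bin (x + r) (suc r) ≡⟨ cong (λ y → y ^ suc r + l! * bin (x + r) (suc r)) (+-comm v 1) ⟨
  (v + 1) ^ suc r + l! * bin (x + r) (suc r) ≤⟨ +-monoˡ-≤ _ (pow-upper v 1 r) ⟩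
  v ^ suc r + suc r * (1 * (v + 1) ^ r) + l! * bin (x + r) (suc r) ≡⟨ lem (v ^ suc r) (suc r * (1 * (v + 1) ^ r)) (l! * bin (x + r) (suc r)) ⟩
  v ^ suc r + l! * bin (x + r) (suc r) + suc r * (1 * (v + 1) ^ r) ≤⟨ +-mono-≤ (bin-difference-lower x b r) step ⟩
  x ^ suc r + l! * bin (v + r) (suc r) + l! * bin (v + r) r ≡⟨ lem₂ (x ^ suc r) l! (bin (v + r) (suc r)) (bin (v + r) r) ⟩
  x ^ suc r + l! * (bin (v + r) r + bin (v + r) (suc r)) ∎)
  where
  open ≤-Reasoning
  l! = suc r !
  v = x + b
  lem : ∀ a b c → a + b + c ≡ a + c + b
  lem = solve-∀
  lem₂ : ∀ a b c d → a + b * c + b * d ≡ a + b * (d + c)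
  lem₂ = solve-∀
  step : suc r * (1 * (v + 1) ^ r) ≤ l! * bin (v + r) r
  step = ≤-trans (*-monoʳ-≤ (suc r) (≤-trans (≤-reflexive (trans (*-identityˡ _) (cong (_^ r) (+-comm v 1)))) (^≤!*bin v r))) (≤-reflexive (sym (*-assoc (suc r) (r !) _)))

*-^ : ∀ a b r → (a * b) ^ r ≡ a ^ r * b ^ r
*-^ a b zero = refl
*-^ a b (suc r) = trans (cong (a * b *_) (*-^ a b r)) (lem a b (a ^ r) (b ^ r))
  where
  lem : ∀ a b c d → a * b * (c * d) ≡ a * c * (b * d)
  lem = solve-∀

-- Shows that the gain is a constant fraction of `n ^ r`. With `x = W - r` one has
-- `2 * n ≤ 8 * x + 8 * r ≤ 8 * x + n`, hence `n ≤ 8 * x`.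
bin-linear : ∀ n W r → n ≤ 4 * W → 8 * r ≤ n → n ^ r ≤ 8 ^ r * (r ! * bin W r)
bin-linear n W r n≤ r≤ = begin
  n ^ r ≤⟨ ^-monoˡ-≤ r n≤8x ⟩
  (8 * x) ^ r ≡⟨ *-^ 8 x r ⟩
  8 ^ r * x ^ r ≤⟨ *-monoʳ-≤ (8 ^ r) (≤-trans (^-monoˡ-≤ r (n≤1+n x)) (^≤!*bin x r)) ⟩
  8 ^ r * (r ! * bin (x + r) r) ≡⟨ cong (λ y → 8 ^ r * (r ! * bin y r)) (m∸n+n≡m r≤W) ⟩
  8 ^ r * (r ! * bin W r) ∎
  where
  open ≤-Reasoning
  x = W ∸ r
  r≤W : r ≤ W
  r≤W = *-cancelˡ-≤ 4 (≤-trans (*-monoˡ-≤ r {4} {8} (s≤s (s≤s (s≤s (s≤s z≤n))))) (≤-trans r≤ n≤))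
  n≤8x : n ≤ 8 * x
  n≤8x = +-cancelʳ-≤ n n (8 * x) (begin
    n + n ≤⟨ +-mono-≤ n≤ n≤ ⟩
    4 * W + 4 * W ≡⟨ cong (λ y → 4 * y + 4 * y) (m∸n+n≡m r≤W) ⟨
    4 * (x + r) + 4 * (x + r) ≡⟨ lem x r ⟩
    8 * x + 8 * r ≤⟨ +-monoʳ-≤ (8 * x) r≤ ⟩
    8 * x + n ∎)
    where
    lem : ∀ x r → 4 * (x + r) + 4 * (x + r) ≡ 8 * x + 8 * r
    lem = solve-∀

-- Division by `W`. The sets that are not rich contribute a multiple of `n ^ suc r₀`, in which one
-- factor `n` is replaced by `4 * W`.
reduce-count : ∀ W u v l r₀ n Λ kb q Q → 1 ≤ W → n ≤ 4 * W → W ≤ n → suc u ≤ n →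
  W * suc (bin u l) ≤ W * bin v l + (W * (Λ + kb * (q * bin W r₀)) + Q * (kb * bin (suc u) (suc r₀))) →
  suc (bin u l) ≤ bin v l + (Λ + kb * ((q + 4 * Q) * n ^ r₀))
reduce-count W u v l r₀ n Λ kb q Q 1≤W n≤4W W≤n u<n h = *-cancelˡ-≤ W {{>-nonZero 1≤W}} (begin
  W * suc (bin u l) ≤⟨ h ⟩
  W * bin v l + (W * (Λ + kb * (q * bin W r₀)) + Q * (kb * bin (suc u) (suc r₀)))
    ≤⟨ +-monoʳ-≤ (W * bin v l) (+-mono-≤ (*-monoʳ-≤ W (+-monoʳ-≤ Λ (*-monoʳ-≤ kb (*-monoʳ-≤ q (≤-trans (bin-≤-^ W r₀) (^-monoˡ-≤ r₀ W≤n))))))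
         (*-monoʳ-≤ Q (*-monoʳ-≤ kb (≤-trans (bin-≤-^ (suc u) (suc r₀)) (≤-trans (^-monoˡ-≤ (suc r₀) u<n) (*-monoˡ-≤ (n ^ r₀) n≤4W)))))) ⟩
  W * bin v l + (W * (Λ + kb * (q * n ^ r₀)) + Q * (kb * (4 * W * n ^ r₀))) ≡⟨ lem W (bin v l) Λ kb q Q (n ^ r₀) ⟩
  W * (bin v l + (Λ + kb * ((q + 4 * Q) * n ^ r₀))) ∎)
  where
  open ≤-Reasoning
  lem : ∀ W v L kb q Q p → W * v + (W * (L + kb * (q * p)) + Q * (kb * (4 * W * p))) ≡ W * (v + (L + kb * ((q + 4 * Q) * p)))
  lem = solve-∀

-- Nothing is discarded here: `t` and `τ` are both `b`, and `z = 1`. Frankl's bound counts on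
-- `suc u` vertices and the degree bound on `u`, which costs `b * n ^ r₀` in addition to the term
-- with `E`. The gain is of order `b * n ^ r`, so `n` is bounded by a constant.
few-blocks : ∀ r₀ W u v y b t₀ n Λ E → let r = suc r₀ ; l = suc r ; c = b + 1 + 1 in
  1 ≤ b → b ≤ t₀ → n ≤ 4 * W → u ≤ n → 8 * r ≤ n → b + y ≡ u → v ≤ y →
  suc (bin u l) ≤ bin v l + (Λ + b * (E * n ^ r₀)) →
  c * (b ^ l * Λ) + c * (b ^ l * bin (suc y) l) + 1 * (b * (b * (b ^ r * bin W r))) ≤ c * (b ^ l * bin (suc u) l) →
  n ≤ 8 ^ r * (r ! * ((t₀ + 2) * (1 + E)))
few-blocks r₀ W u v y b t₀ n Λ E 1≤b b≤t₀ n≤4W u≤n 8r≤n refl v≤y h₁ h₂ = fin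
  where
  open ≤-Reasoning
  r = suc r₀
  l = suc r
  c = b + 1 + 1
  instance
    b≢0 : NonZero b
    b≢0 = >-nonZero 1≤b
  p = n ^ r₀
  cancelled : c * Λ + c * bin (suc y) l + b * bin W r ≤ c * bin (suc u) l
  cancelled = *-cancelˡ-≤ (b ^ l) {{m^n≢0 b l}} (≤-trans (≤-reflexive (lem (b ^ r) b c Λ (bin (suc y) l) (bin W r))) (≤-trans h₂ (≤-reflexive (lem₂ c (b ^ l) (bin (suc u) l)))))
    where
    lem : ∀ B b c L Y w → b * B * (c * L + c * Y + b * w) ≡ c * (b * B * L) + c * (b * B * Y) + 1 * (b * (b * (B * w)))
    lem = solve-∀
    lem₂ : ∀ a b c → a * (b * c) ≡ b * (a * c)
    lem₂ = solve-∀
  gain : b * bin W r ≤ b * ((t₀ + 2) * ((1 + E) * p))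
  gain = +-cancelˡ-≤ (c * (Λ + bin y l + bin y r)) _ _ (begin
    c * (Λ + bin y l + bin y r) + b * bin W r ≡⟨ lem c Λ (bin y l) (bin y r) (b * bin W r) ⟩
    c * Λ + c * (bin y r + bin y l) + b * bin W r ≤⟨ cancelled ⟩
    c * (bin u r + bin u l) ≤⟨ *-monoʳ-≤ c (+-mono-≤ (≤-trans (bin-add-≤ b y r₀) (+-monoʳ-≤ (bin y r) (*-monoʳ-≤ b (≤-trans (bin-≤-^ u r₀) (^-monoˡ-≤ r₀ u≤n)))))
         (≤-trans (n≤1+n _) (≤-trans h₁ (+-monoˡ-≤ _ (bin-mono l v≤y))))) ⟩
    c * (bin y r + b * p + (bin y l + (Λ + b * (E * p)))) ≡⟨ lem₂ c (bin y r) b p (bin y l) Λ E ⟩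
    c * (Λ + bin y l + bin y r) + b * (c * ((1 + E) * p)) ≤⟨ +-monoʳ-≤ (c * (Λ + bin y l + bin y r)) (*-monoʳ-≤ b (*-monoˡ-≤ ((1 + E) * p) (≤-trans (≤-reflexive (+-assoc b 1 1)) (+-monoˡ-≤ 2 b≤t₀)))) ⟩
    c * (Λ + bin y l + bin y r) + b * ((t₀ + 2) * ((1 + E) * p)) ∎)
    where
    lem : ∀ c L y y' w → c * (L + y + y') + w ≡ c * L + c * (y' + y) + w
    lem = solve-∀
    lem₂ : ∀ c y' b p y L E → c * (y' + b * p + (y + (L + b * (E * p)))) ≡ c * (L + y + y') + b * (c * ((1 + E) * p))
    lem₂ = solve-∀
  fin : n ≤ 8 ^ r * (r ! * ((t₀ + 2) * (1 + E)))
  fin = *-cancelʳ-≤ n _ p {{m^n≢0 n r₀ {{>-nonZero n>0}}}} (begin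
    n * p ≤⟨ bin-linear n W r n≤4W 8r≤n ⟩
    8 ^ r * (r ! * bin W r) ≤⟨ *-monoʳ-≤ (8 ^ r) (*-monoʳ-≤ (r !) (*-cancelˡ-≤ b gain)) ⟩
    8 ^ r * (r ! * ((t₀ + 2) * ((1 + E) * p))) ≡⟨ lem (8 ^ r) (r !) (t₀ + 2) (1 + E) p ⟩
    8 ^ r * (r ! * ((t₀ + 2) * (1 + E))) * p ∎)
    where
    n>0 : 0 < n
    n>0 = <-≤-trans z<s 8r≤n
    lem : ∀ a b c d p → a * (b * (c * (d * p))) ≡ a * (b * (c * d)) * p
    lem = solve-∀

-- Both counts, times `l !`, are compared as differences of powers: the degree bound yields at least
-- `(x + b) ^ l - x ^ l`, and Frankl's bound at most `N ^ l - suc y ^ l` on a sample of about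
-- `τ * (x + b) / b` vertices. After scaling by `τ ^ l` and `b ^ l` the main terms agree up to
-- rounding. There remain the gain `G`, the rounding errors, whose factor depends only on `l`, and a
-- term of lower order in `n`.
many-blocks : ∀ r₀ W x y b n Λ E τ z t N c₃ → let r = suc r₀ ; l = suc r ; c = t + 1 + z in
  1 ≤ τ → τ ≤ b → t ≡ τ + l → z + 1 ≤ t → N ≡ suc y + t → n ≤ 4 * W → 8 * r ≤ n → x + b ≤ n → c₃ + l ≤ τ →
  τ * (x + b + l) ≤ b * N → b * N ≤ τ * (x + b) + c₃ * b →
  suc (bin (x + b + r) l) ≤ bin (x + r) l + (Λ + b * (E * n ^ r₀)) →
  c * (τ ^ l * Λ) + c * (b ^ l * bin (suc y) l) + z * (t * (b * (τ ^ r * bin W r))) ≤ c * (b ^ l * bin N l) →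
  z * n ≤ 8 ^ r * (2 * ((l * c₃ + l * l) * 2 ^ r)) * n + 8 ^ r * (2 * (τ * (l ! * E)))
many-blocks r₀ W x y b n Λ E τ z t N c₃ 1≤τ τ≤b et z<t eN n≤4W 8r≤n xb≤n c₃≤τ bN≥ bN≤ h₁ h₂ = fin
  where
  open ≤-Reasoning
  r = suc r₀
  l = suc r
  c = t + 1 + z
  l! = l !
  p = n ^ r₀
  E′ = E * p
  P = τ * (x + b)
  Z = τ * x
  X = b * N
  Y = b * suc y
  R = 2 * (τ * n)
  b≤n : b ≤ n
  b≤n = ≤-trans (m≤n+m b x) xb≤n
  1≤b : 1 ≤ b
  1≤b = ≤-trans 1≤τ τ≤b
  1≤t : 1 ≤ t
  1≤t = ≤-trans (m≤n+m 1 z) z<t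
  lower : (x + b) ^ l ≤ x ^ l + (l! * Λ + l! * (b * E′))
  lower = +-cancelʳ-≤ (l! * bin (x + r) l) _ _ (begin
    (x + b) ^ l + l! * bin (x + r) l ≤⟨ bin-difference-lower x b r ⟩
    x ^ l + l! * bin (x + b + r) l ≤⟨ +-monoʳ-≤ (x ^ l) (*-monoʳ-≤ l! (≤-trans (n≤1+n _) h₁)) ⟩
    x ^ l + l! * (bin (x + r) l + (Λ + b * E′)) ≡⟨ lem (x ^ l) l! (bin (x + r) l) Λ (b * E′) ⟩
    x ^ l + (l! * Λ + l! * (b * E′)) + l! * bin (x + r) l ∎)
    where
    lem : ∀ a b c d e → a + b * (c + (d + e)) ≡ a + (b * d + b * e) + b * c
    lem = solve-∀
  G : ℕ
  G = z * (t * (b * (τ ^ r * (l! * bin W r))))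
  upper : c * (τ ^ l * (l! * Λ)) + G + c * (b ^ l * suc y ^ l) ≤ c * (b ^ l * N ^ l)
  upper = +-cancelʳ-≤ (c * (b ^ l * (l! * bin (suc y) l))) _ _ (begin
    c * (τ ^ l * (l! * Λ)) + G + c * (b ^ l * suc y ^ l) + c * (b ^ l * (l! * bin (suc y) l))
      ≡⟨ lem c (τ ^ l) l! Λ (b ^ l) (bin (suc y) l) (suc y ^ l) z t b (τ ^ r) (bin W r) ⟩
    l! * (c * (τ ^ l * Λ) + c * (b ^ l * bin (suc y) l) + z * (t * (b * (τ ^ r * bin W r)))) + c * (b ^ l * suc y ^ l)
      ≤⟨ +-monoˡ-≤ (c * (b ^ l * suc y ^ l)) (*-monoʳ-≤ l! h₂) ⟩
    l! * (c * (b ^ l * bin N l)) + c * (b ^ l * suc y ^ l) ≡⟨ lem₂ l! c (b ^ l) (bin N l) (suc y ^ l) ⟩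
    c * (b ^ l * (l! * bin N l + suc y ^ l))
      ≤⟨ *-monoʳ-≤ c (*-monoʳ-≤ (b ^ l) (subst (λ N → l! * bin N l + suc y ^ l ≤ N ^ l + l! * bin (suc y) l) (sym eN) (bin-difference-upper (suc y) t r))) ⟩
    c * (b ^ l * (N ^ l + l! * bin (suc y) l)) ≡⟨ lem₃ c (b ^ l) (N ^ l) (l! * bin (suc y) l) ⟩
    c * (b ^ l * N ^ l) + c * (b ^ l * (l! * bin (suc y) l)) ∎)
    where
    lem : ∀ c T l! L B Y y z t b u w → c * (T * (l! * L)) + z * (t * (b * (u * (l! * w)))) + c * (B * y) + c * (B * (l! * Y))
      ≡ l! * (c * (T * L) + c * (B * Y) + z * (t * (b * (u * w)))) + c * (B * y)
    lem = solve-∀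
    lem₂ : ∀ l! c B N y → l! * (c * (B * N)) + c * (B * y) ≡ c * (B * (l! * N + y))
    lem₂ = solve-∀
    lem₃ : ∀ c B N y → c * (B * (N + y)) ≡ c * (B * N) + c * (B * y)
    lem₃ = solve-∀
  Pd≤R : P + c₃ * b + l * b ≤ R
  Pd≤R = begin
    P + c₃ * b + l * b ≡⟨ lem P c₃ l b ⟩
    P + (c₃ + l) * b ≤⟨ +-mono-≤ (*-monoʳ-≤ τ xb≤n) (*-mono-≤ c₃≤τ b≤n) ⟩
    τ * n + τ * n ≡⟨ cong (τ * n +_) (+-identityʳ (τ * n)) ⟨
    R ∎
    where
    lem : ∀ P c l b → P + c * b + l * b ≡ P + (c + l) * b
    lem = solve-∀
  -- Since `suc y = N - t` with `t = τ + l`, the number `Y` is roughly `τ * (x + b) - b * t`; the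
  -- excess `l` of `t` over `τ` accounts for `l * b`.
  Z≤ : Z ≤ Y + l * b
  Z≤ = +-cancelʳ-≤ (b * τ + τ * l) _ _ (begin
    Z + (b * τ + τ * l) ≡⟨ lem τ x b l ⟩
    τ * (x + b + l) ≤⟨ bN≥ ⟩
    b * N ≡⟨ cong (b *_) (trans eN (cong (suc y +_) et)) ⟩
    b * (suc y + (τ + l)) ≤⟨ m≤m+n _ (τ * l) ⟩
    b * (suc y + (τ + l)) + τ * l ≡⟨ lem₂ b (suc y) τ l ⟩
    Y + l * b + (b * τ + τ * l) ∎)
    where
    lem : ∀ τ x b l → τ * x + (b * τ + τ * l) ≡ τ * (x + b + l)
    lem = solve-∀
    lem₂ : ∀ b y τ l → b * (y + (τ + l)) + τ * l ≡ b * y + l * b + (b * τ + τ * l)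
    lem₂ = solve-∀
  Xl : X ^ l ≤ P ^ l + l * (c₃ * b * R ^ r)
  Xl = ≤-trans (^-monoˡ-≤ l bN≤) (≤-trans (pow-upper P (c₃ * b) r) (+-monoʳ-≤ (P ^ l) (*-monoʳ-≤ l (*-monoʳ-≤ (c₃ * b) (^-monoˡ-≤ r (≤-trans (m≤m+n (P + c₃ * b) (l * b)) Pd≤R))))))
  Zl : Z ^ l ≤ Y ^ l + l * (l * b * R ^ r)
  Zl = ≤-trans (^-monoˡ-≤ l Z≤) (≤-trans (pow-upper Y (l * b) r) (+-monoʳ-≤ (Y ^ l) (*-monoʳ-≤ l (*-monoʳ-≤ (l * b) (^-monoˡ-≤ r
    (≤-trans (+-monoˡ-≤ (l * b) (≤-trans (*-monoʳ-≤ b (≤-trans (m≤m+n (suc y) t) (≤-reflexive (sym eN)))) bN≤)) Pd≤R))))))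
  combined : G ≤ c * (l * (c₃ * b * R ^ r) + l * (l * b * R ^ r) + τ ^ l * (l! * (b * E′)))
  combined = +-cancelˡ-≤ (c * P ^ l + c * Y ^ l + c * (τ ^ l * (l! * Λ))) _ _ (begin
    c * P ^ l + c * Y ^ l + c * (τ ^ l * (l! * Λ)) + G ≡⟨ cong₂ (λ a d → c * a + c * d + c * (τ ^ l * (l! * Λ)) + G) (*-^ τ (x + b) l) (*-^ b (suc y) l) ⟩
    c * (τ ^ l * (x + b) ^ l) + c * (b ^ l * suc y ^ l) + c * (τ ^ l * (l! * Λ)) + G ≡⟨ lem c (τ ^ l) ((x + b) ^ l) (b ^ l * suc y ^ l) (l! * Λ) G ⟩
    c * (τ ^ l * (x + b) ^ l) + (c * (τ ^ l * (l! * Λ)) + G + c * (b ^ l * suc y ^ l)) ≤⟨ +-mono-≤ (*-monoʳ-≤ c (*-monoʳ-≤ (τ ^ l) lower)) upper ⟩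
    c * (τ ^ l * (x ^ l + (l! * Λ + l! * (b * E′)))) + c * (b ^ l * N ^ l) ≡⟨ lem₂ c (τ ^ l) (x ^ l) (l! * Λ) (l! * (b * E′)) (b ^ l * N ^ l) ⟩
    c * (τ ^ l * x ^ l) + c * (b ^ l * N ^ l) + (c * (τ ^ l * (l! * Λ)) + c * (τ ^ l * (l! * (b * E′))))
      ≡⟨ cong₂ (λ a d → c * a + c * d + (c * (τ ^ l * (l! * Λ)) + c * (τ ^ l * (l! * (b * E′))))) (*-^ τ x l) (*-^ b N l) ⟨
    c * Z ^ l + c * X ^ l + (c * (τ ^ l * (l! * Λ)) + c * (τ ^ l * (l! * (b * E′)))) ≤⟨ +-monoˡ-≤ _ (+-mono-≤ (*-monoʳ-≤ c Zl) (*-monoʳ-≤ c Xl)) ⟩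
    c * (Y ^ l + l * (l * b * R ^ r)) + c * (P ^ l + l * (c₃ * b * R ^ r)) + (c * (τ ^ l * (l! * Λ)) + c * (τ ^ l * (l! * (b * E′))))
      ≡⟨ lem₃ c (Y ^ l) (l * (l * b * R ^ r)) (P ^ l) (l * (c₃ * b * R ^ r)) (τ ^ l * (l! * Λ)) (τ ^ l * (l! * (b * E′))) ⟩
    c * P ^ l + c * Y ^ l + c * (τ ^ l * (l! * Λ)) + c * (l * (c₃ * b * R ^ r) + l * (l * b * R ^ r) + τ ^ l * (l! * (b * E′))) ∎)
    where
    lem : ∀ c T q w v g → c * (T * q) + c * w + c * (T * v) + g ≡ c * (T * q) + (c * (T * v) + g + c * w)
    lem = solve-∀
    lem₂ : ∀ c T q v e w → c * (T * (q + (v + e))) + c * w ≡ c * (T * q) + c * w + (c * (T * v) + c * (T * e))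
    lem₂ = solve-∀
    lem₃ : ∀ c Y e P d v w → c * (Y + e) + c * (P + d) + (c * v + c * w) ≡ c * P + c * Y + c * v + c * (d + e + w)
    lem₃ = solve-∀
  -- As `z < t`, dividing the gain by `c / t` loses no more than a factor 2, whatever `z` is.
  c≤2t : c ≤ 2 * t
  c≤2t = ≤-trans (≤-reflexive (lem t z)) (+-monoʳ-≤ t (≤-trans z<t (m≤m+n t 0)))
    where
    lem : ∀ t z → t + 1 + z ≡ t + (z + 1)
    lem = solve-∀
  e₀ = l * c₃ + l * l
  scaled : z * (l! * bin W r) ≤ 2 * (e₀ * 2 ^ r * n ^ r + τ * (l! * E′))
  scaled = *-cancelˡ-≤ (t * (b * τ ^ r)) {{m*n≢0 t (b * τ ^ r) {{>-nonZero 1≤t}} {{m*n≢0 b (τ ^ r) {{>-nonZero 1≤b}} {{m^n≢0 τ r {{>-nonZero 1≤τ}}}}}}}} (begin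
    t * (b * τ ^ r) * (z * (l! * bin W r)) ≡⟨ lem t b (τ ^ r) z (l! * bin W r) ⟩
    G ≤⟨ combined ⟩
    c * (l * (c₃ * b * R ^ r) + l * (l * b * R ^ r) + τ ^ l * (l! * (b * E′))) ≤⟨ *-monoˡ-≤ _ c≤2t ⟩
    2 * t * (l * (c₃ * b * R ^ r) + l * (l * b * R ^ r) + τ ^ l * (l! * (b * E′)))
      ≡⟨ cong (λ q → 2 * t * (l * (c₃ * b * q) + l * (l * b * q) + τ ^ l * (l! * (b * E′)))) (trans (*-^ 2 (τ * n) r) (cong (2 ^ r *_) (*-^ τ n r))) ⟩
    2 * t * (l * (c₃ * b * (2 ^ r * (τ ^ r * n ^ r))) + l * (l * b * (2 ^ r * (τ ^ r * n ^ r))) + τ * τ ^ r * (l! * (b * E′)))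
      ≡⟨ lem₂ t l c₃ b (2 ^ r) (τ ^ r) (n ^ r) τ l! E′ ⟩
    t * (b * τ ^ r) * (2 * (e₀ * 2 ^ r * n ^ r + τ * (l! * E′))) ∎)
    where
    lem : ∀ t b T z w → t * (b * T) * (z * w) ≡ z * (t * (b * (T * w)))
    lem = solve-∀
    lem₂ : ∀ t l c b w T q τ l! E → 2 * t * (l * (c * b * (w * (T * q))) + l * (l * b * (w * (T * q))) + τ * T * (l! * (b * E)))
      ≡ t * (b * T) * (2 * ((l * c + l * l) * w * q + τ * (l! * E)))
    lem₂ = solve-∀
  fin : z * n ≤ 8 ^ r * (2 * (e₀ * 2 ^ r)) * n + 8 ^ r * (2 * (τ * (l! * E)))
  fin = *-cancelʳ-≤ _ _ p {{m^n≢0 n r₀ {{>-nonZero n>0}}}} (begin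
    z * n * p ≡⟨ *-assoc z n p ⟩
    z * n ^ r ≤⟨ *-monoʳ-≤ z (bin-linear n W r n≤4W 8r≤n) ⟩
    z * (8 ^ r * (r ! * bin W r)) ≤⟨ *-monoʳ-≤ z (*-monoʳ-≤ (8 ^ r) (*-monoˡ-≤ (bin W r) (m≤m+n (r !) (r * r !)))) ⟩
    z * (8 ^ r * (l! * bin W r)) ≡⟨ lem z (8 ^ r) (l! * bin W r) ⟩
    8 ^ r * (z * (l! * bin W r)) ≤⟨ *-monoʳ-≤ (8 ^ r) scaled ⟩
    8 ^ r * (2 * (e₀ * 2 ^ r * n ^ r + τ * (l! * E′))) ≡⟨ lem₂ (8 ^ r) (e₀ * 2 ^ r) n p τ l! E ⟩
    (8 ^ r * (2 * (e₀ * 2 ^ r)) * n + 8 ^ r * (2 * (τ * (l! * E)))) * p ∎)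
    where
    n>0 : 0 < n
    n>0 = <-≤-trans z<s 8r≤n
    lem : ∀ a b c → a * (b * c) ≡ b * (a * c)
    lem = solve-∀
    lem₂ : ∀ a e n p τ l! E → a * (2 * (e * (n * p) + τ * (l! * (E * p)))) ≡ (a * (2 * e) * n + a * (2 * (τ * (l! * E)))) * p
    lem₂ = solve-∀

-- The final contradiction

-- The proportional share, enlarged by `suc l` to cover rounding down and the fewer than `l`
-- elements that `Dense` removes. A stratum too small for that is taken as a whole.
draws : (τ b l y : ℕ) → .{{NonZero b}} → ℕ
draws τ b l y = y ⊓ (τ * y ℕ./ b + suc l)

draws-cases : ∀ τ b l y .{{_ : NonZero b}} → draws τ b l y ≡ y ⊎ draws τ b l y ≡ τ * y ℕ./ b + suc l
draws-cases τ b l y = ⊓-sel y (τ * y ℕ./ b + suc l)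

quotient-bound : ∀ x b .{{_ : NonZero b}} → x ≤ b * (x ℕ./ b + 1)
quotient-bound x b = begin
  x ≡⟨ m≡m%n+[m/n]*n x b ⟩
  x % b + x ℕ./ b * b ≤⟨ +-monoˡ-≤ (x ℕ./ b * b) (<⇒≤ (m%n<n x b)) ⟩
  b + x ℕ./ b * b ≡⟨ lem b (x ℕ./ b) ⟩
  b * (x ℕ./ b + 1) ∎
  where
  open ≤-Reasoning
  lem : ∀ b x → b + x * b ≡ b * (x + 1)
  lem = solve-∀

draws-lower : ∀ τ b l y .{{_ : NonZero b}} → τ ≤ b → τ * y ≤ b * draws τ b l y
draws-lower τ b l y τ≤b with draws-cases τ b l y
... | inj₁ e = ≤-trans (*-monoˡ-≤ y τ≤b) (≤-reflexive (cong (b *_) (sym e)))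
... | inj₂ e = ≤-trans (quotient-bound (τ * y) b) (≤-trans (*-monoʳ-≤ b (+-monoʳ-≤ (τ * y ℕ./ b) (s≤s z≤n))) (≤-reflexive (cong (b *_) (sym e))))

draws-upper : ∀ τ b l y .{{_ : NonZero b}} → b * draws τ b l y ≤ τ * y + suc l * b
draws-upper τ b l y = ≤-trans (*-monoʳ-≤ b (m⊓n≤n y (τ * y ℕ./ b + suc l))) (≤-trans (≤-reflexive (lem b (τ * y ℕ./ b) (suc l))) (+-monoˡ-≤ (suc l * b) (m/n*n≤m (τ * y) b)))
  where
  lem : ∀ b x l → b * (x + l) ≡ x * b + l * b
  lem = solve-∀

draws-dense : ∀ τ b l y .{{_ : NonZero b}} → τ ≤ b → Dense τ b l y (draws τ b l y)
draws-dense τ b l y τ≤b j j<l with draws-cases τ b l y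
... | inj₁ e = ≤-trans (*-monoˡ-≤ (y ∸ j) τ≤b) (≤-reflexive (cong (λ x → b * (x ∸ j)) (sym e)))
... | inj₂ e = ≤-trans (*-monoʳ-≤ τ (m∸n≤m y j)) (≤-trans (quotient-bound (τ * y) b) (*-monoʳ-≤ b (≤-trans (m+n≤o⇒m≤o∸n (τ * y ℕ./ b + 1)
    (≤-trans (≤-reflexive (+-assoc (τ * y ℕ./ b) 1 j)) (+-monoʳ-≤ (τ * y ℕ./ b) (≤-trans j<l (n≤1+n l))))) (≤-reflexive (cong (_∸ j) (sym e))))))

module Arithmetic (r W G g b u n v : ℕ) (1≤r : 1 ≤ r) where

  l k : ℕ
  l = suc r
  k = suc l

  module _ (en : W + (k * g + k * b) ≡ n) (eu : W + (l * g + k * b) ≡ suc u) (big : 2 * (l * (suc (g + b))) ≤ n) (hv : v + suc (g + b) ≤ n) where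
    open ≤-Reasoning

    n≡ : n ≡ suc u + g
    n≡ = trans (sym en) (trans (lem W r g b) (cong (_+ g) eu))
      where
      lem : ∀ W r g b → W + (suc (suc r) * g + suc (suc r) * b) ≡ W + (suc r * g + suc (suc r) * b) + g
      lem = solve-∀

    -- Deleting one vertex of each good edge removes `g` vertices and lowers the requirement by
    -- `2 * l * g`.
    u-big : 2 * (l * suc b) ≤ suc u
    u-big = +-cancelʳ-≤ g _ _ (begin
      2 * (l * suc b) + g ≤⟨ m≤m+n _ (g + 2 * (r * g)) ⟩
      2 * (l * suc b) + g + (g + 2 * (r * g)) ≡⟨ lem r b g ⟩
      2 * (l * suc (g + b)) ≤⟨ big ⟩
      n ≡⟨ n≡ ⟩
      suc u + g ∎)
      where
      lem : ∀ r b g → 2 * (suc r * suc b) + g + (g + 2 * (r * g)) ≡ 2 * (suc r * suc (g + b))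
      lem = solve-∀

    -- Because `2 * l = k + r`, at least `r` vertices per edge of the matching remain besides the
    -- `k` covered ones.
    W-big : r * (g + b) + 2 * l ≤ W
    W-big = +-cancelʳ-≤ (k * (g + b)) _ _ (begin
      r * (g + b) + 2 * l + k * (g + b) ≡⟨ lem r g b ⟩
      2 * (l * suc (g + b)) ≤⟨ big ⟩
      n ≡⟨ en ⟨
      W + (k * g + k * b) ≡⟨ cong (W +_) (*-distribˡ-+ k g b) ⟨
      W + k * (g + b) ∎)
      where
      lem : ∀ r g b → r * (g + b) + 2 * suc r + suc (suc r) * (g + b) ≡ 2 * (suc r * suc (g + b))
      lem = solve-∀

    W-pos : 1 ≤ W
    W-pos = ≤-trans (≤-trans {1} {2 * l} (s≤s z≤n) (m≤n+m (2 * l) (r * (g + b)))) W-big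

    -- Since `k = r + 2 ≤ 3 * r`, `W-big` bounds the covered vertices by three times the uncovered
    -- ones.
    n≤4W : n ≤ 4 * W
    n≤4W = begin
      n ≡⟨ en ⟨
      W + (k * g + k * b) ≡⟨ cong (W +_) (*-distribˡ-+ k g b) ⟨
      W + k * (g + b) ≤⟨ +-monoʳ-≤ W (begin
        k * (g + b) ≤⟨ *-monoˡ-≤ (g + b) (≤-trans (+-monoˡ-≤ r (+-mono-≤ 1≤r 1≤r)) (≤-reflexive (lem r))) ⟩
        3 * r * (g + b) ≡⟨ *-assoc 3 r (g + b) ⟩
        3 * (r * (g + b)) ≤⟨ *-monoʳ-≤ 3 (≤-trans (m≤m+n _ (2 * l)) W-big) ⟩
        3 * W ∎) ⟩
      W + 3 * W ∎
      where
      lem : ∀ r → r + r + r ≡ 3 * r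
      lem = solve-∀

    W≤n : W ≤ n
    W≤n = ≤-trans (m≤m+n W (k * g + k * b)) (≤-reflexive en)

    su≤n : suc u ≤ n
    su≤n = ≤-trans (m≤m+n (suc u) g) (≤-reflexive (sym n≡))

    v+b≤u : v + b ≤ u
    v+b≤u = ≤-pred (+-cancelʳ-≤ g _ _ (≤-trans (≤-reflexive (lem v b g)) (≤-trans hv (≤-reflexive n≡))))
      where
      lem : ∀ v b g → suc (v + b) + g ≡ v + suc (g + b)
      lem = solve-∀

few-blocks-room : ∀ r b u y → b + y ≡ u → 2 * (suc r * suc b) ≤ suc u → r * (2 * b + 1 + 1) ≤ y
few-blocks-room r b u y refl h = +-cancelʳ-≤ (suc b) _ _ (begin
  r * (2 * b + 1 + 1) + suc b ≤⟨ m≤m+n _ (suc b) ⟩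
  r * (2 * b + 1 + 1) + suc b + suc b ≡⟨ lem r b ⟩
  2 * (suc r * suc b) ≤⟨ h ⟩
  suc (b + y) ≡⟨ lem₂ b y ⟩
  y + suc b ∎)
  where
  open ≤-Reasoning
  lem : ∀ r b → r * (2 * b + 1 + 1) + suc b + suc b ≡ 2 * (suc r * suc b)
  lem = solve-∀
  lem₂ : ∀ b y → suc (b + y) ≡ y + suc b
  lem₂ = solve-∀

few-blocks-room′ : ∀ r W G b u y → W + (G + suc (suc r) * b) ≡ suc u → b + y ≡ u → 1 ≤ r → 1 ≤ b → W ≤ y
few-blocks-room′ r W G b u y e refl 1≤r 1≤b = +-cancelʳ-≤ (suc b) _ _ (begin
  W + suc b ≤⟨ +-monoʳ-≤ W (≤-trans (+-monoˡ-≤ b 1≤b) (≤-trans (m≤m+n (b + b) (r * b)) (≤-reflexive (lem b r)))) ⟩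
  W + suc (suc r) * b ≤⟨ +-monoʳ-≤ W (m≤n+m (suc (suc r) * b) G) ⟩
  W + (G + suc (suc r) * b) ≡⟨ e ⟩
  suc (b + y) ≡⟨ lem₂ b y ⟩
  y + suc b ∎)
  where
  open ≤-Reasoning
  lem : ∀ b r → b + b + r * b ≡ suc (suc r) * b
  lem = solve-∀
  lem₂ : ∀ b y → suc (b + y) ≡ y + suc b
  lem₂ = solve-∀

-- The constant `c₃` sums up the excess of the sample: `k * l` since `l` more blocks than the
-- proportional `τ` are drawn, `suc l` from each of the two uses of `draws`, and `l` from writing
-- `x + b` for `suc u`.
module ManyBlocks (r τ z t b c₃ W G u x : ℕ) .{{_ : NonZero b}} (1≤r : 1 ≤ r) (1≤τ : 1 ≤ τ) (τ≤b : τ ≤ b) (et : t ≡ τ + suc r)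
  (ec : c₃ ≡ suc r + (suc (suc r) * suc r + 2 * suc (suc r))) (room : suc t + r * (2 * t + 1 + z) ≤ 2 * (suc r * τ))
  (eu : W + (G + suc (suc r) * b) ≡ suc u) (ex : x + b + suc r ≡ suc u) (u-big : 2 * (suc r * suc b) ≤ suc u) where

  open ≤-Reasoning
  l k pW pG N y : ℕ
  l = suc r
  k = suc l
  pW = draws τ b l W
  pG = draws τ b l G
  N = pW + (pG + k * t)

  N-lower : τ * (x + b + l) ≤ b * N
  N-lower = begin
    τ * (x + b + l) ≡⟨ cong (τ *_) (trans ex (sym eu)) ⟩
    τ * (W + (G + k * b)) ≡⟨ lem τ W G k b ⟩
    τ * W + (τ * G + b * (k * τ)) ≤⟨ +-mono-≤ (draws-lower τ b l W τ≤b) (+-mono-≤ (draws-lower τ b l G τ≤b) (*-monoʳ-≤ b (*-monoʳ-≤ k (≤-trans (m≤m+n τ l) (≤-reflexive (sym et)))))) ⟩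
    b * pW + (b * pG + b * (k * t)) ≡⟨ lem₂ b pW pG (k * t) ⟩
    b * N ∎
    where
    lem : ∀ τ W G k b → τ * (W + (G + k * b)) ≡ τ * W + (τ * G + b * (k * τ))
    lem = solve-∀
    lem₂ : ∀ b p q w → b * p + (b * q + b * w) ≡ b * (p + (q + w))
    lem₂ = solve-∀

  N-upper : b * N ≤ τ * (x + b) + c₃ * b
  N-upper = begin
    b * N ≡⟨ trans (cong (λ t → b * (pW + (pG + k * t))) et) (lem b pW pG k τ l) ⟩
    b * pW + (b * pG + (τ * (k * b) + k * l * b)) ≤⟨ +-mono-≤ (draws-upper τ b l W) (+-monoˡ-≤ _ (draws-upper τ b l G)) ⟩
    τ * W + suc l * b + (τ * G + suc l * b + (τ * (k * b) + k * l * b)) ≡⟨ lem₂ τ W G (suc l) k l b ⟩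
    τ * (W + (G + k * b)) + (k * l + 2 * suc l) * b ≡⟨ cong (λ w → τ * w + (k * l + 2 * suc l) * b) (trans eu (sym ex)) ⟩
    τ * (x + b + l) + (k * l + 2 * suc l) * b ≡⟨ lem₃ τ (x + b) l (k * l + 2 * suc l) b ⟩
    τ * (x + b) + (τ * l + (k * l + 2 * suc l) * b) ≤⟨ +-monoʳ-≤ (τ * (x + b)) (+-monoˡ-≤ _ (≤-trans (*-monoˡ-≤ l τ≤b) (≤-reflexive (*-comm b l)))) ⟩
    τ * (x + b) + (l * b + (k * l + 2 * suc l) * b) ≡⟨ cong (τ * (x + b) +_) (trans (sym (*-distribʳ-+ b l (k * l + 2 * suc l))) (cong (_* b) (sym ec))) ⟩
    τ * (x + b) + c₃ * b ∎
    where
    lem : ∀ b p q k τ l → b * (p + (q + k * (τ + l))) ≡ b * p + (b * q + (τ * (k * b) + k * l * b))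
    lem = solve-∀
    lem₂ : ∀ τ W G s k l b → τ * W + s * b + (τ * G + s * b + (τ * (k * b) + k * l * b)) ≡ τ * (W + (G + k * b)) + (k * l + 2 * s) * b
    lem₂ = solve-∀
    lem₃ : ∀ τ x l c b → τ * (x + l) + c * b ≡ τ * x + (τ * l + c * b)
    lem₃ = solve-∀

  N-big : 2 * (l * τ) ≤ N
  N-big = *-cancelˡ-≤ b (begin
    b * (2 * (l * τ)) ≤⟨ m≤m+n _ (τ * (2 * l)) ⟩
    b * (2 * (l * τ)) + τ * (2 * l) ≡⟨ lem b l τ ⟩
    τ * (2 * (l * suc b)) ≤⟨ *-monoʳ-≤ τ (≤-trans u-big (≤-reflexive (sym ex))) ⟩
    τ * (x + b + l) ≤⟨ N-lower ⟩
    b * N ∎)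
    where
    lem : ∀ b l τ → b * (2 * (l * τ)) + τ * (2 * l) ≡ τ * (2 * (l * suc b))
    lem = solve-∀

  y = N ∸ suc t

  N≡ : N ≡ y + suc t
  N≡ = sym (m∸n+n≡m (≤-trans (m≤m+n (suc t) (r * (2 * t + 1 + z))) (≤-trans room N-big)))

  y-room : r * (2 * t + 1 + z) ≤ y
  y-room = +-cancelˡ-≤ (suc t) _ _ (≤-trans room (≤-trans N-big (≤-reflexive (trans N≡ (+-comm y (suc t))))))

  pW≤y : pW ≤ y
  pW≤y = m+n≤o⇒m≤o∸n pW (+-monoʳ-≤ pW (≤-trans (≤-trans (+-monoˡ-≤ t (≤-trans 1≤τ (≤-trans (m≤m+n τ l) (≤-reflexive (sym et))))) (≤-trans (m≤m+n (t + t) (r * t)) (≤-reflexive (lem t r)))) (m≤n+m (k * t) pG)))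
    where
    lem : ∀ t r → t + t + r * t ≡ suc (suc r) * t
    lem = solve-∀

module Contradiction (_≟A_ : DecidableEquality A)
  (edge : List A → Bool) (edge-ext : ∀ {f g} → (∀ {x} → x ∈ f → x ∈ g) → (∀ {x} → x ∈ g → x ∈ f) → edge f ≡ edge g)
  (r₀ Q q t₀ : ℕ) (budget : (3 + r₀ + 1) * (suc t₀ * (3 + r₀)) ≤ q) (q≤Q : q + suc r₀ ≤ Q)
  (ws : List A) (good : List (A × List A)) (bl : List (List A))
  (uniq : Unique (ws ++ (concat (map blockOf good) ++ concat bl)))
  (good-edges : ∀ p → p ∈ good → edge (blockOf p) ≡ true) (bad-edges : ∀ e → e ∈ bl → edge e ≡ true)
  (maximal : ∀ M → All (λ e → edge e ≡ true) M → AllPairs Disjoint M → length M ≡ suc (length good + length bl) → ⊥)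
  (heavy : ∀ p → p ∈ good → Rich.Heavy edge Q ws q r₀ (proj₁ p))
  (light : ∀ x → x ∈ concat bl → ¬ Rich.Heavy edge Q ws q r₀ x)
  (good-sizes : ∀ p → p ∈ good → length (proj₂ p) ≡ suc (suc r₀)) (bad-sizes : ∀ e → e ∈ bl → length e ≡ suc (suc (suc r₀)))
  (N v : ℕ) (lenN : length (ws ++ (concat (map blockOf good) ++ concat bl)) ≡ suc N)
  (deg : ∀ w → w ∈ ws → ∀ rest → ws ++ (concat (map blockOf good) ++ concat bl) ↭ w ∷ rest →
    suc (bin N (suc (suc r₀))) ≤ ∑ (combs (suc (suc r₀)) rest) (λ f → bit (edge (w ∷ f))) + bin v (suc (suc r₀)))
  where

  module Lo = Local _≟A_ edge edge-ext r₀ Q q t₀ budget q≤Q ws good bl uniq good-edges bad-edges maximal heavy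
  open Rich edge Q ws

  r l k W G g b order Λ : ℕ
  r = suc r₀
  l = suc r
  k = suc l
  W = length ws
  G = length Lo.gs
  g = length good
  b = length bl
  order = suc N
  Λ = Lo.Λ

  lenG : G ≡ l * g
  lenG = trans (length-concat l (map proj₂ good) sized) (cong (l *_) (length-map proj₂ good))
    where
    sized : ∀ e → e ∈ map proj₂ good → length e ≡ l
    sized e m with ∈-map⁻ proj₂ m
    ... | p , p∈ , refl = good-sizes p p∈

  len-blocks : length (concat (map blockOf good)) ≡ k * g
  len-blocks = trans (length-concat k (map blockOf good) sized) (cong (k *_) (length-map blockOf good))
    where
    sized : ∀ e → e ∈ map blockOf good → length e ≡ k
    sized e m with ∈-map⁻ blockOf m
    ... | p , p∈ , refl = cong suc (good-sizes p p∈)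

  len-bad : length (concat bl) ≡ k * b
  len-bad = length-concat k bl bad-sizes

  en : W + (k * g + k * b) ≡ order
  en = trans (sym (trans (length-++ ws) (cong (W +_) (trans (length-++ (concat (map blockOf good))) (cong₂ _+_ len-blocks len-bad))))) lenN

  module Numbers (u : ℕ) (lenu : length ws + (length Lo.gs + length (concat bl)) ≡ suc u)
    (big : 2 * (l * suc (g + b)) ≤ order) (hv : v + suc (g + b) ≤ order) (8r≤n : 8 * r ≤ order) where

    eu : W + (G + k * b) ≡ suc u
    eu = trans (cong (λ c → W + (G + c)) (sym len-bad)) lenu

    eu′ : W + (l * g + k * b) ≡ suc u
    eu′ = trans (cong (λ c → W + (c + k * b)) (sym lenG)) eu

    lenus : length Lo.us ≡ suc u
    lenus = trans (length-++ ws) (trans (cong (W +_) (length-++ Lo.gs)) lenu)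

    module Ar = Arithmetic r W (length Lo.gs) g b u order v (s≤s z≤n)

    W-pos = Ar.W-pos en eu′ big hv
    n≤4W = Ar.n≤4W en eu′ big hv
    W≤n = Ar.W≤n en eu′ big hv
    su≤n = Ar.su≤n en eu′ big hv
    u-big = Ar.u-big en eu′ big hv
    v+b≤u = Ar.v+b≤u en eu′ big hv

    uniq-us : Unique (ws ++ (Lo.gs ++ concat bl))
    uniq-us = Lo.unique-us

    count : ∀ E → E ≡ k * (q + 4 * Q) → suc (bin u l) ≤ bin v l + (Λ + b * (E * order ^ r₀))
    count E refl = subst (λ x → suc (bin u l) ≤ bin v l + (Λ + x)) (lem k b (q + 4 * Q) (order ^ r₀))
      (subst (λ c → suc (bin u l) ≤ bin v l + (Λ + c * ((q + 4 * Q) * order ^ r₀))) len-bad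
      (reduce-count W u v l r₀ order Λ (length (concat bl)) q Q W-pos n≤4W W≤n su≤n
        (subst (λ x → W * suc (bin u l) ≤ W * bin v l + (W * (Λ + length (concat bl) * (q * bin W r₀)) + Q * (length (concat bl) * bin x r))) lenus
          (Lo.local-count N u v (q * bin W r₀) lenus lenN deg (λ x x∈ → ≮⇒≥ (light x x∈))))))
      where
      lem : ∀ k b e p → k * b * (e * p) ≡ b * (k * e * p)
      lem = solve-∀

    zero-case : b ≡ 0 → ⊥
    zero-case b≡0 = Lo.no-blocks N u v (empty bl b≡0) lenus lenN W-pos (≤-trans (m≤m+n v b) v+b≤u) deg
      where
      empty : ∀ (bs : List (List A)) → length bs ≡ 0 → concat bs ≡ []
      empty [] _ = refl

    few-case : ∀ E → E ≡ k * (q + 4 * Q) → 1 ≤ b → b ≤ t₀ → order ≤ 8 ^ r * (r ! * ((t₀ + 2) * (1 + E)))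
    few-case E eE 1≤b b≤t₀ = few-blocks r₀ W u v (u ∸ b) b t₀ order Λ E 1≤b b≤t₀ n≤4W (<⇒≤ su≤n) 8r≤n by (m+n≤o⇒m≤o∸n v v+b≤u) (count E eE)
      (subst (λ m → (b + 1 + 1) * (b ^ l * Λ) + (b + 1 + 1) * (b ^ l * bin (suc (u ∸ b)) l) + 1 * (b * (b * (b ^ r * bin W r))) ≤ (b + 1 + 1) * (b ^ l * bin m l)) sy
        (sampled-frankl rich ws Lo.gs bl r k b 1 (u ∸ b) b b W (length Lo.gs) uniq-us bad-sizes
          (λ j _ → ≤-refl) (λ j _ → ≤-refl) (λ j _ → ≤-refl) ≤-refl ≤-refl ≤-refl ≤-refl
          (trans eu (sym sy)) (few-blocks-room′ r W (length Lo.gs) b u (u ∸ b) eu by (s≤s z≤n) 1≤b) (few-blocks-room r b u (u ∸ b) by u-big)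
          (λ bs bs∈ → Lo.no-family b bs b≤t₀ bs∈)))
      where
      by : b + (u ∸ b) ≡ u
      by = m+[n∸m]≡n (≤-trans (m≤n+m b v) v+b≤u)
      sy : (u ∸ b) + suc b ≡ suc u
      sy = trans (+-suc (u ∸ b) b) (cong suc (trans (+-comm (u ∸ b) b) by))

    many-case : ∀ E → E ≡ k * (q + 4 * Q) → ∀ τ z c₃ → t₀ < b → 1 ≤ τ → t₀ ≡ τ + l → z + 1 ≤ t₀ → c₃ + l ≤ τ →
      c₃ ≡ l + (k * l + 2 * k) → suc t₀ + r * (2 * t₀ + 1 + z) ≤ 2 * (l * τ) →
      z * order ≤ 8 ^ r * (2 * ((l * c₃ + l * l) * 2 ^ r)) * order + 8 ^ r * (2 * (τ * (l ! * E)))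
    many-case E eE τ z c₃ t₀<b 1≤τ et z<t c₃≤τ ec room = many-blocks r₀ W x Mb.y b order Λ E τ z t₀ Mb.N c₃ 1≤τ τ≤b et z<t
        (trans Mb.N≡ (+-suc Mb.y t₀)) n≤4W 8r≤n (≤-trans (≤-trans (m≤m+n (x + b) l) (≤-reflexive ex)) su≤n) c₃≤τ Mb.N-lower Mb.N-upper
        (subst (λ w → suc (bin w l) ≤ bin (x + r) l + (Λ + b * (E * order ^ r₀))) (sym ux) (≤-trans (count E eE) (+-monoˡ-≤ _ (bin-mono l v≤))))
        (subst (λ m → (t₀ + 1 + z) * (τ ^ l * Λ) + (t₀ + 1 + z) * (b ^ l * bin (suc Mb.y) l) + z * (t₀ * (b * (τ ^ r * bin W r))) ≤ (t₀ + 1 + z) * (b ^ l * bin m l)) (sym Mb.N≡)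
          (sampled-frankl rich ws Lo.gs bl r k t₀ z Mb.y τ b Mb.pW Mb.pG uniq-us bad-sizes
            (draws-dense τ b l W τ≤b) (draws-dense τ b l (length Lo.gs) τ≤b) dB (m⊓n≤m W _) (m⊓n≤m (length Lo.gs) _) (<⇒≤ t₀<b) τ≤b
            Mb.N≡ Mb.pW≤y Mb.y-room (λ bs bs∈ → Lo.no-family t₀ bs ≤-refl bs∈)))
      where
      τ≤b : τ ≤ b
      τ≤b = ≤-trans (m≤m+n τ l) (≤-trans (≤-reflexive (sym et)) (<⇒≤ t₀<b))
      instance
        b≢0 : NonZero b
        b≢0 = >-nonZero (≤-trans 1≤τ τ≤b)
      x : ℕ
      x = suc u ∸ (b + l)
      room-u : b + l ≤ suc u
      room-u = ≤-trans (≤-trans (m≤m+n (b + l) (b + l + 2 * (r * b))) (≤-reflexive (lem b r))) u-big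
        where
        lem : ∀ b r → b + suc r + (b + suc r + 2 * (r * b)) ≡ 2 * (suc r * suc b)
        lem = solve-∀
      ex : x + b + l ≡ suc u
      ex = trans (+-assoc x b l) (m∸n+n≡m room-u)
      ux : x + b + r ≡ u
      ux = suc-injective (trans (sym (+-suc (x + b) r)) ex)
      v≤ : v ≤ x + r
      v≤ = +-cancelʳ-≤ b v (x + r) (≤-trans v+b≤u (≤-reflexive (trans (sym ux) (lem x b r))))
        where
        lem : ∀ x b r → x + b + r ≡ x + r + b
        lem = solve-∀
      -- This is the reason for `t₀ = τ + l`: with fewer than `l` blocks removed, at least `τ` drawn
      -- blocks are left.
      dB : Dense τ b l b t₀
      dB j j<l = ≤-trans (*-monoʳ-≤ τ (m∸n≤m b j)) (≤-trans (≤-reflexive (*-comm τ b)) (*-monoʳ-≤ b (m+n≤o⇒m≤o∸n τ (≤-trans (+-monoʳ-≤ τ (<⇒≤ j<l)) (≤-reflexive (sym et))))))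
      module Mb = ManyBlocks r τ z t₀ b c₃ W (length Lo.gs) u x (s≤s z≤n) 1≤τ τ≤b et ec room eu ex u-big

  U : ℕ
  U = W + (G + length (concat bl))

  U-pos : 2 * (l * suc (g + b)) ≤ order → 0 < U
  U-pos big = positive r U g b (≤-trans big (≤-reflexive (trans (sym en) (trans (lem W r g b) (cong (_+ g) (cong (W +_) (cong₂ _+_ (sym lenG) (sym len-bad))))))))
    where
    positive : ∀ l T g b → 2 * (suc l * suc (g + b)) ≤ T + g → 0 < T
    positive l (suc T) g b h = z<s
    positive l zero g b h = ⊥-elim (1+n≰n (≤-trans (≤-trans (s≤s (m≤m+n g b)) (≤-trans (m≤m+n (suc (g + b)) (l * suc (g + b))) (m≤m+n (suc l * suc (g + b)) _))) h))
    lem : ∀ W r g b → W + (suc (suc r) * g + suc (suc r) * b) ≡ W + (suc r * g + suc (suc r) * b) + g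
    lem = solve-∀

  absurd : ∀ E τ z c₃ → 2 * (l * suc (g + b)) ≤ order → v + suc (g + b) ≤ order → 8 * r ≤ order → E ≡ k * (q + 4 * Q) →
    8 ^ r * (r ! * ((t₀ + 2) * (1 + E))) < order →
    1 ≤ τ → t₀ ≡ τ + l → z + 1 ≤ t₀ → c₃ + l ≤ τ → c₃ ≡ l + (k * l + 2 * k) → suc t₀ + r * (2 * t₀ + 1 + z) ≤ 2 * (l * τ) →
    z ≡ suc (8 ^ r * (2 * ((l * c₃ + l * l) * 2 ^ r))) → 8 ^ r * (2 * (τ * (l ! * E))) < order → ⊥
  absurd E τ z c₃ big hv 8r≤n eE few< 1≤τ et z<t c₃≤τ ec room z≡ many< = cases (b ≟ 0)
    where
    module Nu = Numbers (pred U) (sym (suc-pred U {{>-nonZero (U-pos big)}})) big hv 8r≤n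
    cases : Dec (b ≡ 0) → ⊥
    cases (yes b≡0) = Nu.zero-case b≡0
    cases (no b≢0) with b ≤? t₀
    ... | yes b≤ = <-irrefl refl (<-≤-trans few< (Nu.few-case E eE (n≢0⇒n>0 b≢0) b≤))
    -- As `z` exceeds `K` by one, cancelling `K * order` leaves a single `order` below a constant.
    ... | no b> = <-irrefl refl (<-≤-trans many< (+-cancelˡ-≤ (K * order) _ _
            (≤-trans (≤-reflexive (trans (+-comm (K * order) order) (cong (_* order) (sym z≡)))) (Nu.many-case E eE τ z c₃ (≰⇒> b>) 1≤τ et z<t c₃≤τ ec room))))
      where
      K = 8 ^ r * (2 * ((l * c₃ + l * l) * 2 ^ r))

-- From subsets to lists

same-members-↭ : {xs ys : List A} → Unique xs → Unique ys → (∀ {x} → x ∈ xs → x ∈ ys) → (∀ {x} → x ∈ ys → x ∈ xs) → xs ↭ ys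
same-members-↭ u v f g = ∼bag⇒↭ (unique∧set⇒bag u v (mk⇔ f g))

fromList : List (Fin n) → S.Subset n
fromList [] = S.⊥
fromList (x ∷ f) = S.⁅ x ⁆ S.∪ fromList f

∈-fromList⁺ : {x : Fin n} (f : List (Fin n)) → x ∈ f → x S.∈ fromList f
∈-fromList⁺ (y ∷ f) (here refl) = SP.x∈p∪q⁺ (inj₁ (SP.x∈⁅x⁆ y))
∈-fromList⁺ (y ∷ f) (there p) = SP.x∈p∪q⁺ (inj₂ (∈-fromList⁺ f p))

∈-fromList⁻ : {x : Fin n} (f : List (Fin n)) → x S.∈ fromList f → x ∈ f
∈-fromList⁻ [] p = ⊥-elim (SP.∉⊥ p)
∈-fromList⁻ (y ∷ f) p with SP.x∈p∪q⁻ S.⁅ y ⁆ (fromList f) p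
... | inj₁ q = here (SP.x∈⁅y⁆⇒x≡y y q)
... | inj₂ q = there (∈-fromList⁻ f q)

fromList-ext : (f : List (Fin n)) {p : S.Subset n} → (∀ {x} → x ∈ f → x S.∈ p) → (∀ {x} → x S.∈ p → x ∈ f) → fromList f ≡ p
fromList-ext f h h' = SP.⊆-antisym (λ q → h (∈-fromList⁻ f q)) (λ q → ∈-fromList⁺ f (h' q))

members : S.Subset n → List (Fin n)
members [] = []
members (true ∷ p) = zero ∷ map suc (members p)
members (false ∷ p) = map suc (members p)

length-members : (p : S.Subset n) → length (members p) ≡ S.∣ p ∣
length-members [] = refl
length-members (true ∷ p) = cong suc (trans (length-map suc (members p)) (length-members p))
length-members (false ∷ p) = trans (length-map suc (members p)) (length-members p)

∈-members⁺ : {x : Fin n} {p : S.Subset n} → x S.∈ p → x ∈ members p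
∈-members⁺ {p = true ∷ p} Vec.here = here refl
∈-members⁺ {p = true ∷ p} (Vec.there q) = there (∈-map⁺ suc (∈-members⁺ q))
∈-members⁺ {p = false ∷ p} (Vec.there q) = ∈-map⁺ suc (∈-members⁺ q)

∈-members⁻ : {x : Fin n} (p : S.Subset n) → x ∈ members p → x S.∈ p
∈-members⁻ (true ∷ p) (here refl) = Vec.here
∈-members⁻ (true ∷ p) (there q) with ∈-map⁻ suc q
... | y , y∈ , refl = Vec.there (∈-members⁻ p y∈)
∈-members⁻ (false ∷ p) q with ∈-map⁻ suc q
... | y , y∈ , refl = Vec.there (∈-members⁻ p y∈)

members-unique : (p : S.Subset n) → Unique (members p)
members-unique [] = []
members-unique (true ∷ p) = All.tabulate (λ {x} m e → case ∈-map⁻ suc (subst (_∈ map suc (members p)) (sym e) m) of λ { (_ , _ , ()) }) ∷ UniqueP.map⁺ FinP.suc-injective (members-unique p)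
members-unique (false ∷ p) = UniqueP.map⁺ FinP.suc-injective (members-unique p)

filter-∈-combs : ∀ {P : A → Set} (P? : ∀ x → Dec (P x)) (xs : List A) → filter P? xs ∈ combs (length (filter P? xs)) xs
filter-∈-combs P? [] = here refl
filter-∈-combs P? (x ∷ xs) with does (P? x)
... | true = ∈-++⁺ˡ (∈-map⁺ (x ∷_) (filter-∈-combs P? xs))
... | false with length (filter P? xs) | filter-∈-combs P? xs
...   | zero | h = h
...   | suc i | h = ∈-++⁺ʳ (map (x ∷_) (combs i xs)) h

_≟S_ : DecidableEquality (S.Subset n)
_≟S_ = VecP.≡-dec BoolP._≟_

module Edges {k N : ℕ} (H : KGraph k N) where

  open DecMem (_≟S_ {N}) using (_∈?_)

  edge : List (Fin N) → Bool
  edge f = does (fromList f ∈? edges H)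

  edge⁻ : ∀ f → edge f ≡ true → fromList f ∈ edges H
  edge⁻ f e with fromList f ∈? edges H
  ... | yes p = p

  edge⁺ : ∀ f → fromList f ∈ edges H → edge f ≡ true
  edge⁺ f p = dec-true (fromList f ∈? edges H) p

  edge-ext : ∀ {f g} → (∀ {x} → x ∈ f → x ∈ g) → (∀ {x} → x ∈ g → x ∈ f) → edge f ≡ edge g
  edge-ext {f} {g} h h' = cong (λ p → does (p ∈? edges H)) (fromList-ext f (λ q → ∈-fromList⁺ g (h q)) (λ q → h' (∈-fromList⁻ g q)))

  fromList-members : ∀ (e : S.Subset N) → fromList (members e) ≡ e
  fromList-members e = fromList-ext (members e) (∈-members⁻ e) (λ q → ∈-members⁺ {p = e} q)

  edge-size : ∀ {e} → e ∈ edges H → S.∣ e ∣ ≡ k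
  edge-size = All.lookup (uniform H)

  -- An edge at `w` consists of `w` and the sublist of `rest` that lies in it. A sublist represents
  -- at most one edge, because the edge list has no repetitions.
  degree-≤ : ∀ l w rest → k ≡ suc l → allFin N ↭ w ∷ rest → degree H w ≤ ∑ (combs l rest) (λ f → bit (edge (w ∷ f)))
  degree-≤ l w rest refl pm = begin
    length star ≡⟨ trans (sym (*-identityʳ _)) (sym (∑-const star 1)) ⟩
    ∑ star (λ _ → 1) ≤⟨ ∑-mono-∈ star represented ⟩
    ∑ star (λ e → ∑ (combs l rest) (λ f → bit (does (e ≟S fromList (w ∷ f))))) ≡⟨ ∑-swap star (combs l rest) _ ⟩
    ∑ (combs l rest) (λ f → ∑ star (λ e → bit (does (e ≟S fromList (w ∷ f))))) ≤⟨ ∑-mono (combs l rest) once ⟩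
    ∑ (combs l rest) (λ f → bit (edge (w ∷ f))) ∎
    where
    open ≤-Reasoning
    star = filter (λ e → w SP.∈? e) (edges H)
    uniq : Unique (w ∷ rest)
    uniq = unique-↭ pm (UniqueP.allFin⁺ N)
    once : ∀ f → ∑ star (λ e → bit (does (e ≟S fromList (w ∷ f)))) ≤ bit (edge (w ∷ f))
    once f with fromList (w ∷ f) ∈? edges H
    ... | yes _ = ∑-eq≤1 _≟S_ (UniqueP.filter⁺ (λ e → w SP.∈? e) (simple H)) (fromList (w ∷ f))
    ... | no ∉E = ≤-reflexive (∑-zero-∈ star absent)
      where
      absent : ∀ e → e ∈ star → bit (does (e ≟S fromList (w ∷ f))) ≡ 0
      absent e m with e ≟S fromList (w ∷ f)
      ... | no _ = refl
      ... | yes refl = ⊥-elim (∉E (proj₁ (∈-filter⁻ (λ e → w SP.∈? e) m)))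
    represented : ∀ e → e ∈ star → 1 ≤ ∑ (combs l rest) (λ f → bit (does (e ≟S fromList (w ∷ f))))
    represented e m = ≤-trans (≤-reflexive (sym (bit-true (dec-true (e ≟S fromList (w ∷ f₀)) (sym whole))))) (∑-term (λ f → bit (does (e ≟S fromList (w ∷ f)))) f₀∈)
      where
      w∈e : w S.∈ e
      w∈e = proj₂ (∈-filter⁻ (λ e → w SP.∈? e) {xs = edges H} m)
      f₀ = filter (λ x → x SP.∈? e) rest
      sub : ∀ {x} → x ∈ w ∷ f₀ → x S.∈ e
      sub (here refl) = w∈e
      sub (there p) = proj₂ (∈-filter⁻ (λ x → x SP.∈? e) {xs = rest} p)
      sup : ∀ {x} → x S.∈ e → x ∈ w ∷ f₀
      sup {x} p with ∈-resp-↭ pm (∈-allFin x)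
      ... | here eq = here eq
      ... | there q = there (∈-filter⁺ (λ x → x SP.∈? e) q p)
      whole : fromList (w ∷ f₀) ≡ e
      whole = fromList-ext (w ∷ f₀) sub sup
      uniq₀ : Unique (w ∷ f₀)
      uniq₀ with uniq
      ... | w∉ ∷ u = All.tabulate (λ p → All.lookup w∉ (proj₁ (∈-filter⁻ (λ x → x SP.∈? e) {xs = rest} p))) ∷ UniqueP.filter⁺ (λ x → x SP.∈? e) u
      len₀ : length f₀ ≡ l
      len₀ = suc-injective (trans (↭-length (same-members-↭ uniq₀ (members-unique e) (λ p → ∈-members⁺ (sub p)) (λ p → sup (∈-members⁻ e p))))
        (trans (length-members e) (edge-size (proj₁ (∈-filter⁻ (λ e → w SP.∈? e) m)))))
      f₀∈ : f₀ ∈ combs l rest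
      f₀∈ = subst (λ i → f₀ ∈ combs i rest) len₀ (filter-∈-combs (λ x → x SP.∈? e) rest)

-- Enlarging a matching

-- Meant for heaviness as `Good`: a block with a good vertex is stored as that vertex and the rest,
-- the form in which `Local` keeps the vertex and exchanges the rest.
record Split {A : Set} (Good : A → Set) (M : List (List A)) : Set where
  field
    good   : List (A × List A)
    bad    : List (List A)
    perm   : concat (map blockOf good) ++ concat bad ↭ concat M
    count  : length good + length bad ≡ length M
    good-∈ : ∀ p → p ∈ good → Σ (List A) λ e → e ∈ M × blockOf p ↭ e
    bad-∈  : ∀ e → e ∈ bad → e ∈ M
    heavy  : ∀ p → p ∈ good → Good (proj₁ p)
    light  : ∀ x → x ∈ concat bad → ¬ Good x

split : {Good : A → Set} (good? : ∀ x → Dec (Good x)) (M : List (List A)) → Split Good M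
split good? [] = record { good = [] ; bad = [] ; perm = ↭-refl ; count = refl ; good-∈ = λ _ () ; bad-∈ = λ _ () ; heavy = λ _ () ; light = λ _ () }
split {Good = Good} good? (e ∷ M) with any? good? e | split good? M
... | no none-good | R = record
  { good = R.good ; bad = e ∷ R.bad
  ; perm = ↭-trans (PermP.shifts (concat (map blockOf R.good)) e) (PermP.++⁺ˡ e R.perm)
  ; count = trans (+-suc (length R.good) (length R.bad)) (cong suc R.count)
  ; good-∈ = λ p m → let (e' , m' , q) = R.good-∈ p m in e' , there m' , q
  ; bad-∈ = λ { _ (here refl) → here refl ; e' (there m) → there (R.bad-∈ e' m) }
  ; heavy = R.heavy
  ; light = λ x m → case ∈-++⁻ e m of λ { (inj₁ q) g → none-good (lose q g) ; (inj₂ q) → R.light x q }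
  }
  where
  module R = Split R
... | yes some-good | R with find some-good
...   | u , u∈ , gu with ∈-∃++ u∈
...     | as , bs , refl = record
  { good = (u , as ++ bs) ∷ R.good ; bad = R.bad
  ; perm = ↭-trans (Perm.↭-reflexive (++-assoc (u ∷ as ++ bs) (concat (map blockOf R.good)) (concat R.bad))) (PermP.++⁺ (↭-sym (PermP.shift u as bs)) R.perm)
  ; count = cong suc R.count
  ; good-∈ = λ { _ (here refl) → as ++ u ∷ bs , here refl , ↭-sym (PermP.shift u as bs) ; p (there m) → let (e' , m' , q) = R.good-∈ p m in e' , there m' , q }
  ; bad-∈ = λ e' m → there (R.bad-∈ e' m)
  ; heavy = λ { _ (here refl) → gu ; p (there m) → R.heavy p m }
  ; light = R.light
  }
  where module R = Split R

-- The constants are variables here and enter only through the relations listed; `matching-theorem`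
-- supplies the values of `Constants`.
module Enlarge (r₀ z τ t₀ q Q E c₃ : ℕ) (budget : (3 + r₀ + 1) * (suc t₀ * (3 + r₀)) ≤ q) (q≤Q : q + suc r₀ ≤ Q) (eE : E ≡ (3 + r₀) * (q + 4 * Q))
  (1≤τ : 1 ≤ τ) (et : t₀ ≡ τ + (2 + r₀)) (z<t : z + 1 ≤ t₀) (c₃≤τ : c₃ + (2 + r₀) ≤ τ) (ec : c₃ ≡ (2 + r₀) + ((3 + r₀) * (2 + r₀) + 2 * (3 + r₀)))
  (room : suc t₀ + suc r₀ * (2 * t₀ + 1 + z) ≤ 2 * ((2 + r₀) * τ))
  {N : ℕ} (H : KGraph (3 + r₀) (suc N)) (m : ℕ) (big : 2 * ((2 + r₀) * m) ≤ suc N) (8r≤n : 8 * suc r₀ ≤ suc N)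
  (few< : 8 ^ suc r₀ * (suc r₀ ! * ((t₀ + 2) * (1 + E))) < suc N)
  (z≡ : z ≡ suc (8 ^ suc r₀ * (2 * (((2 + r₀) * c₃ + (2 + r₀) * (2 + r₀)) * 2 ^ suc r₀))))
  (many< : 8 ^ suc r₀ * (2 * (τ * ((2 + r₀) ! * E))) < suc N)
  (deg : ∀ v → suc (bin N (2 + r₀)) ≤ degree H v + bin (suc N ∸ m) (2 + r₀))
  (M : List (S.Subset (suc N))) (matching : IsMatching H M) (M<m : length M < m)
  (maximal : ∀ M' → IsMatching H M' → length M' ≡ suc (length M) → ⊥)
  where

  open Edges H
  open DecMem (FinP._≟_ {suc N}) using (_∈?_)

  V : Set
  V = Fin (suc N)

  blocks : List (List V)
  blocks = map members M

  covered : List V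
  covered = concat blocks

  ws : List V
  ws = filter (λ v → ¬? (v ∈? covered)) (allFin (suc N))

  open Rich edge Q ws

  from-blocks : ∀ {e} → e ∈ blocks → Σ (S.Subset (suc N)) λ p → p ∈ M × e ≡ members p
  from-blocks m = ∈-map⁻ members m

  in-H : ∀ {p} → p ∈ M → p ∈ edges H
  in-H = All.lookup (proj₁ matching)

  block-edge : ∀ {e} → e ∈ blocks → edge e ≡ true
  block-edge m with from-blocks m
  ... | p , p∈ , refl = edge⁺ (members p) (subst (_∈ edges H) (sym (fromList-members p)) (in-H p∈))

  block-size : ∀ {e} → e ∈ blocks → length e ≡ 3 + r₀
  block-size m with from-blocks m
  ... | p , p∈ , refl = trans (length-members p) (edge-size (in-H p∈))

  unique-covered : Unique covered
  unique-covered = UniqueP.concat⁺ (AllP.map⁺ (All.tabulate (λ {p} _ → members-unique p)))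
    (AllPairsP.map⁺ (AllPairs.map {R = λ e f → S.Empty (e S.∩ f)} {S = λ e f → Disjoint (members e) (members f)} (λ {e} {f} empty {x} (a , b) → empty (x , SP.x∈p∩q⁺ (∈-members⁻ e a , ∈-members⁻ f b))) (proj₂ matching)))

  unique-split : Unique (ws ++ covered)
  unique-split = UniqueP.++⁺ (UniqueP.filter⁺ (λ v → ¬? (v ∈? covered)) (UniqueP.allFin⁺ (suc N))) unique-covered
    (λ { (a , b) → proj₂ (∈-filter⁻ (λ v → ¬? (v ∈? covered)) {xs = allFin (suc N)} a) b })

  module _ (R : Split (Heavy q r₀) blocks) where

    good = Split.good R
    bl = Split.bad R

    all-↭ : ws ++ (concat (map blockOf good) ++ concat bl) ↭ allFin (suc N)
    all-↭ = ↭-trans (PermP.++⁺ˡ ws (Split.perm R)) (same-members-↭ unique-split (UniqueP.allFin⁺ (suc N)) (λ {x} _ → ∈-allFin x) locate)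
      where
      locate : ∀ {x} → x ∈ allFin (suc N) → x ∈ ws ++ covered
      locate {x} m with x ∈? covered
      ... | yes p = ∈-++⁺ʳ ws p
      ... | no ¬p = ∈-++⁺ˡ (∈-filter⁺ (λ v → ¬? (v ∈? covered)) m ¬p)

    count : length good + length bl ≡ length M
    count = trans (Split.count R) (length-map members M)

    no-larger : ∀ M' → All (λ e → edge e ≡ true) M' → AllPairs Disjoint M' → length M' ≡ suc (length good + length bl) → ⊥
    no-larger M' ed dis len = maximal (map fromList M') (AllP.map⁺ (All.map (λ {f} → edge⁻ f) ed) ,
      AllPairsP.map⁺ (AllPairs.map {R = Disjoint} {S = λ e f → S.Empty (fromList e S.∩ fromList f)} (λ {e} {f} d (x , x∈) → case SP.x∈p∩q⁻ (fromList e) (fromList f) x∈ of λ { (a , b) → d (∈-fromList⁻ e a , ∈-fromList⁻ f b) }) dis))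
      (trans (length-map fromList M') (trans len (cong suc count)))

    good-edges : ∀ p → p ∈ good → edge (blockOf p) ≡ true
    good-edges p m with Split.good-∈ R p m
    ... | e , e∈ , pm = trans (edge-ext (∈-resp-↭ pm) (∈-resp-↭ (↭-sym pm))) (block-edge e∈)

    good-sizes : ∀ p → p ∈ good → length (proj₂ p) ≡ 2 + r₀
    good-sizes p m with Split.good-∈ R p m
    ... | e , e∈ , pm = suc-injective (trans (↭-length pm) (block-size e∈))

    s<m : suc (length good + length bl) ≤ m
    s<m = subst (_< m) (sym count) M<m

    split-⊥ : ⊥
    split-⊥ = Contradiction.absurd FinP._≟_ edge edge-ext r₀ Q q t₀ budget q≤Q ws good bl (unique-↭ (↭-sym all-↭) (UniqueP.allFin⁺ (suc N)))
      good-edges (λ e m → block-edge (Split.bad-∈ R e m)) no-larger (Split.heavy R) (Split.light R) good-sizes (λ e m → block-size (Split.bad-∈ R e m))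
      N (suc N ∸ m) (trans (↭-length all-↭) (length-tabulate (λ x → x)))
      (λ w w∈ rest pm → ≤-trans (deg w) (+-monoˡ-≤ _ (degree-≤ (2 + r₀) w rest refl (↭-trans (↭-sym all-↭) pm))))
      E τ z c₃ (≤-trans (*-monoʳ-≤ 2 (*-monoʳ-≤ (2 + r₀) s<m)) big)
      (≤-trans (+-monoʳ-≤ (suc N ∸ m) s<m) (≤-reflexive (m∸n+n≡m (≤-trans (≤-trans (m≤m+n m _) (m≤m+n ((2 + r₀) * m) _)) big))))
      8r≤n eE few< 1≤τ et z<t c₃≤τ ec room z≡ many<

  contradiction : ⊥
  contradiction = split-⊥ (split (λ u → q * bin (length ws) r₀ <? ∑ (combs (suc r₀) ws) (λ g → bit (rich (u ∷ g)))) blocks)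

bin≡C : ∀ n k → bin n k ≡ n C k
bin≡C n zero = sym (trans (nCk≡nC[n∸k] {0} {n} z≤n) (nCn≡1 n))
bin≡C zero (suc k) = sym (k>n⇒nCk≡0 {0} {suc k} z<s)
bin≡C (suc n) (suc k) = trans (cong₂ _+_ (bin≡C n k) (bin≡C n (suc k))) (nCk+nC[k+1]≡[n+1]C[k+1] n k)

-- Search for matchings of a given size

tuples : List A → ℕ → List (List A)
tuples xs zero = [] ∷ []
tuples xs (suc j) = cartesianProductWith _∷_ xs (tuples xs j)

∈-tuples⁺ : {xs ys : List A} → All (_∈ xs) ys → ys ∈ tuples xs (length ys)
∈-tuples⁺ [] = here refl
∈-tuples⁺ (p ∷ ps) = ∈-cartesianProductWith⁺ _∷_ p (∈-tuples⁺ ps)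

∈-tuples⁻ : ∀ (xs : List A) j {ys} → ys ∈ tuples xs j → All (_∈ xs) ys × length ys ≡ j
∈-tuples⁻ xs zero (here refl) = [] , refl
∈-tuples⁻ xs (suc j) m with ∈-cartesianProductWith⁻ _∷_ xs (tuples xs j) m
... | x , ys , x∈ , ys∈ , refl with ∈-tuples⁻ xs j ys∈
...   | ps , e = x∈ ∷ ps , cong suc e

MatchingOfSize : ∀ {k n} → KGraph k n → ℕ → Set
MatchingOfSize {n = n} H j = Σ (List (S.Subset n)) λ M → IsMatching H M × length M ≡ j

-- Exhaustive search through tuples of edges makes the appeal to a maximum matching constructive.
matching-of-size? : ∀ {k n} (H : KGraph k n) j → Dec (MatchingOfSize H j)
matching-of-size? H j with any? (AllPairs.allPairs? (λ e f → ¬? (SP.nonempty? (e S.∩ f)))) (tuples (edges H) j)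
... | yes p with find p
...   | M , M∈ , dis = yes (M , (proj₁ (∈-tuples⁻ (edges H) j M∈) , dis) , proj₂ (∈-tuples⁻ (edges H) j M∈))
matching-of-size? H j | no ¬p = no λ { (M , (sub , dis) , refl) → ¬p (lose (∈-tuples⁺ sub) dis) }

-- The size grows by one at a time: if there is no matching of size `suc s`, the one of size `s` is
-- maximum, and `step` refutes that.
build-matching : ∀ {k n} (H : KGraph k n) m →
  (∀ M → IsMatching H M → length M < m → (∀ M' → IsMatching H M' → length M' ≡ suc (length M) → ⊥) → ⊥) →
  ∀ s → s ≤ m → MatchingOfSize H s
build-matching H m step zero _ = [] , ([] , []) , refl
build-matching H m step (suc s) s<m with matching-of-size? H (suc s) | build-matching H m step s (<⇒≤ s<m)
... | yes p | _ = p
... | no ¬p | M , mt , refl = ⊥-elim (step M mt s<m (λ M' mt' e → ¬p (M' , mt' , e)))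

-- The definitions follow the dependence: `c₃` and `K` measure the sampling error in terms of `l`;
-- `z` makes the gain exceed it; `τ` leaves room for `z` further classes; `q` and `Q′` pay for the
-- exchanges caused by `suc t₀` new edges; `n₀` exceeds the constants that remain.
module Constants (r₀ : ℕ) where
  r l k c₃ K z τ t₀ q Q′ E n₀ : ℕ
  r = suc r₀
  l = suc r
  k = suc l
  c₃ = l + (k * l + 2 * k)
  K = 8 ^ r * (2 * ((l * c₃ + l * l) * 2 ^ r))
  z = suc K
  τ = l * (z + 2 * l + 1)
  t₀ = τ + l
  q = (k + 1) * (suc t₀ * k)
  Q′ = q + r
  E = k * (q + 4 * Q′)
  n₀ = suc (8 ^ r * (r ! * ((t₀ + 2) * (1 + E))) + (8 ^ r * (2 * (τ * (l ! * E))) + 8 * r))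

τ-lower : ∀ l z → z ≤ suc l * (z + 2 * suc l + 1)
τ-lower l z = ≤-trans (≤-trans (m≤m+n z (2 * suc l)) (m≤m+n (z + 2 * suc l) 1)) (m≤m+n _ _)

-- With `l = suc r`, the averaging needs about `(2 * l - 1) * τ` of the `2 * l * τ` vertices. The
-- `τ` left over must cover `r * z` and terms in `l`, and the chosen value does so with a surplus of
-- `z + r + 1`.
room-bound : ∀ r z → suc (suc r * (z + 2 * suc r + 1) + suc r) + r * (2 * (suc r * (z + 2 * suc r + 1) + suc r) + 1 + z) ≤ 2 * (suc r * (suc r * (z + 2 * suc r + 1)))
room-bound r z = ≤-trans (m≤m+n _ (z + r + 1)) (≤-reflexive (lem r z))
  where
  lem : ∀ r z → suc (suc r * (z + 2 * suc r + 1) + suc r) + r * (2 * (suc r * (z + 2 * suc r + 1) + suc r) + 1 + z) + (z + r + 1) ≡ 2 * (suc r * (suc r * (z + 2 * suc r + 1)))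
  lem = solve-∀

c₃-bound : ∀ l c r → c + suc l ≤ 8 ^ r * (2 * ((suc l * c + suc l * suc l) * 2 ^ r))
c₃-bound l c r = begin
  c + suc l ≤⟨ m≤m+n _ (l * (c + suc l)) ⟩
  suc l * (c + suc l) ≡⟨ *-distribˡ-+ (suc l) c (suc l) ⟩
  e ≤⟨ m≤m*n e (2 ^ r) {{m^n≢0 2 r}} ⟩
  e * 2 ^ r ≤⟨ m≤m+n _ _ ⟩
  2 * (e * 2 ^ r) ≤⟨ m≤n*m (2 * (e * 2 ^ r)) (8 ^ r) {{m^n≢0 8 r}} ⟩
  8 ^ r * (2 * (e * 2 ^ r)) ∎
  where
  open ≤-Reasoning
  e = suc l * c + suc l * suc l

matching-theorem : ∀ r₀ N m (H : KGraph (3 + r₀) (suc N)) → Constants.n₀ r₀ ≤ suc N → 2 * ((2 + r₀) * m) ≤ suc N →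
  (∀ v → suc (bin N (2 + r₀)) ≤ degree H v + bin (suc N ∸ m) (2 + r₀)) → MatchingOfSize H m
matching-theorem r₀ N m H n₀≤ big deg = build-matching H m step m ≤-refl
  where
  open Constants r₀
  few many : ℕ
  few = 8 ^ r * (r ! * ((t₀ + 2) * (1 + E)))
  many = 8 ^ r * (2 * (τ * (l ! * E)))
  z≤τ : z ≤ τ
  z≤τ = τ-lower r z
  step : ∀ M → IsMatching H M → length M < m → (∀ M' → IsMatching H M' → length M' ≡ suc (length M) → ⊥) → ⊥
  step M mt lt mx = Enlarge.contradiction r₀ z τ t₀ q Q′ E c₃ ≤-refl ≤-refl refl (≤-trans (s≤s z≤n) z≤τ) refl
    (+-mono-≤ z≤τ (s≤s z≤n)) (≤-trans (c₃-bound r c₃ r) (≤-trans (n≤1+n K) z≤τ)) refl (room-bound r z)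
    H m big (≤-trans (≤-trans (≤-trans (m≤n+m (8 * r) many) (m≤n+m (many + 8 * r) few)) (n≤1+n _)) n₀≤)
    (≤-trans (s≤s (m≤m+n few (many + 8 * r))) n₀≤) refl (≤-trans (s≤s (≤-trans (m≤m+n many (8 * r)) (m≤n+m (many + 8 * r) few))) n₀≤)
    deg M mt lt mx

-- Transfer from the rational hypothesis

open import Data.Integer as ℤ using (+_)
import Data.Integer.Properties as ℤP
open import Data.Rational using (ℚ; 0ℚ; 1ℚ; _/_; _÷_; _-_)
import Data.Rational as Q
import Data.Rational.Properties as QP
import Data.Rational.Unnormalised as Qᵘ
import Data.Rational.Unnormalised.Properties as QᵘP

reciprocal-bounds : ∀ d .{{_ : NonZero d}} → (0ℚ Q.< (+ 1) / suc d) × ((+ 1) / suc d Q.< (+ 1) / d)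
reciprocal-bounds (suc d) = QP.toℚᵘ-cancel-< (QᵘP.<-respʳ-≃ (QᵘP.≃-sym (QP.toℚᵘ-fromℚᵘ (Qᵘ.mkℚᵘ (+ 1) (suc d)))) (Qᵘ.*<* (ℤ.+<+ z<s)))
  , QP.toℚᵘ-cancel-< (QᵘP.<-respˡ-≃ (QᵘP.≃-sym (QP.toℚᵘ-fromℚᵘ (Qᵘ.mkℚᵘ (+ 1) (suc d)))) (QᵘP.<-respʳ-≃ (QᵘP.≃-sym (QP.toℚᵘ-fromℚᵘ (Qᵘ.mkℚᵘ (+ 1) d)))
      (Qᵘ.*<* (ℤ.+<+ (+-monoˡ-< 0 (n<1+n (suc d)))))))

-- With x = k / d and y = n / k the product x * y is n / d.
size-bound-from-ℚ : ∀ d k n m β → 0ℚ Q.< β → (+ m / 1) Q.≤ ((+ suc k / suc d) - β) Q.* (+ n / suc k) → suc d * m ≤ n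
size-bound-from-ℚ d k n m β 0<β h = *-cancelˡ-≤ (suc k) (ℤP.drop‿+≤+ (subst₂ ℤ._≤_ left right (QᵘP.drop-*≤* product)))
  where
  x = + suc k / suc d
  y = + n / suc k
  xᵘ = Qᵘ.mkℚᵘ (+ suc k) d
  yᵘ = Qᵘ.mkℚᵘ (+ n) k
  y≥0 : Q.NonNegative y
  y≥0 = QP.normalize-nonNeg n (suc k)
  x-β≤x : x - β Q.≤ x
  x-β≤x = QP.≤-trans (QP.+-monoʳ-≤ x (QP.neg-antimono-≤ (QP.<⇒≤ 0<β))) (QP.≤-reflexive (QP.+-identityʳ x))
  h′ : (+ m / 1) Q.≤ x Q.* y
  h′ = QP.≤-trans h (QP.*-monoʳ-≤-nonNeg y {{y≥0}} x-β≤x)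
  product : Qᵘ.mkℚᵘ (+ m) 0 Qᵘ.≤ xᵘ Qᵘ.* yᵘ
  product = QᵘP.≤-respˡ-≃ (QP.toℚᵘ-fromℚᵘ (Qᵘ.mkℚᵘ (+ m) 0)) (QᵘP.≤-respʳ-≃
    (QᵘP.≃-trans (QP.toℚᵘ-homo-* x y) (QᵘP.*-cong (QP.toℚᵘ-fromℚᵘ xᵘ) (QP.toℚᵘ-fromℚᵘ yᵘ))) (QP.toℚᵘ-mono-≤ h′))
  left : + m ℤ.* Qᵘ.↧ (xᵘ Qᵘ.* yᵘ) ≡ + (suc k * (suc d * m))
  left = trans (sym (ℤP.pos-* m (suc d * suc k))) (cong +_ (lem m (suc d) (suc k)))
    where
    lem : ∀ m d k → m * (d * k) ≡ k * (d * m)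
    lem = solve-∀
  right : Qᵘ.↥ (xᵘ Qᵘ.* yᵘ) ℤ.* + 1 ≡ + (suc k * n)
  right = trans (ℤP.*-identityʳ _) (sym (ℤP.pos-* (suc k) n))

theorem1p3 : (k : ℕ) → (hk : 3 ≤ k) →
    Σ ℚ λ β → (0ℚ Q.< β) × (β Q.< _/_ (+ 1) (betaDen k) {{nz-betaDen k hk}}) ×
    Σ ℕ λ n₀ → (n : ℕ) → n₀ ≤ n →
    (m : ℕ) → 1 ≤ m →
    (+ m / 1) Q.≤ (_/_ (+ k) (2 * (k ∸ 1)) {{nz-2k-1 k hk}} - β) Q.* (_/_ (+ n) k {{nz-k k hk}}) →
    (H : KGraph k n) →
    MinDegreeGreaterThan H (((n ∸ 1) C (k ∸ 1)) ∸ ((n ∸ m) C (k ∸ 1))) →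
    MatchingNumberAtLeast H m
theorem1p3 zero ()
theorem1p3 (suc zero) (s≤s ())
theorem1p3 (suc (suc zero)) (s≤s (s≤s ()))
theorem1p3 k@(suc (suc (suc r₀))) hk = β , proj₁ bounds , proj₂ bounds , Constants.n₀ r₀ , conclude
  where
  β : ℚ
  β = (+ 1) / suc (betaDen k)
  bounds : (0ℚ Q.< β) × (β Q.< _/_ (+ 1) (betaDen k) {{nz-betaDen k hk}})
  bounds = reciprocal-bounds (betaDen k) {{nz-betaDen k hk}}
  conclude : (n : ℕ) → Constants.n₀ r₀ ≤ n → (m : ℕ) → 1 ≤ m →
    (+ m / 1) Q.≤ (_/_ (+ k) (2 * (k ∸ 1)) {{nz-2k-1 k hk}} - β) Q.* (_/_ (+ n) k {{nz-k k hk}}) →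
    (H : KGraph k n) → MinDegreeGreaterThan H (((n ∸ 1) C (k ∸ 1)) ∸ ((n ∸ m) C (k ∸ 1))) → MatchingNumberAtLeast H m
  conclude (suc N) n₀≤ m _ h H deg = let (M , mt , len) = matching-theorem r₀ N m H n₀≤ small deg′ in M , mt , ≤-reflexive (sym len)
    where
    l : ℕ
    l = suc (suc r₀)
    small : 2 * (l * m) ≤ suc N
    -- The denominator `2 * l` reduces to `suc (suc r₀ + 1 * l)`, so the first argument is its
    -- predecessor.
    small = ≤-trans (≤-reflexive (sym (*-assoc 2 l m))) (size-bound-from-ℚ (suc r₀ + 1 * l) (suc (suc r₀)) (suc N) m β (proj₁ bounds) h)
    deg′ : ∀ v → suc (bin N l) ≤ degree H v + bin (suc N ∸ m) l
    -- The truncated subtraction of the degree condition is undone by `a ≤ b + (a ∸ b)`.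
    deg′ v = subst₂ (λ a b → suc a ≤ degree H v + b) (sym (bin≡C N l)) (sym (bin≡C (suc N ∸ m) l))
      (≤-trans (s≤s (m≤n+m∸n (N C l) ((suc N ∸ m) C l))) (≤-trans (≤-reflexive (sym (+-suc ((suc N ∸ m) C l) (N C l ∸ (suc N ∸ m) C l))))
        (≤-trans (+-monoʳ-≤ ((suc N ∸ m) C l) (deg v)) (≤-reflexive (+-comm ((suc N ∸ m) C l) (degree H v))))))
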